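{- Let $A,D,E$ be multiplicative characters of $\mathbb{F}_q$ such that $A^2$, $E^2$, $A^2\overline{D^2}\,\overline{E^2}$, $A^2D^2\overline{E^2}$ are all different from $\varepsilon$, $A^2\neq D^2$ and $D^2\neq E^2$. Then for every $z\in\mathbb{F}_q$ with $z\neq1$, \begin{align*} &{}_2F_1(A^2,E^2;\,D^2\mid z)\,{}_2F_1(D^2\overline{E^2},\overline{E^2};\,A^2\overline{E^2}\mid z)\\ &=\frac{E^2(z)}{q}\,\delta(1-z^2)+\frac{AD\overline{E}(4)\,(\overline{A^2}\,\overline{D^2}E^2)(1-z)\,g(A\overline{E}\,\overline{D})\,g(\overline{A}ED\varphi)}{g(\varphi)}\\ &\qquad\times{}_4F_3\!\left(A^2,D^2\overline{E^2},AD\overline{E},AD\overline{E}\varphi;\,A^2D^2\overline{E^2},D^2,A^2\overline{E^2}\;\middle|\;\frac{ -4z}{(1-z)^2}\right). \end{align*}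
   Context: Let $p$ be an odd prime, $q=p^r$, and $\mathbb{F}_q$ the field with $q$ elements. Multiplicative characters of $\mathbb{F}_q^\times$ are extended to $\mathbb{F}_q$ by $\chi(0)=0$ (including the trivial character $\varepsilon$). $\varphi$ is the quadratic character. Characters are multiplied pointwise, $\overline{A}$ is the inverse of $A$, and an expression like $(\overline{A^2}\,\overline{D^2}E^2)(1-z)$ means the product character evaluated at $1-z$. For $x\in\mathbb{F}_q$, $\delta(x)=1$ if $x=0$ and $0$ otherwise. The Gauss sum is $g(\chi)=\sum_{x\in\mathbb{F}_q}\chi(x)\theta(x)$ with $\theta(\alpha)=\zeta_p^{\mathrm{tr}(\alpha)}$, $\zeta_p$ a fixed primitive $p$-th root of unity, $\mathrm{tr}$ the trace to $\mathbb{F}_p$. The binomial coefficient is $\binom{A}{B}=\frac{B(-1)}{q}\sum_{x\in\mathbb{F}_q}A(x)\overline{B}(1-x)$. Greene's series: ${}_{n+1}F_n(A_0,\dots,A_n;\,B_1,\dots,B_n\mid x)=\frac{q}{q-1}\sum_{\chi}\binom{A_0\chi}{\chi}\prod_{i=1}^n\binom{A_i\chi}{B_i\chi}\chi(x)$, summed over all multiplicative characters $\chi$. -}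

module Defs where

open import Level using (0ℓ)
open import Data.Nat as ℕ using (ℕ; zero; suc)
open import Data.List using (List; []; _∷_; foldr; map; length)
open import Data.List.Membership.Propositional using (_∈_)
open import Data.List.Relation.Unary.Unique.Propositional using (Unique)
open import Data.List.Relation.Unary.Any using (Any; any?)
open import Data.List.Relation.Unary.All using (All)
open import Data.List.Relation.Unary.AllPairs using (AllPairs)
open import Data.Vec using (Vec; []; _∷_)
open import Data.Bool using (Bool; true; false; if_then_else_)
open import Relation.Nullary using (¬_; Dec; yes; no)
open import Relation.Nullary.Decidable using (⌊_⌋)
open import Relation.Binary.PropositionalEquality using (_≡_; _≢_)
open import Relation.Binary.Definitions using (DecidableEquality)
open import Algebra.Bundles using (CommutativeRing)
open import Algebra.Structures using (IsCommutativeRing)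

-- A finite field F_q (propositional equality, explicit enumeration).
-- The inverse 0 ⁻¹ is an arbitrary (unspecified) element.

record FiniteField : Set₁ where
  infixl 7 _*_
  infixl 6 _+_
  field
    Carrier   : Set
    _+_ _*_   : Carrier → Carrier → Carrier
    -_        : Carrier → Carrier
    _⁻¹       : Carrier → Carrier
    0# 1#     : Carrier
    isCommutativeRing : IsCommutativeRing _≡_ _+_ _*_ -_ 0# 1#
    0≢1       : 0# ≢ 1#
    inverseʳ  : ∀ x → x ≢ 0# → x * (x ⁻¹) ≡ 1#
    _≟_       : DecidableEquality Carrier
    elements  : List Carrier
    complete  : ∀ x → x ∈ elements
    unique    : Unique elements

  size : ℕ
  size = length elements

ringFromℕ : (R : CommutativeRing 0ℓ 0ℓ) → ℕ → CommutativeRing.Carrier R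
ringFromℕ R zero    = CommutativeRing.0# R
ringFromℕ R (suc n) = CommutativeRing._+_ R (CommutativeRing.1# R) (ringFromℕ R n)

-- The coefficient field: a field of characteristic 0 (stands in for ℂ).

record CharZeroField : Set₁ where
  field
    cring : CommutativeRing 0ℓ 0ℓ
  open CommutativeRing cring public
  field
    _⁻¹      : Carrier → Carrier
    inverseʳ : ∀ x → ¬ (x ≈ 0#) → (x * (x ⁻¹)) ≈ 1#
    0≉1      : ¬ (0# ≈ 1#)
    charZero : ∀ n → ¬ (ringFromℕ cring (suc n) ≈ 0#)

  fromℕ : ℕ → Carrier
  fromℕ = ringFromℕ cring

  _/_ : Carrier → Carrier → Carrier
  x / y = x * (y ⁻¹)

-- Characters, Gauss sums, binomial coefficients and Greene's series,
-- relative to: the finite field F (of order q = p^r), the coefficient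
-- field K, a fixed primitive p-th root of unity ζ in K, and a list
-- `chars` meant to enumerate all multiplicative characters (the
-- theorem assumes this).

module Setup (F : FiniteField) (K : CharZeroField) (p r : ℕ)
             (ζ : CharZeroField.Carrier K) (chars : List (FiniteField.Carrier F → CharZeroField.Carrier K)) where

  module F = FiniteField F
  module K = CharZeroField K
  open F using () renaming (Carrier to 𝔽)
  open K using () renaming (Carrier to 𝕂)

  -- characters are represented by their (extended) value functions
  Char : Set
  Char = 𝔽 → 𝕂

  _^F_ : 𝔽 → ℕ → 𝔽
  x ^F zero  = F.1#
  x ^F suc n = x F.* (x ^F n)

  _^K_ : 𝕂 → ℕ → 𝕂
  x ^K zero  = K.1#
  x ^K suc n = x K.* (x ^K n)

  natF : ℕ → 𝔽
  natF zero    = F.0#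
  natF (suc n) = F.1# F.+ natF n

  q : ℕ
  q = F.size

  sumF : (𝔽 → 𝕂) → 𝕂
  sumF f = foldr (λ x acc → f x K.+ acc) K.0# F.elements

  sumList : {X : Set} → List X → (X → 𝕂) → 𝕂
  sumList xs f = foldr (λ x acc → f x K.+ acc) K.0# xs

  -- trace tr : F_q → F_p,  tr α = Σ_{i<r} α^(p^i)  (an element of the prime field)
  tr : 𝔽 → 𝔽
  tr α = go r
    where
    go : ℕ → 𝔽
    go zero    = F.0#
    go (suc i) = (α ^F (p ℕ.^ i)) F.+ go i

  -- the residue k ∈ {0,…,p-1} with k·1 = x (x in the prime field)
  primeFieldIndex : 𝔽 → ℕ
  primeFieldIndex x = go p
    where
    go : ℕ → ℕ
    go zero    = 0
    go (suc k) with natF k F.≟ x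
    ... | yes _ = k
    ... | no  _ = go k

  θ : 𝔽 → 𝕂
  θ α = ζ ^K primeFieldIndex (tr α)

  isZero : 𝔽 → Bool
  isZero x = ⌊ x F.≟ F.0# ⌋

  ε : Char
  ε x = if isZero x then K.0# else K.1#

  infixl 7 _·_
  _·_ : Char → Char → Char
  (A · B) x = A x K.* B x

  inv : Char → Char
  inv A x = if isZero x then K.0# else A (x F.⁻¹)

  sq : Char → Char
  sq A = A · A

  isSquare : 𝔽 → Bool
  isSquare x = ⌊ any? (λ y → (y F.* y) F.≟ x) F.elements ⌋

  φ : Char
  φ x = if isZero x then K.0# else (if isSquare x then K.1# else K.- K.1#)

  δ : 𝔽 → 𝕂
  δ x = if isZero x then K.1# else K.0#

  record IsChar (χ : Char) : Set where
    field
      at0  : χ F.0# K.≈ K.0#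
      at1  : χ F.1# K.≈ K.1#
      mult : ∀ x y → χ (x F.* y) K.≈ (χ x K.* χ y)

  _≗ᶜ_ : Char → Char → Set
  A ≗ᶜ B = ∀ x → A x K.≈ B x

  gauss : Char → 𝕂
  gauss χ = sumF (λ x → χ x K.* θ x)

  binom : Char → Char → 𝕂
  binom A B = (B (F.- F.1#) K./ K.fromℕ q) K.* sumF (λ x → A x K.* inv B (F.1# F.+ (F.- x)))

  prodBinom : ∀ {n} → Vec Char n → Vec Char n → Char → 𝕂
  prodBinom []       []       χ = K.1#
  prodBinom (a ∷ as) (b ∷ bs) χ = binom (a · χ) (b · χ) K.* prodBinom as bs χ

  hyp : ∀ {n} → Char → Vec Char n → Vec Char n → 𝔽 → 𝕂
  hyp A₀ As Bs x =
    (K.fromℕ q K./ K.fromℕ (q ℕ.∸ 1)) K.*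
    sumList chars (λ χ → (binom (A₀ · χ) χ K.* prodBinom As Bs χ) K.* χ x)

{-# OPTIONS --safe #-}
module Submission where

-- Write a = A², b = D²Ē², e = E², c = D² = b e and s = A D Ē, so that s² = a b.
--
-- 1. Euler integrals turn q² times the product of the two ₂F₁ into a sum over (y, t), in which y and t occur
--    through α = (1 − z y)/(1 − t), β = (1 − z t)/(1 − y) and e(y / t).  The pairs (α, β) and (y, t) determine
--    each other through two linear equations; degenerate fibres cancel because the characters are nontrivial,
--    except for z = −1, where the line of solutions over α = β = −z produces the δ-term.
-- 2. What remains is a sum over (α, β) depending, up to ā b̄(1 − z), only on κ = −z / (1 − z)².  Inserting Gauss
--    sums for e and ē and substituting α ↦ −t / α, β ↦ −s / β makes it a Kloosterman-type sum, whose multiplicative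
--    Fourier expansion in κ has coefficients J(aχ, χ̄) J(bχ, ā b̄ χ̄) J(c̄χ̄, ā e χ̄) / (q − 1).
-- 3. The Hasse–Davenport relation g(T) g(Tφ) T(4) = g(T²) g(φ) for T = sχ rewrites the last Jacobi sum as the two
--    binomials of the ₄F₃ with upper parameters s and sφ, which accounts for the argument 4κ.
--
-- Equality in the coefficient field is not decidable, so vanishing statements such as Σ χ = 0 are obtained from
-- idempotents: e² = e together with ¬ (e = 1) makes 1 − e invertible and e = 0.

-- Each hypothesis excludes degenerate sums. A² ≠ ε and D² ≠ E² (that is, b ≠ ε) allow α and β to be
-- introduced by indicators even where a numerator and a denominator vanish; A² ≠ D² kills the sum
-- along the curve αβ = z²; E² ≠ ε gives g(e) g(ē) = q; A²D²Ē² ≠ ε disposes of the term s + t = 0,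
-- which multiplicative characters do not see; A²D̄²Ē² ≠ ε keeps the characters of g(AĒD̄) and
-- g(ĀEDφ) nontrivial. The characters a, b, c, e are squares, hence 1 at -1, and signs disappear.
-- The substitution α ↦ -t / α, β ↦ -s / β is forced: division of the exponent by αβ leaves s + t -
-- t / α - s / β and one further term κ (s + t) / (αβ), which is a product in the new variables.
-- Binomials and series carry denominators q and q - 1; identities are therefore proved after
-- multiplication by `Q` and `N`, which are cancelled at the end.

open import Defs
open import Level using (0ℓ)
open import Data.Bool using (if_then_else_)
open import Data.Empty using (⊥; ⊥-elim)
import Data.Fin as Fin
import Data.Fin.Properties as Finₚ
open import Data.Integer as ℤ using (ℤ; +_; -[1+_])
import Data.Integer.Properties as ℤ
open import Data.List using (List; length; _∷_; []; foldr; applyUpTo)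
open import Data.List.Membership.Propositional using (_∈_; lose; find)
import Data.List.Properties as Listₚ
open import Data.List.Relation.Unary.All using (All; []; _∷_)
import Data.List.Relation.Unary.All as All
import Data.List.Relation.Unary.All.Properties as Allₚ
open import Data.List.Relation.Unary.AllPairs using (AllPairs; []; _∷_)
import Data.List.Relation.Unary.AllPairs.Properties as AllPairsₚ
open import Data.List.Relation.Unary.Any using (Any; here; there; any?)
import Data.List.Relation.Unary.Any as Any
open import Data.List.Relation.Unary.Unique.Propositional using (Unique)
open import Data.Maybe using (Maybe; just; nothing)
open import Data.Nat using (ℕ; zero; suc; _∸_; _^_)
import Data.Nat as ℕ
open import Data.Nat.Combinatorics using (nCn≡1; nCk≡n!/k![n-k]!; k![n∸k]!∣n!) renaming (_C_ to infix 9 _choose_)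
open import Data.Nat.Coprimality using (Coprime; coprime-Bézout)
open import Data.Nat.Divisibility using (_∣_; _∣?_; divides; ∣⇒≤; ∣1⇒≡1; m∣m*n)
open import Data.Nat.DivMod using (m/n*n≡m)
open import Data.Nat.GCD using (module Bézout)
open import Data.Nat.Primality using (Prime; prime⇒nonZero; prime⇒nonTrivial; prime⇒irreducible; euclidsLemma)
import Data.Nat.Properties as ℕₚ
open import Data.Product using (∃; _×_; _,_; proj₁; proj₂)
open import Data.Sign as Sign using (Sign)
open import Data.Sum using (_⊎_; inj₁; inj₂)
open import Data.Vec using (Vec; _∷_; []; replicate)
open import Relation.Nullary using (¬_; Dec; yes; no)
open import Relation.Nullary.Decidable using (¬?)
open import Relation.Binary.Definitions using (DecidableEquality)
open import Relation.Binary.PropositionalEquality as ≡ using (_≡_; _≢_)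
open import Algebra.Bundles using (CommutativeMonoid; CommutativeRing)
import Algebra.Properties.CommutativeSemiring.Binomial
import Algebra.Properties.Monoid.Sum
import Algebra.Properties.Ring
import Algebra.Properties.Semiring.Exp
import Algebra.Properties.Semiring.Mult.TCOptimised
import Algebra.Solver.Ring
import Algebra.Solver.Ring.AlmostCommutativeRing as ACR
import Relation.Binary.Reasoning.Setoid

-- Ring normalisation with integer coefficients

-- The ring solver with integer coefficients: in an abstract ring only these let it cancel x − x.
module IntegerSolver (R : CommutativeRing 0ℓ 0ℓ) where
  open CommutativeRing R
  open Algebra.Properties.Semiring.Mult.TCOptimised semiring using (×-homo-+; ×1-homo-*; 1+×) renaming (_×_ to _⊠_)
  open Algebra.Properties.Ring ring using (-‿involutive; -0#≈0#; -‿+-comm; -‿distribˡ-*; -‿distribʳ-*)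
  open Relation.Binary.Reasoning.Setoid setoid

  -- `_⊠_` is the optimised multiple, with `1 ⊠ x` equal to `x` by computation, so the constants 0
  -- and 1 of the solver evaluate to `0#` and `1#` themselves.
  ⟦_⟧ℤ : ℤ → Carrier
  ⟦ + n ⟧ℤ      = n ⊠ 1#
  ⟦ -[1+ n ] ⟧ℤ = - (suc n ⊠ 1#)

  private
    signed : Sign → Carrier → Carrier
    signed Sign.+ x = x
    signed Sign.- x = - x

    neg-homo : ∀ i → ⟦ ℤ.- i ⟧ℤ ≈ - ⟦ i ⟧ℤ
    neg-homo (+ zero)  = sym -0#≈0#
    neg-homo (+ suc n) = refl
    neg-homo -[1+ n ]  = sym (-‿involutive _)

    ⊖-homo : ∀ m n → ⟦ m ℤ.⊖ n ⟧ℤ ≈ m ⊠ 1# - n ⊠ 1#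
    ⊖-homo zero    zero    = sym (-‿inverseʳ 0#)
    ⊖-homo zero    (suc n) = sym (+-identityˡ _)
    ⊖-homo (suc m) zero    = sym (trans (+-congˡ -0#≈0#) (+-identityʳ _))
    ⊖-homo (suc m) (suc n) = begin
      ⟦ suc m ℤ.⊖ suc n ⟧ℤ  ≡⟨ ≡.cong ⟦_⟧ℤ (ℤ.[1+m]⊖[1+n]≡m⊖n m n) ⟩
      ⟦ m ℤ.⊖ n ⟧ℤ  ≈⟨ ⊖-homo m n ⟩
      M - N  ≈⟨ +-congʳ (+-identityʳ M) ⟨
      (M + 0#) - N  ≈⟨ +-congʳ (+-congˡ (-‿inverseʳ 1#)) ⟨
      (M + (1# - 1#)) - N  ≈⟨ +-congʳ (+-assoc M 1# (- 1#)) ⟨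
      ((M + 1#) - 1#) - N  ≈⟨ +-assoc _ _ _ ⟩
      (M + 1#) + (- 1# - N)  ≈⟨ +-cong (+-comm M 1#) (-‿+-comm 1# N) ⟩
      (1# + M) - (1# + N)  ≈⟨ +-cong (1+× m 1#) (-‿cong (1+× n 1#)) ⟨
      suc m ⊠ 1# - suc n ⊠ 1#  ∎
      where M = m ⊠ 1#
            N = n ⊠ 1#

    +-homo : ∀ i j → ⟦ i ℤ.+ j ⟧ℤ ≈ ⟦ i ⟧ℤ + ⟦ j ⟧ℤ
    +-homo (+ m)    (+ n)    = ×-homo-+ 1# m n
    +-homo (+ m)    -[1+ n ] = ⊖-homo m (suc n)
    +-homo -[1+ m ] (+ n)    = trans (⊖-homo n (suc m)) (+-comm _ _)
    +-homo -[1+ m ] -[1+ n ] = begin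
      - ((suc (suc (m ℕ.+ n))) ⊠ 1#)  ≡⟨ ≡.cong (λ k → - (k ⊠ 1#)) (≡.cong suc (ℕₚ.+-suc m n)) ⟨
      - ((suc m ℕ.+ suc n) ⊠ 1#)  ≈⟨ -‿cong (×-homo-+ 1# (suc m) (suc n)) ⟩
      - (suc m ⊠ 1# + suc n ⊠ 1#)  ≈⟨ -‿+-comm _ _ ⟨
      - (suc m ⊠ 1#) - suc n ⊠ 1#  ∎


    ◃-homo : ∀ s n → ⟦ s ℤ.◃ n ⟧ℤ ≈ signed s (n ⊠ 1#)
    ◃-homo Sign.+ zero    = refl
    ◃-homo Sign.- zero    = sym -0#≈0#
    ◃-homo Sign.+ (suc n) = refl
    ◃-homo Sign.- (suc n) = refl

    signed-cong : ∀ s {x y} → x ≈ y → signed s x ≈ signed s y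
    signed-cong Sign.+ = λ e → e
    signed-cong Sign.- = -‿cong

    signed-* : ∀ s t x y → signed (s Sign.* t) (x * y) ≈ signed s x * signed t y
    signed-* Sign.+ Sign.+ x y = refl
    signed-* Sign.+ Sign.- x y = -‿distribʳ-* x y
    signed-* Sign.- Sign.+ x y = -‿distribˡ-* x y
    signed-* Sign.- Sign.- x y = begin
      x * y  ≈⟨ -‿involutive _ ⟨
      - - (x * y)  ≈⟨ -‿cong (-‿distribʳ-* x y) ⟩
      - (x * - y)  ≈⟨ -‿distribˡ-* x (- y) ⟩
      - x * - y  ∎

    signed-abs : ∀ i → signed (ℤ.sign i) (ℤ.∣ i ∣ ⊠ 1#) ≈ ⟦ i ⟧ℤ
    signed-abs (+ n)    = refl
    signed-abs -[1+ n ] = refl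

    *-homo : ∀ i j → ⟦ i ℤ.* j ⟧ℤ ≈ ⟦ i ⟧ℤ * ⟦ j ⟧ℤ
    *-homo i j = begin
      ⟦ i ℤ.* j ⟧ℤ  ≈⟨ ◃-homo s (ℤ.∣ i ∣ ℕ.* ℤ.∣ j ∣) ⟩
      signed s ((ℤ.∣ i ∣ ℕ.* ℤ.∣ j ∣) ⊠ 1#)  ≈⟨ signed-cong s (×1-homo-* ℤ.∣ i ∣ ℤ.∣ j ∣) ⟩
      signed s (ℤ.∣ i ∣ ⊠ 1# * ℤ.∣ j ∣ ⊠ 1#)  ≈⟨ signed-* (ℤ.sign i) (ℤ.sign j) _ _ ⟩
      signed (ℤ.sign i) (ℤ.∣ i ∣ ⊠ 1#) * signed (ℤ.sign j) (ℤ.∣ j ∣ ⊠ 1#) ≈⟨ *-cong (signed-abs i) (signed-abs j) ⟩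
      ⟦ i ⟧ℤ * ⟦ j ⟧ℤ  ∎
      where s = ℤ.sign i Sign.* ℤ.sign j

  private
    almostCommutativeRing = ACR.fromCommutativeRing R

    ℤ⟶R : ℤ.+-*-rawRing ACR.-Raw-AlmostCommutative⟶ almostCommutativeRing
    ℤ⟶R = record
      { ⟦_⟧ = ⟦_⟧ℤ ; +-homo = +-homo ; *-homo = *-homo ; -‿homo = neg-homo ; 0-homo = refl ; 1-homo = refl }

    -- Identifying only equal integers is sound in every ring. In characteristic p it is incomplete:
    -- p and 0 stay distinct coefficients.
    ≟-image : ∀ i j → Maybe (⟦ i ⟧ℤ ≈ ⟦ j ⟧ℤ)
    ≟-image i j with i ℤ.≟ j
    ... | yes eq = just (reflexive (≡.cong ⟦_⟧ℤ eq))
    ... | no  _  = nothing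

  open Algebra.Solver.Ring ℤ.+-*-rawRing almostCommutativeRing ℤ⟶R ≟-image public
    using (solve; _:=_; _:+_; _:*_; _:-_; :-_; con; Polynomial)

  :1 : ∀ {n} → Polynomial n
  :1 = con (+ 1)

  :0 : ∀ {n} → Polynomial n
  :0 = con (+ 0)

-- Finite sums in commutative monoids and rings

module MonoidSums (M : CommutativeMonoid 0ℓ 0ℓ) where
  open CommutativeMonoid M
  open Relation.Binary.Reasoning.Setoid setoid

  ⨁ : {X : Set} → List X → (X → Carrier) → Carrier
  ⨁ xs f = foldr (λ x acc → f x ∙ acc) ε xs

  -- A Kronecker delta for a monoid, where there is no 1 to scale by; the same lemmas thus serve
  -- sums and products.
  guard : {P : Set} → Dec P → Carrier → Carrier
  guard (yes _) m = m
  guard (no  _) m = ε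

  guard-yes : ∀ {P : Set} (d : Dec P) {m} → P → guard d m ≈ m
  guard-yes (yes _) p = refl
  guard-yes (no ¬p) p = ⊥-elim (¬p p)

  guard-no : ∀ {P : Set} (d : Dec P) {m} → ¬ P → guard d m ≈ ε
  guard-no (yes p) ¬p = ⊥-elim (¬p p)
  guard-no (no _)  ¬p = refl

  interchange : ∀ a b c d → (a ∙ b) ∙ (c ∙ d) ≈ (a ∙ c) ∙ (b ∙ d)
  interchange a b c d = begin
    (a ∙ b) ∙ (c ∙ d) ≈⟨ assoc a b (c ∙ d) ⟩
    a ∙ (b ∙ (c ∙ d)) ≈⟨ ∙-congˡ (assoc b c d) ⟨
    a ∙ ((b ∙ c) ∙ d) ≈⟨ ∙-congˡ (∙-congʳ (comm b c)) ⟩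
    a ∙ ((c ∙ b) ∙ d) ≈⟨ ∙-congˡ (assoc c b d) ⟩
    a ∙ (c ∙ (b ∙ d)) ≈⟨ assoc a c (b ∙ d) ⟨
    (a ∙ c) ∙ (b ∙ d) ∎

  ⨁-cong-All : ∀ {X : Set} {xs : List X} {f g : X → Carrier} → All (λ x → f x ≈ g x) xs → ⨁ xs f ≈ ⨁ xs g
  ⨁-cong-All []       = refl
  ⨁-cong-All (p ∷ ps) = ∙-cong p (⨁-cong-All ps)

  ⨁-cong : ∀ {X : Set} (xs : List X) {f g : X → Carrier} → (∀ x → f x ≈ g x) → ⨁ xs f ≈ ⨁ xs g
  ⨁-cong []       h = refl
  ⨁-cong (x ∷ xs) h = ∙-cong (h x) (⨁-cong xs h)

  ⨁-ε : ∀ {X : Set} (xs : List X) → ⨁ xs (λ _ → ε) ≈ ε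
  ⨁-ε []       = refl
  ⨁-ε (x ∷ xs) = trans (identityˡ _) (⨁-ε xs)

  ⨁-∙ : ∀ {X : Set} (xs : List X) (f g : X → Carrier) → ⨁ xs (λ x → f x ∙ g x) ≈ ⨁ xs f ∙ ⨁ xs g
  ⨁-∙ []       f g = sym (identityˡ ε)
  ⨁-∙ (x ∷ xs) f g = trans (∙-congˡ (⨁-∙ xs f g)) (interchange _ _ _ _)

  ⨁-swap : ∀ {X Y : Set} (xs : List X) (ys : List Y) (f : X → Y → Carrier) →
           ⨁ xs (λ x → ⨁ ys (f x)) ≈ ⨁ ys (λ y → ⨁ xs (λ x → f x y))
  ⨁-swap []       ys f = sym (⨁-ε ys)
  ⨁-swap (x ∷ xs) ys f = trans (∙-congˡ (⨁-swap xs ys f)) (sym (⨁-∙ ys (f x) _))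

  module _ {X : Set} (_≟_ : DecidableEquality X) where
    ⨁-guard-∉ : ∀ {xs : List X} {a} (f : X → Carrier) → All (a ≢_) xs → ⨁ xs (λ x → guard (x ≟ a) (f x)) ≈ ε
    ⨁-guard-∉ f []       = refl
    ⨁-guard-∉ {x ∷ xs} {a} f (p ∷ ps) =
      trans (∙-cong (guard-no (x ≟ a) (λ e → p (≡.sym e))) (⨁-guard-∉ f ps)) (identityˡ ε)

    ⨁-guard : ∀ {xs : List X} {a} (f : X → Carrier) → Unique xs → a ∈ xs → ⨁ xs (λ x → guard (x ≟ a) (f x)) ≈ f a
    ⨁-guard {x ∷ xs} f (p ∷ u) (here ≡.refl) =
      trans (∙-cong (guard-yes (x ≟ x) ≡.refl) (⨁-guard-∉ f p)) (identityʳ _)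
    ⨁-guard {x ∷ xs} {a} f (p ∷ u) (there m) =
      trans (∙-cong (guard-no (x ≟ a) (All-lookup p m)) (⨁-guard f u m)) (identityˡ _)
      where
      All-lookup : ∀ {xs : List X} {a x} → All (x ≢_) xs → a ∈ xs → x ≢ a
      All-lookup (q ∷ _)  (here ≡.refl) = q
      All-lookup (_ ∷ qs) (there k)     = All-lookup qs k

    module _ {xs : List X} (complete : ∀ x → x ∈ xs) (unique : Unique xs) where
      -- Double counting: `f (σ x)` is expanded over y against the indicator of y = σ x, which is
      -- also the indicator of x = τ y. No permutation between the list and its image has to be
      -- built.
      ⨁-bijection : ∀ (f : X → Carrier) (σ τ : X → X) → (∀ x → σ (τ x) ≡ x) → (∀ x → τ (σ x) ≡ x) →
                    ⨁ xs (λ x → f (σ x)) ≈ ⨁ xs f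
      ⨁-bijection f σ τ στ τσ = begin
        ⨁ xs (λ x → f (σ x))  ≈⟨ ⨁-cong xs (λ x → sym (⨁-guard f unique (complete (σ x)))) ⟩
        ⨁ xs (λ x → ⨁ xs (λ y → guard (y ≟ σ x) (f y)))  ≈⟨ ⨁-swap xs xs _ ⟩
        ⨁ xs (λ y → ⨁ xs (λ x → guard (y ≟ σ x) (f y)))  ≈⟨ ⨁-cong xs (λ y → ⨁-cong xs (transpose y)) ⟩
        ⨁ xs (λ y → ⨁ xs (λ x → guard (x ≟ τ y) (f y)))  ≈⟨ ⨁-cong xs (λ y → ⨁-guard (λ _ → f y) unique (complete (τ y))) ⟩
        ⨁ xs f  ∎
        where
        transpose : ∀ y x → guard (y ≟ σ x) (f y) ≈ guard (x ≟ τ y) (f y)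
        transpose y x with y ≟ σ x
        ... | yes e = sym (guard-yes (x ≟ τ y) (≡.trans (≡.sym (τσ x)) (≡.cong τ (≡.sym e))))
        ... | no ne = sym (guard-no (x ≟ τ y) (λ e → ne (≡.trans (≡.sym (στ y)) (≡.cong σ (≡.sym e)))))

module RingSums (R : CommutativeRing 0ℓ 0ℓ) where
  open CommutativeRing R
  open MonoidSums +-commutativeMonoid public
    renaming (⨁ to ∑; ⨁-cong to ∑-cong; ⨁-cong-All to ∑-cong-All; ⨁-ε to ∑-zero; ⨁-∙ to ∑-+; ⨁-swap to ∑-swap;
              ⨁-guard to ∑-guard; ⨁-bijection to ∑-bijection)

  module _ {X : Set} where
    ∑-*ˡ : ∀ (xs : List X) c (f : X → Carrier) → ∑ xs (λ x → c * f x) ≈ c * ∑ xs f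
    ∑-*ˡ []       c f = sym (zeroʳ c)
    ∑-*ˡ (x ∷ xs) c f = trans (+-congˡ (∑-*ˡ xs c f)) (sym (distribˡ c _ _))

    ∑-*ʳ : ∀ (xs : List X) c (f : X → Carrier) → ∑ xs (λ x → f x * c) ≈ ∑ xs f * c
    ∑-*ʳ xs c f = trans (∑-cong xs (λ x → *-comm _ _)) (trans (∑-*ˡ xs c f) (*-comm _ _))

-- Arithmetic in the finite field

module FiniteFieldProperties (F : FiniteField) where
  open FiniteField F

  commutativeRing : CommutativeRing 0ℓ 0ℓ
  commutativeRing = record { isCommutativeRing = isCommutativeRing }

  open CommutativeRing commutativeRing public
    using (+-assoc; +-comm; +-identityˡ; +-identityʳ; -‿inverseʳ; -‿inverseˡ; *-assoc; *-comm; *-identityˡ; *-identityʳ; zeroˡ; zeroʳ; distribˡ; distribʳ; _-_)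
  open IntegerSolver commutativeRing public
  open ≡.≡-Reasoning

  inverseˡ : ∀ {x} → x ≢ 0# → x ⁻¹ * x ≡ 1#
  inverseˡ {x} x≢0 = ≡.trans (*-comm (x ⁻¹) x) (inverseʳ x x≢0)

  cancel-⁻¹ˡ : ∀ {x} y → x ≢ 0# → x * (x ⁻¹ * y) ≡ y
  cancel-⁻¹ˡ {x} y x≢0 = ≡.trans (≡.sym (*-assoc x (x ⁻¹) y)) (≡.trans (≡.cong (_* y) (inverseʳ x x≢0)) (*-identityˡ y))

  cancel-⁻¹ʳ : ∀ {x} y → x ≢ 0# → x ⁻¹ * (x * y) ≡ y
  cancel-⁻¹ʳ {x} y x≢0 = ≡.trans (≡.sym (*-assoc (x ⁻¹) x y)) (≡.trans (≡.cong (_* y) (inverseˡ x≢0)) (*-identityˡ y))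

  *-cancelˡ : ∀ {x y z} → x ≢ 0# → x * y ≡ x * z → y ≡ z
  *-cancelˡ {x} {y} {z} x≢0 e = ≡.trans (≡.sym (cancel-⁻¹ʳ y x≢0)) (≡.trans (≡.cong (x ⁻¹ *_) e) (cancel-⁻¹ʳ z x≢0))

  *-≢0 : ∀ {x y} → x ≢ 0# → y ≢ 0# → x * y ≢ 0#
  *-≢0 {x} {y} x≢0 y≢0 e = y≢0 (*-cancelˡ x≢0 (≡.trans e (≡.sym (zeroʳ x))))

  *-≡0 : ∀ {x y} → x * y ≡ 0# → x ≡ 0# ⊎ y ≡ 0#
  *-≡0 {x} {y} e with x ≟ 0# | y ≟ 0#
  ... | yes x≡0 | _       = inj₁ x≡0
  ... | no _    | yes y≡0 = inj₂ y≡0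
  ... | no x≢0  | no y≢0  = ⊥-elim (*-≢0 x≢0 y≢0 e)

  *≡1⇒≢0 : ∀ {x y} → x * y ≡ 1# → x ≢ 0#
  *≡1⇒≢0 {x} {y} e ≡.refl = 0≢1 (≡.trans (≡.sym (zeroˡ y)) e)

  ⁻¹-≢0 : ∀ {x} → x ≢ 0# → x ⁻¹ ≢ 0#
  ⁻¹-≢0 x≢0 = *≡1⇒≢0 (inverseˡ x≢0)

  1≢0 : 1# ≢ 0#
  1≢0 e = 0≢1 (≡.sym e)

  -‿≢0 : ∀ {x} → x ≢ 0# → - x ≢ 0#
  -‿≢0 {x} x≢0 e = x≢0 (begin
    x  ≡⟨ solve 1 (λ x → x := :- (:- x)) ≡.refl x ⟩
    - (- x)  ≡⟨ ≡.cong -_ e ⟩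
    - 0#  ≡⟨ solve 0 (:- :0 := :0) ≡.refl ⟩
    0#  ∎)

  -1≢0 : - 1# ≢ 0#
  -1≢0 = -‿≢0 1≢0

  -‿≡0⇒≡ : ∀ {x y} → x + - y ≡ 0# → x ≡ y
  -‿≡0⇒≡ {x} {y} e = begin
    x  ≡⟨ solve 2 (λ x y → x := (x :+ :- y) :+ y) ≡.refl x y ⟩
    x + - y + y  ≡⟨ ≡.cong (_+ y) e ⟩
    0# + y  ≡⟨ +-identityˡ y ⟩
    y  ∎

  ≢⇒-‿≢0 : ∀ {x y} → x ≢ y → x + - y ≢ 0#
  ≢⇒-‿≢0 x≢y e = x≢y (-‿≡0⇒≡ e)

  *⁻¹-unique : ∀ {m n x} → m ≢ 0# → x * m ≡ n → x ≡ n * m ⁻¹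
  *⁻¹-unique {m} {n} {x} m≢0 e = begin
    x  ≡⟨ cancel-⁻¹ʳ x m≢0 ⟨
    m ⁻¹ * (m * x)  ≡⟨ *-comm (m ⁻¹) (m * x) ⟩
    m * x * m ⁻¹  ≡⟨ ≡.cong (_* m ⁻¹) (≡.trans (*-comm m x) e) ⟩
    n * m ⁻¹  ∎

  *⁻¹-solves : ∀ {m} n → m ≢ 0# → (n * m ⁻¹) * m ≡ n
  *⁻¹-solves {m} n m≢0 = ≡.trans (*-assoc n (m ⁻¹) m) (≡.trans (≡.cong (n *_) (inverseˡ m≢0)) (*-identityʳ n))

  ⁻¹-unique : ∀ {x y} → x * y ≡ 1# → y ≡ x ⁻¹
  ⁻¹-unique {x} {y} e = *-cancelˡ (*≡1⇒≢0 e) (≡.trans e (≡.sym (inverseʳ x (*≡1⇒≢0 e))))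

  ⁻¹-involutive : ∀ {x} → x ≢ 0# → (x ⁻¹) ⁻¹ ≡ x
  ⁻¹-involutive x≢0 = ≡.sym (⁻¹-unique (inverseˡ x≢0))

  ⁻¹-distrib-* : ∀ {x y} → x ≢ 0# → y ≢ 0# → (x * y) ⁻¹ ≡ x ⁻¹ * y ⁻¹
  ⁻¹-distrib-* {x} {y} x≢0 y≢0 = ≡.sym (⁻¹-unique (begin
    x * y * (x ⁻¹ * y ⁻¹)  ≡⟨ solve 4 (λ x y a b → x :* y :* (a :* b) := (x :* a) :* (y :* b)) ≡.refl x y (x ⁻¹) (y ⁻¹) ⟩
    (x * x ⁻¹) * (y * y ⁻¹)  ≡⟨ ≡.cong₂ _*_ (inverseʳ x x≢0) (inverseʳ y y≢0) ⟩
    1# * 1#  ≡⟨ *-identityˡ 1# ⟩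
    1#  ∎))

  1⁻¹ : 1# ⁻¹ ≡ 1#
  1⁻¹ = ≡.sym (⁻¹-unique (*-identityˡ 1#))

  -- Makes both q and q - 1 positive, hence `Q` and `N` nonzero in characteristic 0.
  2≤size : 2 ℕ.≤ size
  2≤size = go elements (complete 0#) (complete 1#)
    where
    go : ∀ xs → 0# ∈ xs → 1# ∈ xs → 2 ℕ.≤ length xs
    go (x ∷ [])     (here p) (here q) = ⊥-elim (0≢1 (≡.trans p (≡.sym q)))
    go (x ∷ y ∷ xs) _        _        = ℕ.s≤s (ℕ.s≤s ℕ.z≤n)

-- Cancellation and idempotents in characteristic 0

module CharZeroFieldProperties (K : CharZeroField) where
  open CharZeroField K
  open RingSums cring
  open IntegerSolver cring public
  open Relation.Binary.Reasoning.Setoid setoid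

  *-cancelˡ : ∀ {x y z} → ¬ (x ≈ 0#) → x * y ≈ x * z → y ≈ z
  *-cancelˡ {x} {y} {z} x≉0 e = begin
    y  ≈⟨ *-identityˡ y ⟨
    1# * y  ≈⟨ *-congʳ inv ⟨
    x ⁻¹ * x * y  ≈⟨ *-assoc _ _ _ ⟩
    x ⁻¹ * (x * y)  ≈⟨ *-congˡ e ⟩
    x ⁻¹ * (x * z)  ≈⟨ *-assoc _ _ _ ⟨
    x ⁻¹ * x * z  ≈⟨ *-congʳ inv ⟩
    1# * z  ≈⟨ *-identityˡ z ⟩
    z  ∎
    where inv = trans (*-comm (x ⁻¹) x) (inverseʳ x x≉0)

  *-≈0 : ∀ {x y} → ¬ (x ≈ 0#) → x * y ≈ 0# → y ≈ 0#
  *-≈0 {x} x≉0 e = *-cancelˡ x≉0 (trans e (sym (zeroʳ x)))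

  *-≉0 : ∀ {x y} → ¬ (x ≈ 0#) → ¬ (y ≈ 0#) → ¬ (x * y ≈ 0#)
  *-≉0 x≉0 y≉0 e = y≉0 (*-≈0 x≉0 e)

  /-* : ∀ z {y} → ¬ (y ≈ 0#) → (z / y) * y ≈ z
  /-* z {y} y≉0 = trans (*-assoc _ _ _) (trans (*-congˡ (trans (*-comm _ _) (inverseʳ y y≉0))) (*-identityʳ z))

  1≉0 : ¬ (1# ≈ 0#)
  1≉0 e = 0≉1 (sym e)

  -‿≈0⇒≈ : ∀ {x y} → x - y ≈ 0# → x ≈ y
  -‿≈0⇒≈ {x} {y} e = begin
    x  ≈⟨ solve 2 (λ x y → x := (x :- y) :+ y) refl x y ⟩
    x - y + y  ≈⟨ +-congʳ e ⟩
    0# + y  ≈⟨ +-identityˡ y ⟩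
    y  ∎

  -- Replaces a case distinction: equality in K need not be decidable.
  idempotent-≈0 : ∀ {e} → e * e ≈ e → ¬ (e ≈ 1#) → e ≈ 0#
  idempotent-≈0 {e} ee e≉1 = *-≈0 (λ h → e≉1 (sym (-‿≈0⇒≈ h))) (begin
    (1# - e) * e  ≈⟨ solve 1 (λ e → (:1 :- e) :* e := e :- e :* e) refl e ⟩
    e - e * e  ≈⟨ +-congˡ (-‿cong ee) ⟩
    e - e  ≈⟨ -‿inverseʳ e ⟩
    0#  ∎)

  -- Idempotents of a field behave like 0 or 1, so the sum behaves like a positive integer. The
  -- conclusion is a negation, so for each summand both e = 0 (drop it) and e = 1 (absorb it into
  -- the integer) may be refuted, against e (e - 1) = 0.
  positive+idempotents≉0 : ∀ {X : Set} {e : X → Carrier} {xs} n → All (λ x → e x * e x ≈ e x) xs →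
                           ¬ (fromℕ (suc n) + ∑ xs e ≈ 0#)
  positive+idempotents≉0 n []       h = charZero n (trans (sym (+-identityʳ _)) h)
  positive+idempotents≉0 {e = e} {xs = x ∷ xs} n (i ∷ is) h = e≉1 (-‿≈0⇒≈ (*-≈0 e≉0 (begin
      e x * (e x - 1#)  ≈⟨ solve 1 (λ e → e :* (e :- :1) := e :* e :- e) refl (e x) ⟩
      e x * e x - e x  ≈⟨ +-congʳ i ⟩
      e x - e x  ≈⟨ -‿inverseʳ (e x) ⟩
      0#  ∎)))
    where
    e≉0 : ¬ (e x ≈ 0#)
    e≉0 z = positive+idempotents≉0 n is (trans (+-congˡ (sym (trans (+-congʳ z) (+-identityˡ _)))) h)
    e≉1 : ¬ (e x ≈ 1#)
    e≉1 z = positive+idempotents≉0 (suc n) is (begin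
      1# + fromℕ (suc n) + ∑ xs e  ≈⟨ solve 3 (λ u v s → (u :+ v) :+ s := v :+ (u :+ s)) refl 1# (fromℕ (suc n)) (∑ xs e) ⟩
      fromℕ (suc n) + (1# + ∑ xs e)  ≈⟨ +-congˡ (+-congʳ z) ⟨
      fromℕ (suc n) + (e x + ∑ xs e)  ≈⟨ h ⟩
      0#  ∎)

  -- Turns one vanishing sum into pointwise vanishing: a summand equal to 1 would make the whole sum
  -- a positive integer plus idempotents.
  idempotents-sum≈0 : ∀ {X : Set} {e : X → Carrier} {xs} → All (λ x → e x * e x ≈ e x) xs →
                      ∑ xs e ≈ 0# → All (λ x → e x ≈ 0#) xs
  idempotents-sum≈0 []                    h = []
  idempotents-sum≈0 {e = e} {xs = x ∷ xs} (i ∷ is) h = ex≈0 ∷ idempotents-sum≈0 is (begin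
      ∑ xs e  ≈⟨ +-identityˡ _ ⟨
      0# + ∑ xs e  ≈⟨ +-congʳ ex≈0 ⟨
      e x + ∑ xs e  ≈⟨ h ⟩
      0#  ∎)
    where
    ex≈0 = idempotent-≈0 i (λ e≈1 → positive+idempotents≉0 0 is (begin
      1# + 0# + ∑ xs e  ≈⟨ +-congʳ (+-identityʳ 1#) ⟩
      1# + ∑ xs e  ≈⟨ +-congʳ e≈1 ⟨
      e x + ∑ xs e  ≈⟨ h ⟩
      0#  ∎))

cases : ∀ {P A : Set} → Dec P → (P → A) → (¬ P → A) → A
cases (yes p) f g = f p
cases (no ¬p) f g = g ¬p

-- Sums over the field and multiplicative characters

module CharacterSums (F : FiniteField) (K : CharZeroField) (p r : ℕ) (ζ : CharZeroField.Carrier K)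
                     (chars : List (FiniteField.Carrier F → CharZeroField.Carrier K)) where
  open Setup F K p r ζ chars public
  module FP = FiniteFieldProperties F
  module KP = CharZeroFieldProperties K
  open FP public using () renaming (solve to solveᶠ; _:=_ to _:=ᶠ_; _:+_ to _:+ᶠ_; _:*_ to _:*ᶠ_; _:-_ to _:-ᶠ_; :-_ to :-ᶠ_; :1 to :1ᶠ; :0 to :0ᶠ)
  open KP public using (solve; _:=_; _:+_; _:*_; _:-_; :-_; :1; :0)
  open F public using () renaming (Carrier to 𝔽; 0# to 0ᶠ; 1# to 1ᶠ; _+_ to _+ᶠ_; _*_ to _*ᶠ_; -_ to -ᶠ_; _⁻¹ to _⁻¹ᶠ; _≟_ to _≟ᶠ_)
  open CharZeroField K public hiding (inverseʳ)
  open RingSums cring public using (∑; ∑-cong; ∑-cong-All; ∑-zero; ∑-+; ∑-swap; ∑-guard; ∑-bijection; ∑-*ˡ; ∑-*ʳ; guard; guard-yes; guard-no)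
  open Relation.Binary.Reasoning.Setoid setoid public

  infixl 6 _-ᶠ_
  _-ᶠ_ : 𝔽 → 𝔽 → 𝔽
  x -ᶠ y = x +ᶠ -ᶠ y

  Q N : Carrier
  Q = fromℕ q
  N = fromℕ (q ℕ.∸ 1)

  1+N≈Q : 1# + N ≈ Q
  1+N≈Q = reflexive (≡.cong fromℕ (lemma FP.2≤size))
    where
    lemma : ∀ {n} → 2 ℕ.≤ n → suc (n ℕ.∸ 1) ≡ n
    lemma (ℕ.s≤s _) = ≡.refl

  Q≈1+N : Q ≈ 1# + N
  Q≈1+N = sym 1+N≈Q

  Q≉0 : ¬ (Q ≈ 0#)
  Q≉0 = lemma FP.2≤size
    where
    lemma : ∀ {n} → 2 ℕ.≤ n → ¬ (fromℕ n ≈ 0#)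
    lemma (ℕ.s≤s {n = n} _) = charZero n

  N≉0 : ¬ (N ≈ 0#)
  N≉0 = lemma FP.2≤size
    where
    lemma : ∀ {n} → 2 ℕ.≤ n → ¬ (fromℕ (n ℕ.∸ 1) ≈ 0#)
    lemma (ℕ.s≤s (ℕ.s≤s {n = n} _)) = charZero n

  0-*ˡ : ∀ {x y} → x ≈ 0# → x * y ≈ 0#
  0-*ˡ h = trans (*-congʳ h) (zeroˡ _)

  0-*ʳ : ∀ {x y} → y ≈ 0# → x * y ≈ 0#
  0-*ʳ h = trans (*-congˡ h) (zeroʳ _)

  ι : {P : Set} → Dec P → Carrier
  ι d = guard d 1#

  ι-yes : ∀ {P : Set} (d : Dec P) → P → ι d ≈ 1#
  ι-yes d = guard-yes d

  ι-no : ∀ {P : Set} (d : Dec P) → ¬ P → ι d ≈ 0#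
  ι-no d = guard-no d

  ι-cong : ∀ {P P′ : Set} (d : Dec P) (d′ : Dec P′) → (P → P′) → (P′ → P) → ι d ≈ ι d′
  ι-cong d d′ f g = cases d (λ x → trans (ι-yes d x) (sym (ι-yes d′ (f x))))
                            (λ x → trans (ι-no d x) (sym (ι-no d′ (λ y → x (g y)))))

  ι-* : ∀ {P : Set} (d : Dec P) {x y} → (P → x ≈ y) → ι d * x ≈ ι d * y
  ι-* d h = cases d (λ w → *-congˡ (h w)) (λ w → trans (*-congʳ (ι-no d w)) (trans (zeroˡ _) (sym (0-*ˡ (ι-no d w)))))

  ι-yes-* : ∀ {P : Set} (d : Dec P) {x} → P → ι d * x ≈ x
  ι-yes-* d w = trans (*-congʳ (ι-yes d w)) (*-identityˡ _)

  ι-no-* : ∀ {P : Set} (d : Dec P) {x} → ¬ P → ι d * x ≈ 0#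
  ι-no-* d w = 0-*ˡ (ι-no d w)

  sumF-cong : ∀ {f g : 𝔽 → Carrier} → (∀ x → f x ≈ g x) → sumF f ≈ sumF g
  sumF-cong = ∑-cong F.elements

  sumF-swap : ∀ (f : 𝔽 → 𝔽 → Carrier) → sumF (λ x → sumF (f x)) ≈ sumF (λ y → sumF (λ x → f x y))
  sumF-swap f = ∑-swap F.elements F.elements f

  sumF-+ : ∀ (f g : 𝔽 → Carrier) → sumF (λ x → f x + g x) ≈ sumF f + sumF g
  sumF-+ = ∑-+ F.elements

  sumF-*ˡ : ∀ c (f : 𝔽 → Carrier) → sumF (λ x → c * f x) ≈ c * sumF f
  sumF-*ˡ = ∑-*ˡ F.elements

  sumF-*ʳ : ∀ c (f : 𝔽 → Carrier) → sumF (λ x → f x * c) ≈ sumF f * c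
  sumF-*ʳ = ∑-*ʳ F.elements

  sumF-zero : ∀ {f : 𝔽 → Carrier} → (∀ x → f x ≈ 0#) → sumF f ≈ 0#
  sumF-zero h = trans (sumF-cong h) (∑-zero F.elements)

  sumF-product : ∀ (f g : 𝔽 → Carrier) → sumF f * sumF g ≈ sumF (λ x → sumF (λ y → f x * g y))
  sumF-product f g = sym (trans (sumF-cong (λ x → sumF-*ˡ (f x) g)) (sumF-*ʳ (sumF g) f))

  sumF-ι : ∀ a (f : 𝔽 → Carrier) → sumF (λ x → ι (x ≟ᶠ a) * f x) ≈ f a
  sumF-ι a f = trans (sumF-cong (λ x → cases (x ≟ᶠ a)
      (λ e → trans (ι-yes-* (x ≟ᶠ a) e) (sym (guard-yes (x ≟ᶠ a) e)))
      (λ e → trans (ι-no-* (x ≟ᶠ a) e) (sym (guard-no (x ≟ᶠ a) e)))))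
    (∑-guard _≟ᶠ_ f F.unique (F.complete a))

  sumF-1 : sumF (λ _ → 1#) ≈ Q
  sumF-1 = count F.elements
    where
    count : ∀ {X : Set} (xs : List X) → ∑ xs (λ _ → 1#) ≈ fromℕ (length xs)
    count []       = refl
    count (x ∷ xs) = +-congˡ (count xs)

  sumF-bijection : ∀ (f : 𝔽 → Carrier) (σ τ : 𝔽 → 𝔽) → (∀ x → σ (τ x) ≡ x) → (∀ x → τ (σ x) ≡ x) → sumF (λ x → f (σ x)) ≈ sumF f
  sumF-bijection = ∑-bijection _≟ᶠ_ F.complete F.unique

  sumF-scale : ∀ {m} → m ≢ 0ᶠ → ∀ (f : 𝔽 → Carrier) → sumF (λ x → f (m *ᶠ x)) ≈ sumF f
  sumF-scale {m} m≢0 f = sumF-bijection f (m *ᶠ_) (m ⁻¹ᶠ *ᶠ_) (λ x → FP.cancel-⁻¹ˡ x m≢0) (λ x → FP.cancel-⁻¹ʳ x m≢0)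

  sumF-reflect : ∀ c (f : 𝔽 → Carrier) → sumF (λ x → f (c +ᶠ -ᶠ x)) ≈ sumF f
  sumF-reflect c f = sumF-bijection f (λ x → c +ᶠ -ᶠ x) (λ x → c +ᶠ -ᶠ x) involutive involutive
    where
    involutive : ∀ x → c +ᶠ -ᶠ (c +ᶠ -ᶠ x) ≡ x
    involutive = solveᶠ 2 (λ c x → c :+ᶠ :-ᶠ (c :+ᶠ :-ᶠ x) :=ᶠ x) ≡.refl c

  sumF-shift : ∀ c (f : 𝔽 → Carrier) → sumF (λ x → f (x +ᶠ c)) ≈ sumF f
  sumF-shift c f = sumF-bijection f (_+ᶠ c) (_+ᶠ -ᶠ c)
    (λ x → solveᶠ 2 (λ c x → (x :+ᶠ :-ᶠ c) :+ᶠ c :=ᶠ x) ≡.refl c x)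
    (λ x → solveᶠ 2 (λ c x → (x :+ᶠ c) :+ᶠ :-ᶠ c :=ᶠ x) ≡.refl c x)

  -- x ↦ m / x is an involution of the units. As `0 ⁻¹` is unspecified, it is completed to a
  -- bijection of the field by fixing 0, where both functions must vanish.
  sumF-reciprocal : ∀ {m} → m ≢ 0ᶠ → ∀ {f g : 𝔽 → Carrier} → f 0ᶠ ≈ 0# → g 0ᶠ ≈ 0# →
                    (∀ x → x ≢ 0ᶠ → f x ≈ g (m *ᶠ x ⁻¹ᶠ)) → sumF f ≈ sumF g
  sumF-reciprocal {m} m≢0 {f} {g} f0 g0 h = trans (sumF-cong (λ x → f≈gσ x (x ≟ᶠ 0ᶠ))) (sumF-bijection g σ σ σσ σσ)
    where
    σ′ : ∀ x → Dec (x ≡ 0ᶠ) → 𝔽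
    σ′ x (yes _) = 0ᶠ
    σ′ x (no _)  = m *ᶠ x ⁻¹ᶠ
    σ : 𝔽 → 𝔽
    σ x = σ′ x (x ≟ᶠ 0ᶠ)
    f≈gσ : ∀ x d → f x ≈ g (σ′ x d)
    f≈gσ x (yes ≡.refl) = trans f0 (sym g0)
    f≈gσ x (no x≢0)     = h x x≢0
    σ-≢0 : ∀ x → x ≢ 0ᶠ → ∀ d → σ′ x d ≡ m *ᶠ x ⁻¹ᶠ
    σ-≢0 x x≢0 (yes e) = ⊥-elim (x≢0 e)
    σ-≢0 x x≢0 (no _)  = ≡.refl
    σ-0 : ∀ d → σ′ 0ᶠ d ≡ 0ᶠ
    σ-0 (yes _) = ≡.refl
    σ-0 (no n)  = ⊥-elim (n ≡.refl)
    σσ′ : ∀ x d → σ (σ′ x d) ≡ x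
    σσ′ x (yes e)  = ≡.trans (σ-0 (0ᶠ ≟ᶠ 0ᶠ)) (≡.sym e)
    σσ′ x (no x≢0) = ≡.trans (σ-≢0 y y≢0 (y ≟ᶠ 0ᶠ)) (≡.sym (FP.*⁻¹-unique y≢0 (≡.trans (≡.cong (x *ᶠ_) (FP.*-comm m (x ⁻¹ᶠ))) (FP.cancel-⁻¹ˡ m x≢0))))
      where
      y = m *ᶠ x ⁻¹ᶠ
      y≢0 = FP.*-≢0 m≢0 (FP.⁻¹-≢0 x≢0)
    σσ : ∀ x → σ (σ x) ≡ x
    σσ x = σσ′ x (x ≟ᶠ 0ᶠ)

  sumF-ι-linear : ∀ {m} n → m ≢ 0ᶠ → ∀ (f : 𝔽 → Carrier) → sumF (λ x → ι ((x *ᶠ m) ≟ᶠ n) * f x) ≈ f (n *ᶠ m ⁻¹ᶠ)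
  sumF-ι-linear {m} n m≢0 f = trans (sumF-cong (λ x → *-congʳ (ι-cong ((x *ᶠ m) ≟ᶠ n) (x ≟ᶠ (n *ᶠ m ⁻¹ᶠ))
      (FP.*⁻¹-unique m≢0) (λ e → ≡.trans (≡.cong (_*ᶠ m) e) (FP.*⁻¹-solves n m≢0)))))
    (sumF-ι (n *ᶠ m ⁻¹ᶠ) f)

  isZero-0 : ∀ {A : Set} {x y : A} → (if isZero 0ᶠ then x else y) ≡ x
  isZero-0 with 0ᶠ ≟ᶠ 0ᶠ
  ... | yes _ = ≡.refl
  ... | no n  = ⊥-elim (n ≡.refl)

  isZero-≢0 : ∀ {A : Set} {a} {x y : A} → a ≢ 0ᶠ → (if isZero a then x else y) ≡ y
  isZero-≢0 {a = a} a≢0 with a ≟ᶠ 0ᶠ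
  ... | yes e = ⊥-elim (a≢0 e)
  ... | no _  = ≡.refl

  ε-≢0 : ∀ {x} → x ≢ 0ᶠ → ε x ≈ 1#
  ε-≢0 x≢0 = reflexive (isZero-≢0 x≢0)

  ε-0 : ε 0ᶠ ≈ 0#
  ε-0 = reflexive isZero-0

  inv-0 : ∀ χ → inv χ 0ᶠ ≈ 0#
  inv-0 χ = reflexive isZero-0

  inv-≢0 : ∀ χ {x} → x ≢ 0ᶠ → inv χ x ≈ χ (x ⁻¹ᶠ)
  inv-≢0 χ x≢0 = reflexive (isZero-≢0 x≢0)

  at0 : ∀ {χ} → IsChar χ → χ 0ᶠ ≈ 0#
  at0 = IsChar.at0

  at1 : ∀ {χ} → IsChar χ → χ 1ᶠ ≈ 1#
  at1 = IsChar.at1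

  at* : ∀ {χ} → IsChar χ → ∀ x y → χ (x *ᶠ y) ≈ χ x * χ y
  at* = IsChar.mult

  -- Identities with inverse characters come from inverses of field elements, hence from units; the
  -- convention that characters vanish at 0 extends them.
  by-units : ∀ {f g : 𝔽 → Carrier} → f 0ᶠ ≈ 0# → g 0ᶠ ≈ 0# → (∀ x → x ≢ 0ᶠ → f x ≈ g x) → ∀ x → f x ≈ g x
  by-units f0 g0 h x = cases (x ≟ᶠ 0ᶠ) (λ { ≡.refl → trans f0 (sym g0) }) (h x)

  χχ⁻¹ : ∀ {χ} → IsChar χ → ∀ {x} → x ≢ 0ᶠ → χ x * χ (x ⁻¹ᶠ) ≈ 1#
  χχ⁻¹ {χ} c {x} x≢0 = trans (sym (at* c _ _)) (trans (reflexive (≡.cong χ (F.inverseʳ x x≢0))) (at1 c))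

  isChar-ε : IsChar ε
  isChar-ε = record
    { at0 = ε-0 ; at1 = ε-≢0 FP.1≢0
    ; mult = λ x y → cases (x ≟ᶠ 0ᶠ)
        (λ { ≡.refl → trans (reflexive (≡.cong ε (FP.zeroˡ y))) (trans ε-0 (sym (0-*ˡ ε-0))) })
        (λ x≢0 → cases (y ≟ᶠ 0ᶠ)
          (λ { ≡.refl → trans (reflexive (≡.cong ε (FP.zeroʳ x))) (trans ε-0 (sym (0-*ʳ ε-0))) })
          (λ y≢0 → trans (ε-≢0 (FP.*-≢0 x≢0 y≢0)) (sym (trans (*-cong (ε-≢0 x≢0) (ε-≢0 y≢0)) (*-identityˡ 1#))))) }

  isChar-· : ∀ {A B} → IsChar A → IsChar B → IsChar (A · B)
  isChar-· a b = record
    { at0 = 0-*ˡ (at0 a)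
    ; at1 = trans (*-cong (at1 a) (at1 b)) (*-identityˡ 1#)
    ; mult = λ x y → trans (*-cong (at* a x y) (at* b x y)) (solve 4 (λ p q r s → (p :* q) :* (r :* s) := (p :* r) :* (q :* s)) refl _ _ _ _) }

  isChar-inv : ∀ {A} → IsChar A → IsChar (inv A)
  isChar-inv {A} a = record
    { at0 = inv-0 A
    ; at1 = trans (inv-≢0 A FP.1≢0) (trans (reflexive (≡.cong A FP.1⁻¹)) (at1 a))
    ; mult = λ x y → cases (x ≟ᶠ 0ᶠ)
        (λ { ≡.refl → trans (reflexive (≡.cong (inv A) (FP.zeroˡ y))) (trans (inv-0 A) (sym (0-*ˡ (inv-0 A)))) })
        (λ x≢0 → cases (y ≟ᶠ 0ᶠ)
          (λ { ≡.refl → trans (reflexive (≡.cong (inv A) (FP.zeroʳ x))) (trans (inv-0 A) (sym (0-*ʳ (inv-0 A)))) })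
          (λ y≢0 → begin
            inv A (x *ᶠ y)  ≈⟨ inv-≢0 A (FP.*-≢0 x≢0 y≢0) ⟩
            A ((x *ᶠ y) ⁻¹ᶠ)  ≡⟨ ≡.cong A (FP.⁻¹-distrib-* x≢0 y≢0) ⟩
            A (x ⁻¹ᶠ *ᶠ y ⁻¹ᶠ)  ≈⟨ at* a _ _ ⟩
            A (x ⁻¹ᶠ) * A (y ⁻¹ᶠ)  ≈⟨ *-cong (inv-≢0 A x≢0) (inv-≢0 A y≢0) ⟨
            inv A x * inv A y  ∎)) }

  χ·inv : ∀ {χ} → IsChar χ → ∀ {x} → x ≢ 0ᶠ → χ x * inv χ x ≈ 1#
  χ·inv {χ} c x≢0 = trans (*-congˡ (inv-≢0 χ x≢0)) (χχ⁻¹ c x≢0)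

  inv-at-⁻¹ : ∀ χ {x} → x ≢ 0ᶠ → inv χ (x ⁻¹ᶠ) ≈ χ x
  inv-at-⁻¹ χ x≢0 = trans (inv-≢0 χ (FP.⁻¹-≢0 x≢0)) (reflexive (≡.cong χ (FP.⁻¹-involutive x≢0)))

  χ≉0 : ∀ {χ} → IsChar χ → ∀ {x} → x ≢ 0ᶠ → ¬ (χ x ≈ 0#)
  χ≉0 c x≢0 e = KP.1≉0 (trans (sym (χχ⁻¹ c x≢0)) (0-*ˡ e))

  inv-inv : ∀ {χ} → IsChar χ → ∀ x → inv (inv χ) x ≈ χ x
  inv-inv {χ} c = by-units (inv-0 (inv χ)) (at0 c) (λ x x≢0 → trans (inv-≢0 (inv χ) x≢0) (inv-at-⁻¹ χ x≢0))

  inv-· : ∀ A B x → inv (A · B) x ≈ inv A x * inv B x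
  inv-· A B = by-units (inv-0 (A · B)) (0-*ˡ (inv-0 A))
    (λ x x≢0 → trans (inv-≢0 (A · B) x≢0) (sym (*-cong (inv-≢0 A x≢0) (inv-≢0 B x≢0))))

  inv-cong : ∀ {A B} → A ≗ᶜ B → inv A ≗ᶜ inv B
  inv-cong {A} {B} h = by-units (inv-0 A) (inv-0 B) (λ x x≢0 → trans (inv-≢0 A x≢0) (trans (h _) (sym (inv-≢0 B x≢0))))

  χ·inv-ε : ∀ {χ} → IsChar χ → (χ · inv χ) ≗ᶜ ε
  χ·inv-ε {χ} c = by-units (0-*ˡ (at0 c)) ε-0 (λ x x≢0 → trans (χ·inv c x≢0) (sym (ε-≢0 x≢0)))

  inv-ε : inv ε ≗ᶜ ε
  inv-ε = by-units (inv-0 ε) ε-0 (λ x x≢0 → trans (inv-≢0 ε x≢0) (trans (ε-≢0 (FP.⁻¹-≢0 x≢0)) (sym (ε-≢0 x≢0))))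

  inv-≉ε : ∀ {χ} → IsChar χ → ¬ (χ ≗ᶜ ε) → ¬ (inv χ ≗ᶜ ε)
  inv-≉ε c χ≉ε h = χ≉ε (λ x → trans (sym (inv-inv c x)) (trans (inv-cong h x) (inv-ε x)))

  ·ε : ∀ {χ} → IsChar χ → (χ · ε) ≗ᶜ χ
  ·ε c = by-units (0-*ˡ (at0 c)) (at0 c) (λ x x≢0 → trans (*-congˡ (ε-≢0 x≢0)) (*-identityʳ _))

  -1ᶠ : 𝔽
  -1ᶠ = -ᶠ 1ᶠ

  -1ᶠ²≡1 : -1ᶠ *ᶠ -1ᶠ ≡ 1ᶠ
  -1ᶠ²≡1 = solveᶠ 0 (:-ᶠ :1ᶠ :*ᶠ :-ᶠ :1ᶠ :=ᶠ :1ᶠ) ≡.refl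

  χ[-1]² : ∀ {χ} → IsChar χ → χ -1ᶠ * χ -1ᶠ ≈ 1#
  χ[-1]² {χ} c = trans (sym (at* c _ _)) (trans (reflexive (≡.cong χ -1ᶠ²≡1)) (at1 c))

  at-neg : ∀ {χ} → IsChar χ → ∀ x → χ (-ᶠ x) ≈ χ -1ᶠ * χ x
  at-neg {χ} c x = trans (reflexive (≡.cong χ (solveᶠ 1 (λ x → :-ᶠ x :=ᶠ :-ᶠ :1ᶠ :*ᶠ x) ≡.refl x))) (at* c _ _)

  inv[-1] : ∀ {χ} → inv χ -1ᶠ ≈ χ -1ᶠ
  inv[-1] {χ} = trans (inv-≢0 χ FP.-1≢0) (reflexive (≡.cong χ (≡.sym (FP.⁻¹-unique -1ᶠ²≡1))))

  sumF-ε : sumF ε ≈ N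
  sumF-ε = begin
    sumF ε  ≈⟨ solve 1 (λ s → s := (:1 :+ s) :- :1) refl (sumF ε) ⟩
    (1# + sumF ε) - 1#  ≈⟨ +-congʳ total ⟩
    (1# + N) - 1#  ≈⟨ solve 1 (λ s → (:1 :+ s) :- :1 := s) refl N ⟩
    N  ∎
    where
    total : 1# + sumF ε ≈ 1# + N
    total = begin
      1# + sumF ε  ≈⟨ +-congʳ (sumF-ι 0ᶠ (λ _ → 1#)) ⟨
      sumF (λ x → ι (x ≟ᶠ 0ᶠ) * 1#) + sumF ε  ≈⟨ sumF-+ _ _ ⟨
      sumF (λ x → ι (x ≟ᶠ 0ᶠ) * 1# + ε x)  ≈⟨ sumF-cong (λ x → cases (x ≟ᶠ 0ᶠ)
          (λ { ≡.refl → trans (+-cong (ι-yes-* (x ≟ᶠ 0ᶠ) ≡.refl) ε-0) (+-identityʳ _) })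
          (λ e → trans (+-cong (ι-no-* (x ≟ᶠ 0ᶠ) e) (ε-≢0 e)) (+-identityˡ _))) ⟩
      sumF (λ _ → 1#)  ≈⟨ sumF-1 ⟩
      Q  ≈⟨ Q≈1+N ⟩
      1# + N  ∎

  -- S = Σχ satisfies S χ(y) = S for every unit y, hence S² = (q − 1) S; and S = q − 1 would force χ = ε.
  sumF-nontrivial : ∀ {χ} → IsChar χ → ¬ (χ ≗ᶜ ε) → sumF χ ≈ 0#
  sumF-nontrivial {χ} c χ≉ε = KP.*-≈0 N⁻¹≉0 (trans (*-comm _ _) (KP.idempotent-≈0 idem e≉1))
    where
    S = sumF χ
    N⁻¹ = 1# / N
    N⁻¹N : N⁻¹ * N ≈ 1#
    N⁻¹N = KP./-* 1# N≉0
    N⁻¹≉0 : ¬ (N⁻¹ ≈ 0#)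
    N⁻¹≉0 h = KP.1≉0 (trans (sym N⁻¹N) (0-*ˡ h))
    absorb : ∀ y → y ≢ 0ᶠ → S * χ y ≈ S
    absorb y y≢0 = begin
      S * χ y  ≈⟨ *-comm _ _ ⟩
      χ y * S  ≈⟨ sumF-*ˡ (χ y) χ ⟨
      sumF (λ x → χ y * χ x)  ≈⟨ sumF-cong (λ x → at* c y x) ⟨
      sumF (λ x → χ (y *ᶠ x))  ≈⟨ sumF-scale y≢0 χ ⟩
      S  ∎
    SS : S * S ≈ S * N
    SS = begin
      S * S  ≈⟨ sumF-*ˡ S χ ⟨
      sumF (λ y → S * χ y)  ≈⟨ sumF-cong (by-units (0-*ʳ (at0 c)) (0-*ʳ ε-0)
                                           (λ y y≢0 → trans (absorb y y≢0) (sym (trans (*-congˡ (ε-≢0 y≢0)) (*-identityʳ S))))) ⟩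
      sumF (λ y → S * ε y)  ≈⟨ sumF-*ˡ S ε ⟩
      S * sumF ε  ≈⟨ *-congˡ sumF-ε ⟩
      S * N  ∎
    e = S * N⁻¹
    idem : e * e ≈ e
    idem = begin
      (S * N⁻¹) * (S * N⁻¹)  ≈⟨ solve 2 (λ s n → (s :* n) :* (s :* n) := (s :* s) :* (n :* n)) refl S N⁻¹ ⟩
      (S * S) * (N⁻¹ * N⁻¹)  ≈⟨ *-congʳ SS ⟩
      (S * N) * (N⁻¹ * N⁻¹)  ≈⟨ solve 3 (λ s n m → (s :* m) :* (n :* n) := (s :* n) :* (n :* m)) refl S N⁻¹ N ⟩
      (S * N⁻¹) * (N⁻¹ * N)  ≈⟨ *-congˡ N⁻¹N ⟩
      e * 1#  ≈⟨ *-identityʳ e ⟩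
      e  ∎
    e≉1 : ¬ (e ≈ 1#)
    e≉1 e≈1 = χ≉ε (by-units (at0 c) ε-0 λ y y≢0 → begin
      χ y  ≈⟨ *-identityˡ _ ⟨
      1# * χ y  ≈⟨ *-congʳ e≈1 ⟨
      (S * N⁻¹) * χ y  ≈⟨ solve 3 (λ s n x → (s :* n) :* x := (s :* x) :* n) refl S N⁻¹ (χ y) ⟩
      (S * χ y) * N⁻¹  ≈⟨ *-congʳ (absorb y y≢0) ⟩
      S * N⁻¹  ≈⟨ e≈1 ⟩
      1#  ≈⟨ ε-≢0 y≢0 ⟨
      ε y  ∎)

-- Orthogonality and duality of characters

module CharacterDuality
  (F : FiniteField) (K : CharZeroField) (p r : ℕ) (ζ : CharZeroField.Carrier K)
  (chars : List (FiniteField.Carrier F → CharZeroField.Carrier K)) where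
  open CharacterSums F K p r ζ chars

  -- The inner product of characters without the factor 1 / (q - 1).
  pairing : Char → Char → Carrier
  pairing χ ψ = sumF (χ · inv ψ)

  pairing-≗ : ∀ {χ ψ} → IsChar χ → χ ≗ᶜ ψ → pairing ψ χ ≈ N
  pairing-≗ {χ} c h = trans (sumF-cong (λ x → trans (*-congʳ (sym (h x))) (χ·inv-ε c x))) sumF-ε

  ≗-from-ratio : ∀ {χ ψ} → IsChar χ → IsChar ψ → (ψ · inv χ) ≗ᶜ ε → χ ≗ᶜ ψ
  ≗-from-ratio {χ} {ψ} c d h = by-units (at0 c) (at0 d) λ x x≢0 → sym (begin
    ψ x  ≈⟨ *-identityʳ _ ⟨
    ψ x * 1#  ≈⟨ *-congˡ (trans (*-comm _ _) (χ·inv c x≢0)) ⟨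
    ψ x * (inv χ x * χ x)  ≈⟨ *-assoc _ _ _ ⟨
    ψ x * inv χ x * χ x  ≈⟨ *-congʳ (trans (h x) (ε-≢0 x≢0)) ⟩
    1# * χ x  ≈⟨ *-identityˡ _ ⟩
    χ x  ∎)

  pairing-≗̸ : ∀ {χ ψ} → IsChar χ → IsChar ψ → ¬ (χ ≗ᶜ ψ) → pairing ψ χ ≈ 0#
  pairing-≗̸ c d h = sumF-nontrivial (isChar-· d (isChar-inv c)) (λ e → h (≗-from-ratio c d e))

  module Enumeration
           (chars-IsChar : All IsChar chars)
           (chars-complete : ∀ χ → IsChar χ → Any (λ ψ → χ ≗ᶜ ψ) chars)
           (chars-distinct : AllPairs (λ χ ψ → ¬ (χ ≗ᶜ ψ)) chars)
           (chars-length : length chars ≡ q ℕ.∸ 1) where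

    ≗-sym : ∀ {χ ψ} → χ ≗ᶜ ψ → ψ ≗ᶜ χ
    ≗-sym h x = sym (h x)

    ≗-trans : ∀ {χ ψ η} → χ ≗ᶜ ψ → ψ ≗ᶜ η → χ ≗ᶜ η
    ≗-trans h k x = trans (h x) (k x)

    ∉-distinct : ∀ {χ xs} {A : Char} → χ ≗ᶜ A → All (λ ψ → ¬ (A ≗ᶜ ψ)) xs → ¬ Any (χ ≗ᶜ_) xs
    ∉-distinct h (n ∷ _)  (here k)  = n (≗-trans (≗-sym h) k)
    ∉-distinct h (_ ∷ ns) (there k) = ∉-distinct h ns k

    -- Equality of characters is decided by their positions in the enumeration.
    _≗?_ : ∀ {χ ψ} → IsChar χ → IsChar ψ → Dec (χ ≗ᶜ ψ)
    _≗?_ {χ} {ψ} c d = go chars-distinct (chars-complete χ c) (chars-complete ψ d)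
      where
      go : ∀ {xs} → AllPairs (λ χ ψ → ¬ (χ ≗ᶜ ψ)) xs → Any (χ ≗ᶜ_) xs → Any (ψ ≗ᶜ_) xs → Dec (χ ≗ᶜ ψ)
      go _        (here h)  (here k)  = yes (≗-trans h (≗-sym k))
      go (n ∷ _)  (here h)  (there k) = no (λ e → ∉-distinct (≗-trans (≗-sym e) h) n k)
      go (n ∷ _)  (there h) (here k)  = no (λ e → ∉-distinct (≗-trans e k) n h)
      go (_ ∷ ns) (there h) (there k) = go ns h k

    -- By orthogonality only the one listed representative of χ contributes. It equals χ merely
    -- pointwise, so `f` has to respect `≗ᶜ`.
    reproduce : ∀ {χ} → IsChar χ → (f : Char → Carrier) → (∀ {ψ} → χ ≗ᶜ ψ → f χ ≈ f ψ) →
                ∑ chars (λ ψ → pairing ψ χ * f ψ) ≈ N * f χ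
    reproduce {χ} c f f-cong = go chars-IsChar chars-distinct (chars-complete χ c)
      where
      vanish : ∀ {xs A} → All IsChar xs → χ ≗ᶜ A → All (λ ψ → ¬ (A ≗ᶜ ψ)) xs → ∑ xs (λ ψ → pairing ψ χ * f ψ) ≈ 0#
      vanish []       h []       = refl
      vanish (d ∷ ds) h (n ∷ ns) = trans (+-cong (0-*ˡ (pairing-≗̸ c d (λ e → n (≗-trans (≗-sym h) e)))) (vanish ds h ns)) (+-identityˡ 0#)
      go : ∀ {xs} → All IsChar xs → AllPairs (λ χ ψ → ¬ (χ ≗ᶜ ψ)) xs → Any (χ ≗ᶜ_) xs →
           ∑ xs (λ ψ → pairing ψ χ * f ψ) ≈ N * f χ
      go (d ∷ ds) (n ∷ _)  (here h)  = trans (+-cong (*-cong (pairing-≗ c h) (sym (f-cong h))) (vanish ds h n)) (+-identityʳ _)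
      go (d ∷ ds) (n ∷ ns) (there h) = trans (+-cong (0-*ˡ (pairing-≗̸ c d (λ e → ∉-distinct e n h))) (go ds ns h)) (+-identityˡ _)

    total : 𝔽 → Carrier
    total x = ∑ chars (λ χ → χ x)

    pairing-flip : ∀ {χ ψ} → IsChar χ → IsChar ψ → pairing χ ψ ≈ pairing ψ χ
    pairing-flip {χ} {ψ} c d = sumF-reciprocal FP.1≢0
      (0-*ˡ (at0 c)) (0-*ˡ (at0 d))
      (λ x x≢0 → trans (*-comm _ _) (sym (trans (reflexive (≡.cong (λ y → ψ y * inv χ y) (FP.*-identityˡ (x ⁻¹ᶠ))))
        (*-cong (sym (inv-≢0 ψ x≢0)) (inv-at-⁻¹ χ x≢0)))))

    -- Multiplication by χ permutes the characters. Since `χ · ψ` is in the list only up to `≗ᶜ`,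
    -- the permutation is carried out by applying `reproduce` twice, with `move` shifting χ from one
    -- side of the pairing to the other.
    total-absorbs : ∀ {χ} → IsChar χ → ∀ x → χ x * total x ≈ total x
    total-absorbs {χ} c x = KP.*-cancelˡ N≉0 (begin
      N * (χ x * total x)  ≈⟨ *-congˡ (∑-*ˡ chars (χ x) _) ⟨
      N * ∑ chars (λ ψ → χ x * ψ x)  ≈⟨ ∑-*ˡ chars N _ ⟨
      ∑ chars (λ ψ → N * (χ · ψ) x)  ≈⟨ ∑-cong-All (All.map (λ d → sym (reproduce (isChar-· c d) (λ η → η x) (λ h → h x))) chars-IsChar) ⟩
      ∑ chars (λ ψ → ∑ chars (λ η → pairing η (χ · ψ) * η x))  ≈⟨ ∑-swap chars chars _ ⟩
      ∑ chars (λ η → ∑ chars (λ ψ → pairing η (χ · ψ) * η x))  ≈⟨ ∑-cong-All (All.map inner chars-IsChar) ⟩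
      ∑ chars (λ η → N * η x)  ≈⟨ ∑-*ˡ chars N _ ⟩
      N * total x  ∎)
      where
      move : ∀ {η ψ} → IsChar η → IsChar ψ → pairing η (χ · ψ) ≈ pairing ψ (η · inv χ)
      move {η} {ψ} e d = trans (sumF-cong (λ y → trans (*-congˡ (inv-· χ ψ y)) (sym (*-assoc _ _ _))))
                               (pairing-flip (isChar-· e (isChar-inv c)) d)
      inner : ∀ {η} → IsChar η → ∑ chars (λ ψ → pairing η (χ · ψ) * η x) ≈ N * η x
      inner {η} e = begin
        ∑ chars (λ ψ → pairing η (χ · ψ) * η x)  ≈⟨ ∑-cong-All (All.map (λ d → *-congʳ (move e d)) chars-IsChar) ⟩
        ∑ chars (λ ψ → pairing ψ (η · inv χ) * η x)  ≈⟨ reproduce (isChar-· e (isChar-inv c)) (λ _ → η x) (λ _ → refl) ⟩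
        N * η x  ∎

    ∑-const : ∀ {X : Set} (xs : List X) c → ∑ xs (λ _ → c) ≈ fromℕ (length xs) * c
    ∑-const []       c = sym (zeroˡ c)
    ∑-const (x ∷ xs) c = trans (+-cong (sym (*-identityˡ c)) (∑-const xs c)) (sym (distribʳ c _ _))

    ∑chars-const : ∀ c → ∑ chars (λ _ → c) ≈ N * c
    ∑chars-const c = trans (∑-const chars c) (*-congʳ (reflexive (≡.cong fromℕ chars-length)))

    total-1 : total 1ᶠ ≈ N
    total-1 = trans (∑-cong-All (All.map at1 chars-IsChar)) (trans (∑chars-const 1#) (*-identityʳ N))

    total-idempotent : ∀ x → total x * total x ≈ N * total x
    total-idempotent x = begin
      total x * total x  ≈⟨ ∑-*ʳ chars (total x) _ ⟨
      ∑ chars (λ χ → χ x * total x)  ≈⟨ ∑-cong-All (All.map (λ c → total-absorbs c x) chars-IsChar) ⟩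
      ∑ chars (λ _ → total x)  ≈⟨ ∑chars-const (total x) ⟩
      N * total x  ∎

    sumF-total : sumF total ≈ N
    sumF-total = begin
      sumF (λ x → ∑ chars (λ χ → χ x))  ≈⟨ ∑-swap F.elements chars _ ⟩
      ∑ chars (λ χ → sumF χ)  ≈⟨ ∑-cong-All (All.map (λ c → trans (sumF-cong (λ x → sym (trans (*-congˡ (inv-ε x)) (·ε c x)))) (sym (*-identityʳ _))) chars-IsChar) ⟩
      ∑ chars (λ χ → pairing χ ε * 1#)  ≈⟨ reproduce isChar-ε (λ _ → 1#) (λ _ → refl) ⟩
      N * 1#  ≈⟨ *-identityʳ N ⟩
      N  ∎

    -- The usual proof needs a character with χ(x) ≠ 1 and so the structure of the unit group. Here
    -- counting replaces it: `total / N` is idempotent at every point, its value at 1 is 1 because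
    -- there are q - 1 characters, and its sum over the field is also 1. The values away from 1 are
    -- therefore idempotents with sum 0.
    total-ι : ∀ x → total x ≈ N * ι (x ≟ᶠ 1ᶠ)
    total-ι x = cases (x ≟ᶠ 1ᶠ)
      (λ { ≡.refl → trans total-1 (sym (trans (*-congˡ (ι-yes (x ≟ᶠ 1ᶠ) ≡.refl)) (*-identityʳ N))) })
      (λ x≢1 → trans (off-1 x≢1) (sym (trans (*-congˡ (ι-no (x ≟ᶠ 1ᶠ) x≢1)) (zeroʳ N))))
      where
      N⁻¹ = 1# / N
      N⁻¹N : N⁻¹ * N ≈ 1#
      N⁻¹N = KP./-* 1# N≉0
      e : 𝔽 → Carrier
      e y = N⁻¹ * (total y - ι (y ≟ᶠ 1ᶠ) * total y)
      e-1 : ∀ {y} → y ≡ 1ᶠ → e y ≈ 0#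
      e-1 {y} h = 0-*ʳ (trans (+-congˡ (-‿cong (ι-yes-* (y ≟ᶠ 1ᶠ) h))) (-‿inverseʳ _))
      e-≢1 : ∀ {y} → y ≢ 1ᶠ → e y ≈ N⁻¹ * total y
      e-≢1 {y} h = *-congˡ (trans (+-congˡ (-‿cong (ι-no-* (y ≟ᶠ 1ᶠ) h))) (solve 1 (λ t → t :- :0 := t) refl (total y)))
      e-idempotent : ∀ y → e y * e y ≈ e y
      e-idempotent y = cases (y ≟ᶠ 1ᶠ)
        (λ h → trans (*-cong (e-1 h) (e-1 h)) (trans (zeroˡ _) (sym (e-1 h))))
        (λ h → begin
          e y * e y  ≈⟨ *-cong (e-≢1 h) (e-≢1 h) ⟩
          (N⁻¹ * total y) * (N⁻¹ * total y)  ≈⟨ solve 2 (λ n t → (n :* t) :* (n :* t) := (n :* n) :* (t :* t)) refl N⁻¹ (total y) ⟩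
          (N⁻¹ * N⁻¹) * (total y * total y)  ≈⟨ *-congˡ (total-idempotent y) ⟩
          (N⁻¹ * N⁻¹) * (N * total y)  ≈⟨ solve 3 (λ n t m → (n :* n) :* (m :* t) := (n :* m) :* (n :* t)) refl N⁻¹ (total y) N ⟩
          (N⁻¹ * N) * (N⁻¹ * total y)  ≈⟨ trans (*-congʳ N⁻¹N) (*-identityˡ _) ⟩
          N⁻¹ * total y  ≈⟨ e-≢1 h ⟨
          e y  ∎)
      sum-e : sumF e ≈ 0#
      sum-e = begin
        sumF e  ≈⟨ sumF-*ˡ N⁻¹ _ ⟩
        N⁻¹ * sumF (λ y → total y - ι (y ≟ᶠ 1ᶠ) * total y)  ≈⟨ *-congˡ (trans (sumF-cong (λ y → +-congˡ (minus y))) (sumF-+ _ _)) ⟩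
        N⁻¹ * (sumF total + sumF (λ y → - 1# * (ι (y ≟ᶠ 1ᶠ) * total y)))  ≈⟨ *-congˡ (+-cong sumF-total (trans (sumF-*ˡ (- 1#) _) (*-congˡ (trans (sumF-ι 1ᶠ total) total-1)))) ⟩
        N⁻¹ * (N + - 1# * N)  ≈⟨ solve 2 (λ m n → m :* (n :+ (:- :1) :* n) := :0) refl N⁻¹ N ⟩
        0#  ∎
        where
        minus : ∀ y → - (ι (y ≟ᶠ 1ᶠ) * total y) ≈ - 1# * (ι (y ≟ᶠ 1ᶠ) * total y)
        minus y = solve 1 (λ t → :- t := (:- :1) :* t) refl _
      off-1 : x ≢ 1ᶠ → total x ≈ 0#
      off-1 x≢1 = KP.*-≈0 (λ h → KP.1≉0 (trans (sym N⁻¹N) (0-*ˡ h)))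
        (trans (sym (e-≢1 x≢1)) (All.lookup (KP.idempotents-sum≈0 (All.tabulate (λ {y} _ → e-idempotent y)) sum-e) (F.complete x)))

    dual-orthogonality : ∀ m n → n ≢ 0ᶠ → ∑ chars (λ χ → χ m * inv χ n) ≈ N * ι (m ≟ᶠ n)
    dual-orthogonality m n n≢0 = begin
      ∑ chars (λ χ → χ m * inv χ n)  ≈⟨ ∑-cong-All (All.map (λ {χ} c → trans (*-congˡ (inv-≢0 χ n≢0)) (sym (at* c m (n ⁻¹ᶠ)))) chars-IsChar) ⟩
      total (m *ᶠ n ⁻¹ᶠ)  ≈⟨ total-ι _ ⟩
      N * ι ((m *ᶠ n ⁻¹ᶠ) ≟ᶠ 1ᶠ)  ≈⟨ *-congˡ (ι-cong ((m *ᶠ n ⁻¹ᶠ) ≟ᶠ 1ᶠ) (m ≟ᶠ n)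
          (λ h → ≡.trans (≡.sym (FP.*⁻¹-solves m n≢0)) (≡.trans (≡.cong (_*ᶠ n) h) (FP.*-identityˡ n)))
          (λ { ≡.refl → F.inverseʳ m n≢0 })) ⟩
      N * ι (m ≟ᶠ n)  ∎

-- Jacobi sums

module JacobiSums
  (F : FiniteField) (K : CharZeroField) (p r : ℕ) (ζ : CharZeroField.Carrier K)
  (chars : List (FiniteField.Carrier F → CharZeroField.Carrier K)) where
  open CharacterSums F K p r ζ chars

  jacobi : Char → Char → Carrier
  jacobi A B = sumF (λ x → A x * B (1ᶠ +ᶠ -ᶠ x))

  jacobi-cong : ∀ {A A′ B B′} → A ≗ᶜ A′ → B ≗ᶜ B′ → jacobi A B ≈ jacobi A′ B′
  jacobi-cong h k = sumF-cong (λ x → *-cong (h x) (k _))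

  -- For σ ≠ 0 the substitution s ↦ σ s gives the Jacobi sum; at σ = 0 what is left is B(-1) Σ A B,
  -- which survives only for trivial A B. This correction enters the product of Gauss sums and, with
  -- A B = ē e, becomes the δ-term of the theorem.
  convolution : ∀ {A B} → IsChar A → IsChar B → ∀ σ →
    sumF (λ s → A s * B (σ +ᶠ -ᶠ s)) ≈ (A · B) σ * jacobi A B + ι (σ ≟ᶠ 0ᶠ) * (B -1ᶠ * sumF (A · B))
  convolution {A} {B} a b σ = cases (σ ≟ᶠ 0ᶠ)
    (λ { ≡.refl → begin
      sumF (λ s → A s * B (0ᶠ +ᶠ -ᶠ s))  ≈⟨ sumF-cong (λ s → trans (*-congˡ (trans (reflexive (≡.cong B (FP.+-identityˡ _))) (at-neg b s)))
                                                           (solve 3 (λ x m y → x :* (m :* y) := m :* (x :* y)) refl (A s) (B -1ᶠ) (B s))) ⟩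
      sumF (λ s → B -1ᶠ * (A · B) s)  ≈⟨ sumF-*ˡ _ _ ⟩
      B -1ᶠ * sumF (A · B)  ≈⟨ ι-yes-* (0ᶠ ≟ᶠ 0ᶠ) ≡.refl ⟨
      ι (0ᶠ ≟ᶠ 0ᶠ) * (B -1ᶠ * sumF (A · B))  ≈⟨ +-identityˡ _ ⟨
      0# + ι (0ᶠ ≟ᶠ 0ᶠ) * (B -1ᶠ * sumF (A · B))  ≈⟨ +-congʳ (0-*ˡ (at0 (isChar-· a b))) ⟨
      (A · B) 0ᶠ * jacobi A B + ι (0ᶠ ≟ᶠ 0ᶠ) * (B -1ᶠ * sumF (A · B)) ∎ })
    (λ σ≢0 → begin
      sumF (λ s → A s * B (σ +ᶠ -ᶠ s))  ≈⟨ sumF-scale σ≢0 _ ⟨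
      sumF (λ s → A (σ *ᶠ s) * B (σ +ᶠ -ᶠ (σ *ᶠ s)))  ≈⟨ sumF-cong (λ s → trans (*-cong (at* a σ s)
                                                                     (trans (reflexive (≡.cong B (solveᶠ 2 (λ σ s → σ :+ᶠ :-ᶠ (σ :*ᶠ s) :=ᶠ σ :*ᶠ (:1ᶠ :+ᶠ :-ᶠ s)) ≡.refl σ s))) (at* b σ _)))
                                                                   (solve 4 (λ w x y z → (w :* x) :* (y :* z) := (w :* y) :* (x :* z)) refl _ _ _ _)) ⟩
      sumF (λ s → (A · B) σ * (A s * B (1ᶠ +ᶠ -ᶠ s)))  ≈⟨ sumF-*ˡ _ _ ⟩
      (A · B) σ * jacobi A B  ≈⟨ +-identityʳ _ ⟨
      (A · B) σ * jacobi A B + 0#  ≈⟨ +-congˡ (ι-no-* (σ ≟ᶠ 0ᶠ) σ≢0) ⟨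
      (A · B) σ * jacobi A B + ι (σ ≟ᶠ 0ᶠ) * (B -1ᶠ * sumF (A · B)) ∎)

  -- For m = 0 both sides vanish because χ is nontrivial.
  sumF-ι-ratio : ∀ {χ} → IsChar χ → ¬ (χ ≗ᶜ ε) → ∀ m n → sumF (λ α → ι ((α *ᶠ m) ≟ᶠ n) * χ α) ≈ χ n * inv χ m
  sumF-ι-ratio {χ} c χ≉ε m n = cases (m ≟ᶠ 0ᶠ)
    (λ { ≡.refl → trans (degenerate (n ≟ᶠ 0ᶠ)) (sym (0-*ʳ (inv-0 χ))) })
    (λ m≢0 → trans (sumF-ι-linear n m≢0 χ) (trans (at* c _ _) (*-congˡ (sym (inv-≢0 χ m≢0)))))
    where
    degenerate : Dec (n ≡ 0ᶠ) → sumF (λ α → ι ((α *ᶠ 0ᶠ) ≟ᶠ n) * χ α) ≈ 0#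
    degenerate (yes ≡.refl) = trans (sumF-cong (λ α → ι-yes-* ((α *ᶠ 0ᶠ) ≟ᶠ 0ᶠ) (FP.zeroʳ α))) (sumF-nontrivial c χ≉ε)
    degenerate (no n≢0)     = sumF-zero (λ α → ι-no-* ((α *ᶠ 0ᶠ) ≟ᶠ n) (λ h → n≢0 (≡.trans (≡.sym h) (FP.zeroʳ α))))

  -- w = x / (1 - x) takes every value except -1 exactly once, which leaves Σ χ(w) - χ(-1).
  jacobi-inv : ∀ {χ} → IsChar χ → ¬ (χ ≗ᶜ ε) → jacobi χ (inv χ) ≈ - χ -1ᶠ
  jacobi-inv {χ} c χ≉ε = begin
    sumF (λ x → χ x * inv χ (1ᶠ +ᶠ -ᶠ x))  ≈⟨ sumF-cong (λ x → sumF-ι-ratio c χ≉ε _ x) ⟨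
    sumF (λ x → sumF (λ w → ι ((w *ᶠ (1ᶠ +ᶠ -ᶠ x)) ≟ᶠ x) * χ w))  ≈⟨ sumF-swap _ ⟩
    sumF (λ w → sumF (λ x → ι ((w *ᶠ (1ᶠ +ᶠ -ᶠ x)) ≟ᶠ x) * χ w))  ≈⟨ sumF-cong inner ⟩
    sumF (λ w → χ w + - 1# * (ι (w ≟ᶠ -1ᶠ) * χ w))  ≈⟨ sumF-+ _ _ ⟩
    sumF χ + sumF (λ w → - 1# * (ι (w ≟ᶠ -1ᶠ) * χ w))  ≈⟨ +-cong (sumF-nontrivial c χ≉ε) (trans (sumF-*ˡ _ _) (*-congˡ (sumF-ι -1ᶠ χ))) ⟩
    0# + - 1# * χ -1ᶠ  ≈⟨ solve 1 (λ x → :0 :+ (:- :1) :* x := :- x) refl _ ⟩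
    - χ -1ᶠ  ∎
    where
    linear : ∀ w x → ι ((w *ᶠ (1ᶠ +ᶠ -ᶠ x)) ≟ᶠ x) ≈ ι ((x *ᶠ (1ᶠ +ᶠ w)) ≟ᶠ w)
    linear w x = ι-cong ((w *ᶠ (1ᶠ +ᶠ -ᶠ x)) ≟ᶠ x) ((x *ᶠ (1ᶠ +ᶠ w)) ≟ᶠ w)
      (λ h → FP.-‿≡0⇒≡ (≡.trans (solveᶠ 2 (λ w x → x :*ᶠ (:1ᶠ :+ᶠ w) :+ᶠ :-ᶠ w :=ᶠ x :+ᶠ :-ᶠ (w :*ᶠ (:1ᶠ :+ᶠ :-ᶠ x))) ≡.refl w x)
                                (≡.trans (≡.cong (λ y → x +ᶠ -ᶠ y) h) (FP.-‿inverseʳ x))))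
      (λ h → FP.-‿≡0⇒≡ (≡.trans (solveᶠ 2 (λ w x → w :*ᶠ (:1ᶠ :+ᶠ :-ᶠ x) :+ᶠ :-ᶠ x :=ᶠ w :+ᶠ :-ᶠ (x :*ᶠ (:1ᶠ :+ᶠ w))) ≡.refl w x)
                                (≡.trans (≡.cong (λ y → w +ᶠ -ᶠ y) h) (FP.-‿inverseʳ w))))
    inner : ∀ w → sumF (λ x → ι ((w *ᶠ (1ᶠ +ᶠ -ᶠ x)) ≟ᶠ x) * χ w) ≈ χ w + - 1# * (ι (w ≟ᶠ -1ᶠ) * χ w)
    inner w = trans (sumF-cong (λ x → *-congʳ (linear w x))) (cases (w ≟ᶠ -1ᶠ)
      (λ { ≡.refl → trans (sumF-zero (λ x → ι-no-* ((x *ᶠ (1ᶠ +ᶠ -1ᶠ)) ≟ᶠ -1ᶠ) (λ h → FP.-1≢0 (≡.trans (≡.sym h)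
                       (solveᶠ 1 (λ x → x :*ᶠ (:1ᶠ :+ᶠ :-ᶠ :1ᶠ) :=ᶠ :0ᶠ) ≡.refl x)))))
             (sym (trans (+-congˡ (*-congˡ (ι-yes-* (w ≟ᶠ -1ᶠ) ≡.refl))) (solve 1 (λ x → x :+ (:- :1) :* x := :0) refl _))) })
      (λ w≢-1 → trans (sumF-ι-linear w (λ h → w≢-1 (≡.trans (solveᶠ 1 (λ w → w :=ᶠ (:1ᶠ :+ᶠ w) :+ᶠ :-ᶠ :1ᶠ) ≡.refl w)
                                                    (≡.trans (≡.cong (_+ᶠ -1ᶠ) h) (FP.+-identityˡ -1ᶠ)))) (λ _ → χ w))
             (sym (trans (+-congˡ (*-congˡ (ι-no-* (w ≟ᶠ -1ᶠ) w≢-1))) (solve 1 (λ x → x :+ (:- :1) :* :0 := x) refl _)))))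

  -- The quadratic character and the duplication of Jacobi sums

  module QuadraticCharacter (2≢0 : 1ᶠ +ᶠ 1ᶠ ≢ 0ᶠ) where

    Square : 𝔽 → Set
    Square x = ∃ λ y → y *ᶠ y ≡ x

    square? : ∀ x → Dec (Square x)
    square? x with any? (λ y → (y *ᶠ y) ≟ᶠ x) F.elements
    ... | yes w = yes (proj₁ (find w) , proj₂ (proj₂ (find w)))
    ... | no ¬w = no (λ s → ¬w (lose (F.complete (proj₁ s)) (proj₂ s)))

    φ-0 : φ 0ᶠ ≈ 0#
    φ-0 = reflexive isZero-0

    φ-square : ∀ {x} → x ≢ 0ᶠ → Square x → φ x ≈ 1#
    φ-square {x} x≢0 s = trans (reflexive (isZero-≢0 x≢0)) (reflexive branch)
      where
      branch : (if isSquare x then 1# else - 1#) ≡ 1#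
      branch with any? (λ y → (y *ᶠ y) ≟ᶠ x) F.elements
      ... | yes _ = ≡.refl
      ... | no ¬w = ⊥-elim (¬w (lose (F.complete (proj₁ s)) (proj₂ s)))

    φ-nonsquare : ∀ {x} → ¬ Square x → φ x ≈ - 1#
    φ-nonsquare {x} s = trans (reflexive (isZero-≢0 {a = x} λ { ≡.refl → s (0ᶠ , FP.zeroˡ 0ᶠ) })) (reflexive branch)
      where
      branch : (if isSquare x then 1# else - 1#) ≡ - 1#
      branch with any? (λ y → (y *ᶠ y) ≟ᶠ x) F.elements
      ... | yes w = ⊥-elim (s (proj₁ (find w) , proj₂ (proj₂ (find w))))
      ... | no _  = ≡.refl

    ≢neg : ∀ {w} → w ≢ 0ᶠ → w ≢ -ᶠ w
    ≢neg {w} w≢0 h = FP.*-≢0 2≢0 w≢0 (≡.trans (solveᶠ 1 (λ w → (:1ᶠ :+ᶠ :1ᶠ) :*ᶠ w :=ᶠ w :+ᶠ w) ≡.refl w)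
      (≡.trans (≡.cong (w +ᶠ_) h) (FP.-‿inverseʳ w)))

    square-roots : ∀ {w y} → y *ᶠ y ≡ w *ᶠ w → y ≡ w ⊎ y ≡ -ᶠ w
    square-roots {w} {y} h with FP.*-≡0 {y +ᶠ -ᶠ w} {y +ᶠ -ᶠ (-ᶠ w)}
      (≡.trans (solveᶠ 2 (λ y w → (y :+ᶠ :-ᶠ w) :*ᶠ (y :+ᶠ :-ᶠ (:-ᶠ w)) :=ᶠ y :*ᶠ y :+ᶠ :-ᶠ (w :*ᶠ w)) ≡.refl y w)
               (≡.trans (≡.cong (_+ᶠ -ᶠ (w *ᶠ w)) h) (FP.-‿inverseʳ _)))
    ... | inj₁ e = inj₁ (FP.-‿≡0⇒≡ e)
    ... | inj₂ e = inj₂ (FP.-‿≡0⇒≡ e)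

    -- A nonzero square has the roots w and -w, distinct because 2 ≠ 0.
    count-roots : ∀ x → sumF (λ y → ι ((y *ᶠ y) ≟ᶠ x)) ≈ 1# + φ x
    count-roots x = cases (x ≟ᶠ 0ᶠ)
      (λ { ≡.refl → begin
        sumF (λ y → ι ((y *ᶠ y) ≟ᶠ 0ᶠ))  ≈⟨ sumF-cong (λ y → trans (ι-cong ((y *ᶠ y) ≟ᶠ 0ᶠ) (y ≟ᶠ 0ᶠ) root-0 (λ { ≡.refl → FP.zeroˡ 0ᶠ })) (sym (*-identityʳ _))) ⟩
        sumF (λ y → ι (y ≟ᶠ 0ᶠ) * 1#)  ≈⟨ sumF-ι 0ᶠ (λ _ → 1#) ⟩
        1#  ≈⟨ trans (+-congˡ φ-0) (+-identityʳ 1#) ⟨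
        1# + φ 0ᶠ  ∎ })
      (λ x≢0 → cases (square? x) (two x≢0) (λ s → begin
        sumF (λ y → ι ((y *ᶠ y) ≟ᶠ x))  ≈⟨ sumF-zero (λ y → ι-no ((y *ᶠ y) ≟ᶠ x) (λ h → s (y , h))) ⟩
        0#  ≈⟨ -‿inverseʳ 1# ⟨
        1# + - 1#  ≈⟨ +-congˡ (φ-nonsquare s) ⟨
        1# + φ x  ∎))
      where
      root-0 : ∀ {y} → y *ᶠ y ≡ 0ᶠ → y ≡ 0ᶠ
      root-0 h with FP.*-≡0 h
      ... | inj₁ e = e
      ... | inj₂ e = e
      two : x ≢ 0ᶠ → Square x → sumF (λ y → ι ((y *ᶠ y) ≟ᶠ x)) ≈ 1# + φ x
      two x≢0 (w , ≡.refl) = begin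
        sumF (λ y → ι ((y *ᶠ y) ≟ᶠ x))  ≈⟨ sumF-cong split ⟩
        sumF (λ y → ι (y ≟ᶠ w) * 1# + ι (y ≟ᶠ (-ᶠ w)) * 1#)  ≈⟨ sumF-+ _ _ ⟩
        sumF (λ y → ι (y ≟ᶠ w) * 1#) + sumF (λ y → ι (y ≟ᶠ (-ᶠ w)) * 1#) ≈⟨ +-cong (sumF-ι w (λ _ → 1#)) (sumF-ι (-ᶠ w) (λ _ → 1#)) ⟩
        1# + 1#  ≈⟨ +-congˡ (φ-square x≢0 (w , ≡.refl)) ⟨
        1# + φ x  ∎
        where
        w≢0 : w ≢ 0ᶠ
        w≢0 h = x≢0 (≡.trans (≡.cong (_*ᶠ w) h) (FP.zeroˡ w))
        split : ∀ y → ι ((y *ᶠ y) ≟ᶠ x) ≈ ι (y ≟ᶠ w) * 1# + ι (y ≟ᶠ (-ᶠ w)) * 1#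
        split y = cases (y ≟ᶠ w)
          (λ { ≡.refl → trans (ι-yes ((y *ᶠ y) ≟ᶠ x) ≡.refl) (sym (trans (+-cong (ι-yes-* (y ≟ᶠ w) ≡.refl) (ι-no-* (y ≟ᶠ (-ᶠ w)) (≢neg w≢0))) (+-identityʳ 1#))) })
          (λ y≢w → cases (y ≟ᶠ (-ᶠ w))
            (λ y≡-w → trans (ι-yes ((y *ᶠ y) ≟ᶠ x) (≡.trans (≡.cong (λ y → y *ᶠ y) y≡-w) (solveᶠ 1 (λ w → :-ᶠ w :*ᶠ :-ᶠ w :=ᶠ w :*ᶠ w) ≡.refl w)))
                        (sym (trans (+-cong (ι-no-* (y ≟ᶠ w) y≢w) (ι-yes-* (y ≟ᶠ (-ᶠ w)) y≡-w)) (+-identityˡ 1#))))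
            (λ y≢-w → trans (ι-no ((y *ᶠ y) ≟ᶠ x) (λ h → neither y≢w y≢-w (square-roots h)))
                        (sym (trans (+-cong (ι-no-* (y ≟ᶠ w) y≢w) (ι-no-* (y ≟ᶠ (-ᶠ w)) y≢-w)) (+-identityʳ 0#)))))
          where
          neither : y ≢ w → y ≢ -ᶠ w → y ≡ w ⊎ y ≡ -ᶠ w → ⊥
          neither a b (inj₁ e) = a e
          neither a b (inj₂ e) = b e

    -- The pairs (x, y) with y² = x, counted by x and by y, give q + Σ φ = q.
    sumF-φ : sumF φ ≈ 0#
    sumF-φ = begin
      sumF φ  ≈⟨ solve 2 (λ s q → s := (q :+ s) :- q) refl (sumF φ) Q ⟩
      (Q + sumF φ) - Q  ≈⟨ +-congʳ (+-congʳ sumF-1) ⟨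
      (sumF (λ _ → 1#) + sumF φ) - Q  ≈⟨ +-congʳ (sumF-+ _ _) ⟨
      sumF (λ x → 1# + φ x) - Q  ≈⟨ +-congʳ (sumF-cong count-roots) ⟨
      sumF (λ x → sumF (λ y → ι ((y *ᶠ y) ≟ᶠ x))) - Q  ≈⟨ +-congʳ (sumF-swap _) ⟩
      sumF (λ y → sumF (λ x → ι ((y *ᶠ y) ≟ᶠ x))) - Q  ≈⟨ +-congʳ (sumF-cong one) ⟩
      sumF (λ y → 1#) - Q  ≈⟨ +-congʳ sumF-1 ⟩
      Q - Q  ≈⟨ -‿inverseʳ Q ⟩
      0#  ∎
      where
      one : ∀ y → sumF (λ x → ι ((y *ᶠ y) ≟ᶠ x)) ≈ 1#
      one y = trans (sumF-cong (λ x → trans (ι-cong ((y *ᶠ y) ≟ᶠ x) (x ≟ᶠ (y *ᶠ y)) ≡.sym ≡.sym) (sym (*-identityʳ _)))) (sumF-ι (y *ᶠ y) (λ _ → 1#))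

    square-* : ∀ {x y} → Square x → Square y → Square (x *ᶠ y)
    square-* (u , ≡.refl) (v , ≡.refl) = u *ᶠ v , solveᶠ 2 (λ u v → (u :*ᶠ v) :*ᶠ (u :*ᶠ v) :=ᶠ (u :*ᶠ u) :*ᶠ (v :*ᶠ v)) ≡.refl u v

    square-*⁻ : ∀ {x y} → x ≢ 0ᶠ → Square x → Square (x *ᶠ y) → Square y
    square-*⁻ {y = y} x≢0 (u , ≡.refl) (v , h) = v *ᶠ u ⁻¹ᶠ , FP.*-cancelˡ x≢0 (
        ≡.trans (solveᶠ 3 (λ u v i → (u :*ᶠ u) :*ᶠ ((v :*ᶠ i) :*ᶠ (v :*ᶠ i)) :=ᶠ (v :*ᶠ v) :*ᶠ ((u :*ᶠ i) :*ᶠ (u :*ᶠ i))) ≡.refl u v (u ⁻¹ᶠ))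
        (≡.trans (≡.cong₂ (λ a b → a *ᶠ (b *ᶠ b)) h (F.inverseʳ u u≢0))
                 (solveᶠ 1 (λ a → a :*ᶠ (:1ᶠ :*ᶠ :1ᶠ) :=ᶠ a) ≡.refl _)))
      where
      u≢0 : u ≢ 0ᶠ
      u≢0 h = x≢0 (≡.trans (≡.cong (_*ᶠ u) h) (FP.zeroˡ u))

    -- For a nonsquare m, φ(m x) + φ(x) is −2 or 0 according as m x and x are both nonsquares or not; its sum is 0.
    nonsquare-* : ∀ {m x} → ¬ Square m → ¬ Square x → Square (m *ᶠ x)
    nonsquare-* {m} {x} m∉ x∉ = cases (square? (m *ᶠ x)) (λ s → s) (λ mx∉ → ⊥-elim (KP.1≉0
        (trans (sym (both-yes mx∉ x∉)) (All.lookup (KP.idempotents-sum≈0 (All.tabulate (λ {y} _ → idem y)) sum-both) (F.complete x)))))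
      where
      both : 𝔽 → Carrier
      both x = cases (square? (m *ᶠ x)) (λ _ → 0#) (λ _ → cases (square? x) (λ _ → 0#) (λ _ → 1#))
      both-yes : ∀ {x} → ¬ Square (m *ᶠ x) → ¬ Square x → both x ≈ 1#
      both-yes {x} a b with square? (m *ᶠ x) | square? x
      ... | yes s | _     = ⊥-elim (a s)
      ... | no _  | yes s = ⊥-elim (b s)
      ... | no _  | no _  = refl
      both-no₁ : ∀ {x} → Square (m *ᶠ x) → both x ≈ 0#
      both-no₁ {x} s with square? (m *ᶠ x)
      ... | yes _ = refl
      ... | no n  = ⊥-elim (n s)
      both-no₂ : ∀ {x} → Square x → both x ≈ 0#
      both-no₂ {x} s with square? (m *ᶠ x) | square? x
      ... | yes _ | _     = refl
      ... | no _  | yes _ = refl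
      ... | no _  | no n  = ⊥-elim (n s)
      idem : ∀ x → both x * both x ≈ both x
      idem x with square? (m *ᶠ x) | square? x
      ... | yes _ | _     = zeroˡ 0#
      ... | no _  | yes _ = zeroˡ 0#
      ... | no _  | no _  = *-identityˡ 1#
      m≢0 : m ≢ 0ᶠ
      m≢0 ≡.refl = m∉ (0ᶠ , FP.zeroˡ 0ᶠ)
      value : ∀ x → φ (m *ᶠ x) + φ x ≈ (- 1# - 1#) * both x
      value x = cases (x ≟ᶠ 0ᶠ)
        (λ { ≡.refl → trans (+-cong (trans (reflexive (≡.cong φ (FP.zeroʳ m))) φ-0) φ-0) (trans (+-identityʳ 0#) (sym (0-*ʳ (both-no₂ (0ᶠ , FP.zeroˡ 0ᶠ))))) })
        (λ x≢0 → cases (square? x)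
          (λ s → trans (+-cong (φ-nonsquare (λ t → m∉ (square-*⁻ x≢0 s (≡.subst Square (FP.*-comm m x) t)))) (φ-square x≢0 s))
                   (trans (-‿inverseˡ 1#) (sym (0-*ʳ (both-no₂ s)))))
          (λ n → cases (square? (m *ᶠ x))
            (λ s → trans (+-cong (φ-square (FP.*-≢0 m≢0 x≢0) s) (φ-nonsquare n)) (trans (-‿inverseʳ 1#) (sym (0-*ʳ (both-no₁ s)))))
            (λ k → trans (+-cong (φ-nonsquare k) (φ-nonsquare n)) (sym (trans (*-congˡ (both-yes k n)) (*-identityʳ _))))))
      sum-both : sumF both ≈ 0#
      sum-both = KP.*-≈0 -2≉0 (begin
        (- 1# - 1#) * sumF both  ≈⟨ sumF-*ˡ _ _ ⟨
        sumF (λ x → (- 1# - 1#) * both x)  ≈⟨ sumF-cong value ⟨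
        sumF (λ x → φ (m *ᶠ x) + φ x)  ≈⟨ sumF-+ _ _ ⟩
        sumF (λ x → φ (m *ᶠ x)) + sumF φ  ≈⟨ +-cong (trans (sumF-scale m≢0 φ) sumF-φ) sumF-φ ⟩
        0# + 0#  ≈⟨ +-identityʳ 0# ⟩
        0#  ∎)
        where
        -2≉0 : ¬ (- 1# - 1# ≈ 0#)
        -2≉0 h = charZero 1 (trans (solve 0 (:1 :+ (:1 :+ :0) := :- ((:- :1) :- :1)) refl) (trans (-‿cong h) (solve 0 (:- :0 := :0) refl)))

    φ-* : ∀ x y → φ (x *ᶠ y) ≈ φ x * φ y
    φ-* x y = cases (x ≟ᶠ 0ᶠ)
      (λ { ≡.refl → trans (reflexive (≡.cong φ (FP.zeroˡ y))) (trans φ-0 (sym (0-*ˡ φ-0))) })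
      (λ x≢0 → cases (y ≟ᶠ 0ᶠ)
        (λ { ≡.refl → trans (reflexive (≡.cong φ (FP.zeroʳ x))) (trans φ-0 (sym (0-*ʳ φ-0))) })
        (λ y≢0 → units x≢0 y≢0 (square? x) (square? y)))
      where
      units : x ≢ 0ᶠ → y ≢ 0ᶠ → Dec (Square x) → Dec (Square y) → φ (x *ᶠ y) ≈ φ x * φ y
      units x≢0 y≢0 (yes s) (yes t) = trans (φ-square (FP.*-≢0 x≢0 y≢0) (square-* s t)) (sym (trans (*-cong (φ-square x≢0 s) (φ-square y≢0 t)) (*-identityˡ 1#)))
      units x≢0 y≢0 (yes s) (no t)  = trans (φ-nonsquare (λ u → t (square-*⁻ x≢0 s u))) (sym (trans (*-cong (φ-square x≢0 s) (φ-nonsquare t)) (*-identityˡ _)))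
      units x≢0 y≢0 (no s)  (yes t) = trans (φ-nonsquare (λ u → s (square-*⁻ y≢0 t (≡.subst Square (FP.*-comm x y) u)))) (sym (trans (*-cong (φ-nonsquare s) (φ-square y≢0 t)) (*-identityʳ _)))
      units x≢0 y≢0 (no s)  (no t)  = trans (φ-square (FP.*-≢0 x≢0 y≢0) (nonsquare-* s t)) (sym (trans (*-cong (φ-nonsquare s) (φ-nonsquare t)) (solve 0 (:- :1 :* :- :1 := :1) refl)))

    isChar-φ : IsChar φ
    isChar-φ = record { at0 = φ-0 ; at1 = φ-square FP.1≢0 (1ᶠ , FP.*-identityˡ 1ᶠ) ; mult = φ-* }

    φ≉ε : ¬ (φ ≗ᶜ ε)
    φ≉ε h = N≉0 (trans (sym sumF-ε) (trans (sym (sumF-cong h)) sumF-φ))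

    φ·φ : (φ · φ) ≗ᶜ ε
    φ·φ = by-units (0-*ˡ φ-0) ε-0 (λ x x≢0 →
      trans (sym (φ-* x x)) (trans (φ-square (FP.*-≢0 x≢0 x≢0) (x , ≡.refl)) (sym (ε-≢0 x≢0))))

    4ᶠ : 𝔽
    4ᶠ = 1ᶠ +ᶠ (1ᶠ +ᶠ (1ᶠ +ᶠ 1ᶠ))

    4≡2*2 : 4ᶠ ≡ (1ᶠ +ᶠ 1ᶠ) *ᶠ (1ᶠ +ᶠ 1ᶠ)
    4≡2*2 = solveᶠ 0 (:1ᶠ :+ᶠ (:1ᶠ :+ᶠ (:1ᶠ :+ᶠ :1ᶠ)) :=ᶠ (:1ᶠ :+ᶠ :1ᶠ) :*ᶠ (:1ᶠ :+ᶠ :1ᶠ)) ≡.refl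

    4≢0 : 4ᶠ ≢ 0ᶠ
    4≢0 h = FP.*-≢0 2≢0 2≢0 (≡.trans (≡.sym 4≡2*2) h)

    φ-4 : φ 4ᶠ ≈ 1#
    φ-4 = φ-square 4≢0 (1ᶠ +ᶠ 1ᶠ , ≡.sym 4≡2*2)

    -- x (1 − x) = u has 1 + φ(1 − 4 u) solutions.
    jacobi-duplication : ∀ {χ} → IsChar χ → ¬ (χ ≗ᶜ ε) → χ 4ᶠ * jacobi χ χ ≈ jacobi χ φ
    jacobi-duplication {χ} c χ≉ε = begin
      χ 4ᶠ * jacobi χ χ  ≈⟨ *-congˡ (sumF-cong (λ x → trans (sym (at* c _ _)) (sym (sumF-ι _ χ)))) ⟩
      χ 4ᶠ * sumF (λ x → sumF (λ u → ι (u ≟ᶠ (x *ᶠ (1ᶠ +ᶠ -ᶠ x))) * χ u))  ≈⟨ *-congˡ (trans (sumF-swap _) (sumF-cong (λ u → trans (sumF-*ʳ (χ u) _) (*-congʳ (solutions u))))) ⟩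
      χ 4ᶠ * sumF (λ u → (1# + φ (1ᶠ +ᶠ -ᶠ (4ᶠ *ᶠ u))) * χ u)  ≈⟨ sumF-*ˡ _ _ ⟨
      sumF (λ u → χ 4ᶠ * ((1# + φ (1ᶠ +ᶠ -ᶠ (4ᶠ *ᶠ u))) * χ u))  ≈⟨ sumF-cong (λ u → trans (solve 3 (λ f p c → f :* ((:1 :+ p) :* c) := (f :* c) :+ (f :* c) :* p) refl (χ 4ᶠ) _ (χ u))
                                                                                 (sym (+-cong (at* c _ _) (*-congʳ (at* c _ _))))) ⟩
      sumF (λ u → χ (4ᶠ *ᶠ u) + χ (4ᶠ *ᶠ u) * φ (1ᶠ +ᶠ -ᶠ (4ᶠ *ᶠ u)))  ≈⟨ sumF-scale 4≢0 (λ v → χ v + χ v * φ (1ᶠ +ᶠ -ᶠ v)) ⟩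
      sumF (λ v → χ v + χ v * φ (1ᶠ +ᶠ -ᶠ v))  ≈⟨ sumF-+ _ _ ⟩
      sumF χ + jacobi χ φ  ≈⟨ trans (+-congʳ (sumF-nontrivial c χ≉ε)) (+-identityˡ _) ⟩
      jacobi χ φ  ∎
      where
      2ᶠ = 1ᶠ +ᶠ 1ᶠ
      square-completed : ∀ u x → 4ᶠ *ᶠ (u +ᶠ -ᶠ (x *ᶠ (1ᶠ +ᶠ -ᶠ x))) ≡ ((2ᶠ *ᶠ x) +ᶠ -1ᶠ) *ᶠ ((2ᶠ *ᶠ x) +ᶠ -1ᶠ) +ᶠ -ᶠ (1ᶠ +ᶠ -ᶠ (4ᶠ *ᶠ u))
      square-completed = solveᶠ 2 (λ u x → (:1ᶠ :+ᶠ (:1ᶠ :+ᶠ (:1ᶠ :+ᶠ :1ᶠ))) :*ᶠ (u :+ᶠ :-ᶠ (x :*ᶠ (:1ᶠ :+ᶠ :-ᶠ x))) :=ᶠ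
        (((:1ᶠ :+ᶠ :1ᶠ) :*ᶠ x) :+ᶠ :-ᶠ :1ᶠ) :*ᶠ (((:1ᶠ :+ᶠ :1ᶠ) :*ᶠ x) :+ᶠ :-ᶠ :1ᶠ) :+ᶠ :-ᶠ (:1ᶠ :+ᶠ :-ᶠ ((:1ᶠ :+ᶠ (:1ᶠ :+ᶠ (:1ᶠ :+ᶠ :1ᶠ))) :*ᶠ u))) ≡.refl
      self-cancel : ∀ {x y : 𝔽} → x ≡ y → x +ᶠ -ᶠ y ≡ 0ᶠ
      self-cancel ≡.refl = FP.-‿inverseʳ _
      solutions : ∀ u → sumF (λ x → ι (u ≟ᶠ (x *ᶠ (1ᶠ +ᶠ -ᶠ x)))) ≈ 1# + φ (1ᶠ +ᶠ -ᶠ (4ᶠ *ᶠ u))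
      solutions u = begin
        sumF (λ x → ι (u ≟ᶠ (x *ᶠ (1ᶠ +ᶠ -ᶠ x))))  ≈⟨ sumF-cong (λ x → ι-cong (u ≟ᶠ (x *ᶠ (1ᶠ +ᶠ -ᶠ x))) ((((2ᶠ *ᶠ x) +ᶠ -1ᶠ) *ᶠ ((2ᶠ *ᶠ x) +ᶠ -1ᶠ)) ≟ᶠ d)
              (λ h → FP.-‿≡0⇒≡ (≡.trans (≡.sym (square-completed u x)) (≡.trans (≡.cong (4ᶠ *ᶠ_) (self-cancel h)) (FP.zeroʳ 4ᶠ))))
              (λ h → FP.-‿≡0⇒≡ (FP.*-cancelˡ 4≢0 (≡.trans (square-completed u x) (≡.trans (self-cancel h) (≡.sym (FP.zeroʳ 4ᶠ))))))) ⟩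
        sumF (λ x → ι ((((2ᶠ *ᶠ x) +ᶠ -1ᶠ) *ᶠ ((2ᶠ *ᶠ x) +ᶠ -1ᶠ)) ≟ᶠ d))  ≈⟨ sumF-scale 2≢0 (λ x → ι (((x +ᶠ -1ᶠ) *ᶠ (x +ᶠ -1ᶠ)) ≟ᶠ d)) ⟩
        sumF (λ x → ι (((x +ᶠ -1ᶠ) *ᶠ (x +ᶠ -1ᶠ)) ≟ᶠ d))  ≈⟨ sumF-shift -1ᶠ (λ x → ι ((x *ᶠ x) ≟ᶠ d)) ⟩
        sumF (λ x → ι ((x *ᶠ x) ≟ᶠ d))  ≈⟨ count-roots d ⟩
        1# + φ d  ∎
        where d = 1ᶠ +ᶠ -ᶠ (4ᶠ *ᶠ u)

-- Gauss sums and the Hasse-Davenport relation for duplication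

module GaussSums
  (F : FiniteField) (K : CharZeroField) (p r : ℕ) (ζ : CharZeroField.Carrier K)
  (chars : List (FiniteField.Carrier F → CharZeroField.Carrier K)) where
  open CharacterSums F K p r ζ chars
  open JacobiSums F K p r ζ chars
  open CharacterDuality F K p r ζ chars

  module AdditiveCharacter
    (θ-+ : ∀ x y → θ (x +ᶠ y) ≈ θ x * θ y)
    (θ-0 : θ 0ᶠ ≈ 1#)
    (sumF-θ : sumF θ ≈ 0#) where

    gauss-cong : ∀ {A B} → A ≗ᶜ B → gauss A ≈ gauss B
    gauss-cong h = sumF-cong (λ x → *-congʳ (h x))

    gauss-ε : gauss ε ≈ - 1#
    gauss-ε = begin
      sumF (λ x → ε x * θ x)  ≈⟨ sumF-cong (λ x → cases (x ≟ᶠ 0ᶠ)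
          (λ { ≡.refl → trans (*-congʳ ε-0) (trans (zeroˡ _) (sym (trans (+-congˡ (*-congˡ (ι-yes-* (x ≟ᶠ 0ᶠ) ≡.refl))) (solve 1 (λ t → t :+ (:- :1) :* t := :0) refl _)))) })
          (λ n → trans (*-congʳ (ε-≢0 n)) (trans (*-identityˡ _) (sym (trans (+-congˡ (*-congˡ (ι-no-* (x ≟ᶠ 0ᶠ) n))) (solve 1 (λ t → t :+ (:- :1) :* :0 := t) refl _)))))) ⟩
      sumF (λ x → θ x + - 1# * (ι (x ≟ᶠ 0ᶠ) * θ x))  ≈⟨ sumF-+ _ _ ⟩
      sumF θ + sumF (λ x → - 1# * (ι (x ≟ᶠ 0ᶠ) * θ x))  ≈⟨ +-cong sumF-θ (trans (sumF-*ˡ _ _) (*-congˡ (trans (sumF-ι 0ᶠ θ) θ-0))) ⟩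
      0# + - 1# * 1#  ≈⟨ solve 0 (:0 :+ (:- :1) :* :1 := :- :1) refl ⟩
      - 1#  ∎

    -- The substitution s ↦ s / m handles m ≠ 0. At m = 0 the sum is Σ χ = 0, in agreement with
    -- `inv χ` at 0, so for nontrivial χ the formula is uniform in m.
    gauss-scale : ∀ {χ} → IsChar χ → ¬ (χ ≗ᶜ ε) → ∀ m → sumF (λ s → χ s * θ (s *ᶠ m)) ≈ gauss χ * inv χ m
    gauss-scale {χ} c χ≉ε m = cases (m ≟ᶠ 0ᶠ)
      (λ { ≡.refl → begin
        sumF (λ s → χ s * θ (s *ᶠ 0ᶠ))  ≈⟨ sumF-cong (λ s → trans (*-congˡ (trans (reflexive (≡.cong θ (FP.zeroʳ s))) θ-0)) (*-identityʳ _)) ⟩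
        sumF χ  ≈⟨ sumF-nontrivial c χ≉ε ⟩
        0#  ≈⟨ 0-*ʳ (inv-0 χ) ⟨
        gauss χ * inv χ 0ᶠ  ∎ })
      (λ m≢0 → begin
        sumF (λ s → χ s * θ (s *ᶠ m))  ≈⟨ sumF-scale (FP.⁻¹-≢0 m≢0) _ ⟨
        sumF (λ s → χ (m ⁻¹ᶠ *ᶠ s) * θ ((m ⁻¹ᶠ *ᶠ s) *ᶠ m))  ≈⟨ sumF-cong (λ s → trans (*-cong (trans (at* c _ _) (*-congʳ (sym (inv-≢0 χ m≢0)))) (reflexive (≡.cong θ (cancel m≢0 s))))
                                                                          (trans (*-assoc _ _ _) (*-comm _ _))) ⟩
        sumF (λ s → (χ s * θ s) * inv χ m)  ≈⟨ sumF-*ʳ _ _ ⟩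
        gauss χ * inv χ m  ∎)
      where
      cancel : m ≢ 0ᶠ → ∀ s → (m ⁻¹ᶠ *ᶠ s) *ᶠ m ≡ s
      cancel m≢0 s = ≡.trans (FP.*-comm _ m) (FP.cancel-⁻¹ˡ s m≢0)

    gauss-* : ∀ {A B} → IsChar A → IsChar B → gauss A * gauss B ≈ jacobi A B * gauss (A · B) + B -1ᶠ * sumF (A · B)
    gauss-* {A} {B} a b = begin
      gauss A * gauss B  ≈⟨ sumF-product _ _ ⟩
      sumF (λ x → sumF (λ y → (A x * θ x) * (B y * θ y)))  ≈⟨ sumF-cong (λ x → sym (sumF-shift (-ᶠ x) _)) ⟩
      sumF (λ x → sumF (λ σ → (A x * θ x) * (B (σ +ᶠ -ᶠ x) * θ (σ +ᶠ -ᶠ x))))  ≈⟨ sumF-cong (λ x → sumF-cong (λ σ → trans (solve 4 (λ a t b u → (a :* t) :* (b :* u) := (a :* b) :* (t :* u)) refl _ _ _ _)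
                                                                                      (trans (*-congˡ (trans (sym (θ-+ _ _)) (reflexive (≡.cong θ (solveᶠ 2 (λ x σ → x :+ᶠ (σ :+ᶠ :-ᶠ x) :=ᶠ σ) ≡.refl x σ))))) (*-comm _ _)))) ⟩
      sumF (λ x → sumF (λ σ → θ σ * (A x * B (σ +ᶠ -ᶠ x))))  ≈⟨ trans (sumF-swap _) (sumF-cong (λ σ → trans (sumF-*ˡ _ _) (*-congˡ (convolution a b σ)))) ⟩
      sumF (λ σ → θ σ * ((A · B) σ * jacobi A B + ι (σ ≟ᶠ 0ᶠ) * (B -1ᶠ * sumF (A · B))))
        ≈⟨ sumF-cong (λ σ → solve 5 (λ t c j i s → t :* (c :* j :+ i :* s) := j :* (c :* t) :+ i :* (s :* t)) refl (θ σ) ((A · B) σ) (jacobi A B) (ι (σ ≟ᶠ 0ᶠ)) (B -1ᶠ * sumF (A · B))) ⟩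
      sumF (λ σ → jacobi A B * ((A · B) σ * θ σ) + ι (σ ≟ᶠ 0ᶠ) * ((B -1ᶠ * sumF (A · B)) * θ σ))
        ≈⟨ trans (sumF-+ _ _) (+-cong (sumF-*ˡ _ _) (trans (sumF-ι 0ᶠ _) (trans (*-congˡ θ-0) (*-identityʳ _)))) ⟩
      jacobi A B * gauss (A · B) + B -1ᶠ * sumF (A · B)  ∎

    gauss-*-nontrivial : ∀ {A B} → IsChar A → IsChar B → ¬ ((A · B) ≗ᶜ ε) → gauss A * gauss B ≈ jacobi A B * gauss (A · B)
    gauss-*-nontrivial a b h = trans (gauss-* a b) (trans (+-congˡ (0-*ʳ (sumF-nontrivial (isChar-· a b) h))) (+-identityʳ _))

    gauss-inv : ∀ {χ} → IsChar χ → ¬ (χ ≗ᶜ ε) → gauss χ * gauss (inv χ) ≈ χ -1ᶠ * Q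
    gauss-inv {χ} c χ≉ε = begin
      gauss χ * gauss (inv χ)  ≈⟨ gauss-* c (isChar-inv c) ⟩
      jacobi χ (inv χ) * gauss (χ · inv χ) + inv χ -1ᶠ * sumF (χ · inv χ)  ≈⟨ +-cong (*-cong (jacobi-inv c χ≉ε) (trans (gauss-cong (χ·inv-ε c)) gauss-ε))
                                                                                     (*-cong (inv[-1] {χ}) (trans (sumF-cong (χ·inv-ε c)) sumF-ε)) ⟩
      (- χ -1ᶠ) * (- 1#) + χ -1ᶠ * N  ≈⟨ solve 2 (λ x n → (:- x) :* (:- :1) :+ x :* n := x :* (:1 :+ n)) refl _ _ ⟩
      χ -1ᶠ * (1# + N)  ≈⟨ *-congˡ 1+N≈Q ⟩
      χ -1ᶠ * Q  ∎

    gauss≉0 : ∀ {χ} → IsChar χ → ¬ (χ ≗ᶜ ε) → ¬ (gauss χ ≈ 0#)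
    gauss≉0 c χ≉ε h = KP.*-≉0 (χ≉0 c FP.-1≢0) Q≉0 (trans (sym (gauss-inv c χ≉ε)) (0-*ˡ h))

    module Enumerated
      (chars-IsChar : All IsChar chars)
      (chars-complete : ∀ χ → IsChar χ → Any (λ ψ → χ ≗ᶜ ψ) chars)
      (chars-distinct : AllPairs (λ χ ψ → ¬ (χ ≗ᶜ ψ)) chars)
      (chars-length : length chars ≡ q ℕ.∸ 1) where
      open Enumeration chars-IsChar chars-complete chars-distinct chars-length

      -- Fourier inversion on the unit group. Multiplicative characters vanish at 0 while θ(0) = 1,
      -- hence the extra term.
      θ-expansion : ∀ y → N * θ y ≈ ∑ chars (λ χ → gauss (inv χ) * χ y) + N * ι (y ≟ᶠ 0ᶠ)
      θ-expansion y = cases (y ≟ᶠ 0ᶠ)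
        (λ { ≡.refl → trans (*-congˡ (trans θ-0 (sym (ι-yes (0ᶠ ≟ᶠ 0ᶠ) ≡.refl)))) (sym (trans (+-congʳ (trans
            (∑-cong-All (All.map (λ c → 0-*ʳ (at0 c)) chars-IsChar)) (∑-zero chars))) (+-identityˡ _))) })
        (λ y≢0 → begin
          N * θ y  ≈⟨ *-congˡ (sumF-ι y θ) ⟨
          N * sumF (λ x → ι (x ≟ᶠ y) * θ x)  ≈⟨ sumF-*ˡ _ _ ⟨
          sumF (λ x → N * (ι (x ≟ᶠ y) * θ x))  ≈⟨ sumF-cong (λ x → trans (inner y≢0 x) (trans (sym (∑-*ʳ chars (θ x) _)) (∑-cong chars (λ χ → trans (*-assoc _ _ _) (*-comm _ _))))) ⟩
          sumF (λ x → ∑ chars (λ χ → (inv χ x * θ x) * χ y))  ≈⟨ ∑-swap F.elements chars _ ⟩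
          ∑ chars (λ χ → sumF (λ x → (inv χ x * θ x) * χ y))  ≈⟨ ∑-cong chars (λ χ → sumF-*ʳ (χ y) _) ⟩
          ∑ chars (λ χ → gauss (inv χ) * χ y)  ≈⟨ trans (+-congˡ (0-*ʳ (ι-no (y ≟ᶠ 0ᶠ) y≢0))) (+-identityʳ _) ⟨
          ∑ chars (λ χ → gauss (inv χ) * χ y) + N * ι (y ≟ᶠ 0ᶠ)  ∎)
        where
        inner : y ≢ 0ᶠ → ∀ x → N * (ι (x ≟ᶠ y) * θ x) ≈ ∑ chars (λ χ → χ y * inv χ x) * θ x
        inner y≢0 x = cases (x ≟ᶠ 0ᶠ)
          (λ { ≡.refl → trans (*-congˡ (ι-no-* (0ᶠ ≟ᶠ y) (λ e → y≢0 (≡.sym e)))) (trans (zeroʳ N)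
              (sym (0-*ˡ (trans (∑-cong chars (λ χ → 0-*ʳ (inv-0 χ))) (∑-zero chars))))) })
          (λ x≢0 → trans (sym (*-assoc _ _ _)) (*-congʳ (trans (*-congˡ (ι-cong (x ≟ᶠ y) (y ≟ᶠ x) ≡.sym ≡.sym)) (sym (dual-orthogonality y x x≢0)))))

      module HasseDavenport (2≢0 : 1ᶠ +ᶠ 1ᶠ ≢ 0ᶠ) where
        open QuadraticCharacter 2≢0

        ≗φ⇒·φ≗ε : ∀ {χ} → χ ≗ᶜ φ → (χ · φ) ≗ᶜ ε
        ≗φ⇒·φ≗ε h x = trans (*-congʳ (h x)) (φ·φ x)

        ·φ≗ε⇒≗φ : ∀ {χ} → IsChar χ → (χ · φ) ≗ᶜ ε → χ ≗ᶜ φ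
        ·φ≗ε⇒≗φ {χ} c h = by-units (at0 c) φ-0 (λ x x≢0 → begin
          χ x  ≈⟨ trans (*-congˡ (trans (φ·φ x) (ε-≢0 x≢0))) (*-identityʳ _) ⟨
          χ x * (φ x * φ x)  ≈⟨ *-assoc _ _ _ ⟨
          (χ x * φ x) * φ x  ≈⟨ *-congʳ (trans (h x) (ε-≢0 x≢0)) ⟩
          1# * φ x  ≈⟨ *-identityˡ _ ⟩
          φ x  ∎)

        sq-φ : ∀ {χ} → χ ≗ᶜ φ → sq χ ≗ᶜ ε
        sq-φ h x = trans (*-cong (h x) (h x)) (φ·φ x)

        -- Σ (1 + φ) χ = Σ χ(x²) = q − 1 when χ² = ε, so χ φ has a nonzero sum.
        sq≗ε⇒≗φ : ∀ {χ} → IsChar χ → ¬ (χ ≗ᶜ ε) → sq χ ≗ᶜ ε → χ ≗ᶜ φ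
        sq≗ε⇒≗φ {χ} c χ≉ε χ²≗ε = cases (isChar-· c isChar-φ ≗? isChar-ε) (·φ≗ε⇒≗φ c)
          (λ h → ⊥-elim (N≉0 (begin
            N  ≈⟨ sumF-ε ⟨
            sumF ε  ≈⟨ sumF-cong χ²≗ε ⟨
            sumF (sq χ)  ≈⟨ sumF-cong (λ y → trans (sym (at* c y y)) (sym (sumF-ι (y *ᶠ y) χ))) ⟩
            sumF (λ y → sumF (λ x → ι (x ≟ᶠ (y *ᶠ y)) * χ x))  ≈⟨ sumF-swap _ ⟩
            sumF (λ x → sumF (λ y → ι (x ≟ᶠ (y *ᶠ y)) * χ x))  ≈⟨ sumF-cong (λ x → trans (sumF-*ʳ (χ x) _) (*-congʳ (trans (sumF-cong (λ y → ι-cong (x ≟ᶠ (y *ᶠ y)) ((y *ᶠ y) ≟ᶠ x) ≡.sym ≡.sym)) (count-roots x)))) ⟩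
            sumF (λ x → (1# + φ x) * χ x)  ≈⟨ sumF-cong (λ x → solve 2 (λ f c → (:1 :+ f) :* c := c :+ c :* f) refl (φ x) (χ x)) ⟩
            sumF (λ x → χ x + χ x * φ x)  ≈⟨ sumF-+ _ _ ⟩
            sumF χ + sumF (χ · φ)  ≈⟨ +-cong (sumF-nontrivial c χ≉ε) (sumF-nontrivial (isChar-· c isChar-φ) h) ⟩
            0# + 0#  ≈⟨ +-identityʳ 0# ⟩
            0#  ∎)))

        -- Expressing g(χ)² and g(χ) g(φ) through J(χ, χ) and J(χ, φ) requires χ and χ² to be
        -- nontrivial, and g(χ) ≠ 0 is then cancelled. In the remaining cases χ = ε and χ = φ both
        -- sides are g(ε) g(φ), as χ(4) = 1.
        gauss-duplication : ∀ {χ} → IsChar χ → χ 4ᶠ * (gauss χ * gauss (χ · φ)) ≈ gauss (sq χ) * gauss φ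
        gauss-duplication {χ} c = cases (c ≗? isChar-ε) trivial (λ χ≉ε → cases (isChar-· c c ≗? isChar-ε) (quadratic χ≉ε) (generic χ≉ε))
          where
          trivial : χ ≗ᶜ ε → χ 4ᶠ * (gauss χ * gauss (χ · φ)) ≈ gauss (sq χ) * gauss φ
          trivial h = trans (*-cong (trans (h 4ᶠ) (ε-≢0 4≢0)) (*-cong (gauss-cong (λ x → trans (h x) (sym (trans (*-cong (h x) (h x)) (·ε isChar-ε x)))))
              (gauss-cong (λ x → trans (*-comm _ _) (trans (*-congˡ (h x)) (·ε isChar-φ x)))))) (*-identityˡ _)
          quadratic : ¬ (χ ≗ᶜ ε) → sq χ ≗ᶜ ε → χ 4ᶠ * (gauss χ * gauss (χ · φ)) ≈ gauss (sq χ) * gauss φ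
          quadratic χ≉ε k = trans (*-cong (trans (h 4ᶠ) φ-4) (*-cong (gauss-cong h) (gauss-cong (λ x → trans (≗φ⇒·φ≗ε h x) (sym (k x))))))
              (trans (*-identityˡ _) (*-comm _ _))
            where h = sq≗ε⇒≗φ c χ≉ε k
          generic : ¬ (χ ≗ᶜ ε) → ¬ (sq χ ≗ᶜ ε) → χ 4ᶠ * (gauss χ * gauss (χ · φ)) ≈ gauss (sq χ) * gauss φ
          generic χ≉ε χ²≉ε = KP.*-cancelˡ (gauss≉0 c χ≉ε) (begin
            gauss χ * (χ 4ᶠ * (gauss χ * gauss (χ · φ)))  ≈⟨ solve 3 (λ g f h → g :* (f :* (g :* h)) := (f :* (g :* g)) :* h) refl (gauss χ) (χ 4ᶠ) (gauss (χ · φ)) ⟩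
            (χ 4ᶠ * (gauss χ * gauss χ)) * gauss (χ · φ)  ≈⟨ *-congʳ (*-congˡ (gauss-*-nontrivial c c χ²≉ε)) ⟩
            (χ 4ᶠ * (jacobi χ χ * gauss (sq χ))) * gauss (χ · φ)  ≈⟨ solve 4 (λ f j g h → (f :* (j :* g)) :* h := g :* ((f :* j) :* h)) refl (χ 4ᶠ) (jacobi χ χ) (gauss (sq χ)) (gauss (χ · φ)) ⟩
            gauss (sq χ) * ((χ 4ᶠ * jacobi χ χ) * gauss (χ · φ))  ≈⟨ *-congˡ (*-congʳ (jacobi-duplication c χ≉ε)) ⟩
            gauss (sq χ) * (jacobi χ φ * gauss (χ · φ))  ≈⟨ *-congˡ (gauss-*-nontrivial c isChar-φ (λ h → χ²≉ε (sq-φ (·φ≗ε⇒≗φ c h)))) ⟨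
            gauss (sq χ) * (gauss χ * gauss φ)  ≈⟨ solve 3 (λ s g f → s :* (g :* f) := g :* (s :* f)) refl _ _ _ ⟩
            gauss χ * (gauss (sq χ) * gauss φ)  ∎)

-- Binomial coefficients modulo a prime

module _ {p : ℕ} (p-prime : Prime p) where
  open import Data.Nat using (_!; _≤_; _<_; _∸_; _*_)
  open ≡.≡-Reasoning

  prime-∤-1 : ¬ p ∣ 1
  prime-∤-1 h = ℕ.nonTrivial⇒≢1 {{prime⇒nonTrivial p-prime}} (∣1⇒≡1 h)

  prime-∤-! : ∀ k → k < p → ¬ p ∣ k !
  prime-∤-! zero    k<p h = prime-∤-1 h
  prime-∤-! (suc k) k<p h with euclidsLemma (suc k) (k !) p-prime h
  ... | inj₁ d = ℕₚ.<⇒≱ k<p (∣⇒≤ d)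
  ... | inj₂ d = prime-∤-! k (ℕₚ.<-trans (ℕₚ.n<1+n k) k<p) d

  -- p divides p! = C · (k + 1)! · (p - k - 1)!, but neither factorial, as all their factors are
  -- below p.
  prime-∣-C : ∀ k → suc k < p → p ∣ (p choose suc k)
  prime-∣-C k k<p with euclidsLemma (p choose suc k) (suc k ! * (p ∸ suc k) !) p-prime p∣
    where
    instance
      k!≢0 : ℕ.NonZero (suc k ! * (p ∸ suc k) !)
      k!≢0 = ℕₚ._!*_!≢0 (suc k) (p ∸ suc k)
      p≢0 : ℕ.NonZero p
      p≢0 = prime⇒nonZero p-prime
    p∣p! : p ∣ p !
    p∣p! = ≡.subst (λ n → n ∣ n !) (ℕₚ.suc-pred p) (m∣m*n (ℕ.pred p !))
    p∣ : p ∣ (p choose suc k) * (suc k ! * (p ∸ suc k) !)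
    p∣ = ≡.subst (p ∣_) (begin
      p !  ≡⟨ m/n*n≡m (k![n∸k]!∣n! (ℕₚ.<⇒≤ k<p)) ⟨
      (p ! ℕ./ (suc k ! * (p ∸ suc k) !)) * (suc k ! * (p ∸ suc k) !)  ≡⟨ ≡.cong (_* (suc k ! * (p ∸ suc k) !)) (nCk≡n!/k![n-k]! (ℕₚ.<⇒≤ k<p)) ⟨
      (p choose suc k) * (suc k ! * (p ∸ suc k) !)  ∎) p∣p!
  ... | inj₁ d = d
  ... | inj₂ d with euclidsLemma (suc k !) ((p ∸ suc k) !) p-prime d
  ...   | inj₁ e = ⊥-elim (prime-∤-! (suc k) k<p e)
  ...   | inj₂ e = ⊥-elim (prime-∤-! (p ∸ suc k) (ℕₚ.∸-monoʳ-< {p} {suc k} {0} ℕ.z<s (ℕₚ.<⇒≤ k<p)) e)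

  prime-∤⇒coprime : ∀ {n} → ¬ p ∣ n → Coprime p n
  prime-∤⇒coprime h (d∣p , d∣n) with prime⇒irreducible p-prime d∣p
  ... | inj₁ d≡1 = d≡1
  ... | inj₂ ≡.refl = ⊥-elim (h d∣n)

-- Roots of polynomials and Fermat's theorem for the field

module PolynomialRoots (F : FiniteField) where
  open FiniteField F
  open FiniteFieldProperties F

  eval : ∀ {n} → Vec Carrier n → Carrier → Carrier
  eval []       x = 0#
  eval (c ∷ cs) x = c + x * eval cs x

  -- Horner's scheme with the constant coefficient first. The leading coefficient 1 is the base
  -- case, so a monic polynomial of degree n is a vector of length n and its degree can be read off
  -- the type.
  evalMonic : ∀ {n} → Vec Carrier n → Carrier → Carrier
  evalMonic []       x = 1#
  evalMonic (c ∷ cs) x = c + x * evalMonic cs x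

  -- Synthetic division by X - a; each coefficient is the value at a of a tail of the dividend.
  quotient : ∀ {n} → Carrier → Vec Carrier (suc n) → Vec Carrier n
  quotient a (c ∷ [])           = []
  quotient a (c ∷ cs@(_ ∷ _))   = evalMonic cs a ∷ quotient a cs

  factor : ∀ {n} a (cs : Vec Carrier (suc n)) x → evalMonic cs x + - evalMonic cs a ≡ (x + - a) * evalMonic (quotient a cs) x
  factor a (c ∷ []) x = solve 3 (λ a c x → (c :+ x :* :1) :+ :- (c :+ a :* :1) := (x :+ :- a) :* :1) ≡.refl a c x
  factor a (c ∷ cs@(_ ∷ _)) x = ≡.trans
    (solve 5 (λ a c x e f → (c :+ x :* e) :+ :- (c :+ a :* f) := x :* (e :+ :- f) :+ (x :+ :- a) :* f) ≡.refl a c x (evalMonic cs x) (evalMonic cs a))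
    (≡.trans (≡.cong (λ t → x * t + (x + - a) * evalMonic cs a) (factor a cs x))
      (solve 4 (λ x d g f → x :* (d :* g) :+ d :* f := d :* (f :+ x :* g)) ≡.refl x (x + - a) (evalMonic (quotient a cs) x) (evalMonic cs a)))

  root-bound : ∀ {n} (cs : Vec Carrier n) {xs} → Unique xs → All (λ x → evalMonic cs x ≡ 0#) xs → length xs ℕ.≤ n
  root-bound cs {[]} u rs = ℕ.z≤n
  root-bound [] {x ∷ xs} u (r ∷ rs) = ⊥-elim (1≢0 r)
  root-bound cs@(_ ∷ _) {a ∷ xs} (n ∷ u) (r ∷ rs) = ℕ.s≤s (root-bound (quotient a cs) u (All.zipWith step (n , rs)))
    where
    step : ∀ {x} → a ≢ x × evalMonic cs x ≡ 0# → evalMonic (quotient a cs) x ≡ 0#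
    step {x} (a≢x , e) = *-cancelˡ (≢⇒-‿≢0 (λ h → a≢x (≡.sym h))) (≡.trans (≡.sym (factor a cs x))
      (≡.trans (≡.cong₂ (λ s t → s + - t) e r) (≡.trans (-‿inverseʳ 0#) (≡.sym (zeroʳ _)))))

  infixr 8 _↑_
  _↑_ : Carrier → ℕ → Carrier
  x ↑ zero  = 1#
  x ↑ suc n = x * x ↑ n

  -- A degree bound on functions: the coefficients of a trace, which is a sum of powers, then never
  -- have to be written out.
  PolynomialBelow : ℕ → (Carrier → Carrier) → Set
  PolynomialBelow n f = ∃ λ (cs : Vec Carrier n) → ∀ x → f x ≡ eval cs x

  below-0 : ∀ n → PolynomialBelow n (λ _ → 0#)
  below-0 n = replicate n 0# , go n
    where
    go : ∀ n x → 0# ≡ eval (replicate n 0#) x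
    go zero    x = ≡.refl
    go (suc n) x = ≡.trans (solve 1 (λ x → :0 := :0 :+ x :* :0) ≡.refl x) (≡.cong (λ t → 0# + x * t) (go n x))

  below-+ : ∀ {n f g} → PolynomialBelow n f → PolynomialBelow n g → PolynomialBelow n (λ x → f x + g x)
  below-+ (cs , h) (ds , k) = add cs ds , λ x → ≡.trans (≡.cong₂ _+_ (h x) (k x)) (eval-add cs ds x)
    where
    add : ∀ {n} → Vec Carrier n → Vec Carrier n → Vec Carrier n
    add []       []       = []
    add (c ∷ cs) (d ∷ ds) = c + d ∷ add cs ds
    eval-add : ∀ {n} (cs ds : Vec Carrier n) x → eval cs x + eval ds x ≡ eval (add cs ds) x
    eval-add []       []       x = +-identityˡ 0#
    eval-add (c ∷ cs) (d ∷ ds) x = ≡.trans (solve 5 (λ c d x e f → (c :+ x :* e) :+ (d :+ x :* f) := (c :+ d) :+ x :* (e :+ f)) ≡.refl c d x _ _)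
      (≡.cong (λ t → (c + d) + x * t) (eval-add cs ds x))

  below-weaken : ∀ {m n f} → m ℕ.≤ n → PolynomialBelow m f → PolynomialBelow n f
  below-weaken {n = n} m≤n (cs , h) = proj₁ (pad m≤n cs) , λ x → ≡.trans (h x) (proj₂ (pad m≤n cs) x)
    where
    pad : ∀ {m n} → m ℕ.≤ n → (cs : Vec Carrier m) → PolynomialBelow n (eval cs)
    pad {n = n} ℕ.z≤n [] = below-0 n
    pad (ℕ.s≤s le) (c ∷ cs) = c ∷ proj₁ (pad le cs) , λ x → ≡.cong (λ t → c + x * t) (proj₂ (pad le cs) x)

  below-↑ : ∀ k → PolynomialBelow (suc k) (_↑ k)
  below-↑ zero = 1# ∷ [] , solve 1 (λ x → :1 := :1 :+ x :* :0) ≡.refl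
  below-↑ (suc k) = 0# ∷ proj₁ (below-↑ k) , λ x → ≡.trans (≡.cong (x *_) (proj₂ (below-↑ k) x)) (≡.sym (+-identityˡ _))

  monic : ∀ {n} (cs : Vec Carrier n) x → evalMonic cs x ≡ x ↑ n + eval cs x
  monic []       x = ≡.sym (+-identityʳ 1#)
  monic (c ∷ cs) x = ≡.trans (≡.cong (λ t → c + x * t) (monic cs x)) (solve 4 (λ c x e f → c :+ x :* (e :+ f) := x :* e :+ (c :+ x :* f)) ≡.refl c x _ _)

  monic-root-bound : ∀ {n f} → PolynomialBelow n f → ∀ {xs} → Unique xs → All (λ x → x ↑ n + f x ≡ 0#) xs → length xs ℕ.≤ n
  monic-root-bound {n} (cs , h) u rs = root-bound cs u (All.map (λ {x} r → ≡.trans (monic cs x) (≡.trans (≡.cong (λ t → x ↑ n + t) (≡.sym (h x))) r)) rs)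

  open MonoidSums (CommutativeRing.*-commutativeMonoid commutativeRing)

  -- Multiplication by x ≠ 0 permutes the units, so their nonzero product can be cancelled from
  -- itself times x^(q - 1). The products run over the entire field with the factor 1 at 0; the x
  -- that is split off there turns the exponent q - 1 into q.
  ↑-fermat : ∀ x → x ↑ size ≡ x
  ↑-fermat x with x ≟ 0#
  ... | yes ≡.refl = zero-power 2≤size
    where
    zero-power : ∀ {n} → 2 ℕ.≤ n → 0# ↑ n ≡ 0#
    zero-power (ℕ.s≤s _) = zeroˡ _
  ... | no x≢0 = begin
      x ↑ size  ≡⟨ constant elements ⟨
      ⨁ elements (λ _ → x)  ≡⟨ ⨁-cong elements split ⟩
      ⨁ elements (λ y → onUnits y * guard (y ≟ 0#) x)  ≡⟨ ⨁-∙ elements _ _ ⟩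
      ⨁ elements onUnits * ⨁ elements (λ y → guard (y ≟ 0#) x) ≡⟨ ≡.cong₂ _*_ units-1 (⨁-guard _≟_ (λ _ → x) unique (complete 0#)) ⟩
      1# * x  ≡⟨ *-identityˡ x ⟩
      x  ∎
    where
    open ≡.≡-Reasoning
    constant : ∀ (xs : List Carrier) → ⨁ xs (λ _ → x) ≡ x ↑ length xs
    constant []       = ≡.refl
    constant (_ ∷ xs) = ≡.cong (x *_) (constant xs)
    onUnits unitValue : Carrier → Carrier
    onUnits y = cases (y ≟ 0#) (λ _ → 1#) (λ _ → x)
    unitValue y = cases (y ≟ 0#) (λ _ → 1#) (λ _ → y)
    split : ∀ y → x ≡ onUnits y * guard (y ≟ 0#) x
    split y with y ≟ 0#
    ... | yes _ = ≡.sym (*-identityˡ x)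
    ... | no _  = ≡.sym (*-identityʳ x)
    unitValue-≢0 : ∀ y → unitValue y ≢ 0#
    unitValue-≢0 y with y ≟ 0#
    ... | yes _  = 1≢0
    ... | no y≢0 = y≢0
    unitValue-* : ∀ y → unitValue (x * y) ≡ onUnits y * unitValue y
    unitValue-* y with (x * y) ≟ 0# | y ≟ 0#
    ... | yes _ | yes _  = ≡.sym (*-identityˡ 1#)
    ... | yes e | no y≢0 = ⊥-elim (*-≢0 x≢0 y≢0 e)
    ... | no ne | yes ≡.refl = ⊥-elim (ne (zeroʳ x))
    ... | no _  | no _   = ≡.refl
    product-≢0 : ∀ xs → ⨁ xs unitValue ≢ 0#
    product-≢0 []       = 1≢0
    product-≢0 (y ∷ xs) = *-≢0 (unitValue-≢0 y) (product-≢0 xs)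
    units-1 : ⨁ elements onUnits ≡ 1#
    units-1 = *-cancelˡ (product-≢0 elements) (begin
      ⨁ elements unitValue * ⨁ elements onUnits  ≡⟨ *-comm _ _ ⟩
      ⨁ elements onUnits * ⨁ elements unitValue  ≡⟨ ⨁-∙ elements onUnits unitValue ⟨
      ⨁ elements (λ y → onUnits y * unitValue y)  ≡⟨ ⨁-cong elements unitValue-* ⟨
      ⨁ elements (λ y → unitValue (x * y))  ≡⟨ ⨁-bijection _≟_ complete unique unitValue (x *_) (x ⁻¹ *_) (λ y → cancel-⁻¹ˡ y x≢0) (λ y → cancel-⁻¹ʳ y x≢0) ⟩
      ⨁ elements unitValue  ≡⟨ *-identityʳ _ ⟨
      ⨁ elements unitValue * 1#  ∎)

-- The local `go` functions of `tr` and `primeFieldIndex` cannot be named from outside.  Abstracting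
-- `suc n` in a goal where `go` has unfolded once separates its recursion argument from the parameter,
-- and unification then recovers the function.
mutual
  traceBelow : (F : FiniteField) (K : CharZeroField) (p : ℕ) (ζ : CharZeroField.Carrier K)
    (chars : List (FiniteField.Carrier F → CharZeroField.Carrier K)) → ℕ → FiniteField.Carrier F → ℕ → FiniteField.Carrier F
  traceBelow F K p ζ chars r α k = _

  traceBelow-suc : ∀ F K p ζ chars n α → Setup.tr F K p (suc n) ζ chars α ≡
    FiniteField._+_ F (Setup._^F_ F K p (suc n) ζ chars α (p ℕ.^ n)) (traceBelow F K p ζ chars (suc n) α n)
  traceBelow-suc F K p ζ chars n α with suc n
  ... | _ = ≡.refl

mutual
  indexBelow : (F : FiniteField) (K : CharZeroField) (r : ℕ) (ζ : CharZeroField.Carrier K)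
    (chars : List (FiniteField.Carrier F → CharZeroField.Carrier K)) → ℕ → FiniteField.Carrier F → ℕ → ℕ
  indexBelow F K r ζ chars p x k = _

  indexBelow-suc : ∀ F K r ζ chars n x → Setup.natF F K (suc n) r ζ chars n ≢ x →
    Setup.primeFieldIndex F K (suc n) r ζ chars x ≡ indexBelow F K r ζ chars (suc n) x n
  indexBelow-suc F K r ζ chars n x ne with FiniteField._≟_ F (Setup.natF F K (suc n) r ζ chars n) x
  ... | yes e = ⊥-elim (ne e)
  ... | no _ with suc n
  ...   | _ = ≡.refl

-- The additive character given by the trace

module TraceCharacter
  (F : FiniteField) (K : CharZeroField) (p r : ℕ) (ζ : CharZeroField.Carrier K)
  (chars : List (FiniteField.Carrier F → CharZeroField.Carrier K)) where
  open CharacterSums F K p r ζ chars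
  module PR = PolynomialRoots F

  module PrimePower (p-prime : Prime p) (p≢2 : p ≢ 2) (q≡p^r : q ≡ p ℕ.^ r)
                    (ζ^p≈1 : (ζ ^K p) ≈ 1#) (ζ≉1 : ¬ (ζ ≈ 1#)) where

    natF-+ : ∀ m n → natF (m ℕ.+ n) ≡ natF m +ᶠ natF n
    natF-+ zero    n = ≡.sym (FP.+-identityˡ _)
    natF-+ (suc m) n = ≡.trans (≡.cong (1ᶠ +ᶠ_) (natF-+ m n)) (≡.sym (FP.+-assoc _ _ _))

    natF-* : ∀ m n → natF (m ℕ.* n) ≡ natF m *ᶠ natF n
    natF-* zero    n = ≡.sym (FP.zeroˡ _)
    natF-* (suc m) n = ≡.trans (natF-+ n (m ℕ.* n)) (≡.trans (≡.cong (natF n +ᶠ_) (natF-* m n))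
      (solveᶠ 2 (λ m n → n :+ᶠ m :*ᶠ n :=ᶠ (:1ᶠ :+ᶠ m) :*ᶠ n) ≡.refl _ _))

    -- Translation by 1 permutes the field, so adding q · 1 does not change the sum of all elements.
    natF-q : natF q ≡ 0ᶠ
    natF-q = ≡.trans (solveᶠ 2 (λ s t → t :=ᶠ (s :+ᶠ t) :+ᶠ :-ᶠ s) ≡.refl total (natF q))
      (≡.trans (≡.cong (_+ᶠ -ᶠ total) shifted) (FP.-‿inverseʳ total))
      where
      open RingSums FP.commutativeRing using () renaming (∑ to ∑ᶠ; ∑-+ to ∑ᶠ-+; ∑-bijection to ∑ᶠ-bijection)
      total = ∑ᶠ F.elements (λ x → x)
      ones : ∀ (xs : List 𝔽) → natF (length xs) ≡ ∑ᶠ xs (λ _ → 1ᶠ)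
      ones []       = ≡.refl
      ones (_ ∷ xs) = ≡.cong (1ᶠ +ᶠ_) (ones xs)
      shifted : total +ᶠ natF q ≡ total
      shifted = ≡.trans (≡.cong (total +ᶠ_) (ones F.elements)) (≡.trans (≡.sym (∑ᶠ-+ F.elements (λ x → x) (λ _ → 1ᶠ)))
        (∑ᶠ-bijection _≟ᶠ_ F.complete F.unique (λ x → x) (_+ᶠ 1ᶠ) (_+ᶠ -1ᶠ)
          (solveᶠ 1 (λ x → (x :+ᶠ :-ᶠ :1ᶠ) :+ᶠ :1ᶠ :=ᶠ x) ≡.refl) (solveᶠ 1 (λ x → (x :+ᶠ :1ᶠ) :+ᶠ :-ᶠ :1ᶠ :=ᶠ x) ≡.refl)))

    natF-1≢0 : natF 1 ≢ 0ᶠ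
    natF-1≢0 h = FP.1≢0 (≡.trans (≡.sym (FP.+-identityʳ 1ᶠ)) h)

    natF-p : natF p ≡ 0ᶠ
    natF-p = descend r (≡.trans (≡.cong natF (≡.sym q≡p^r)) natF-q)
      where
      descend : ∀ k → natF (p ℕ.^ k) ≡ 0ᶠ → natF p ≡ 0ᶠ
      descend zero    h = ⊥-elim (natF-1≢0 h)
      descend (suc k) h with FP.*-≡0 (≡.trans (≡.sym (natF-* p (p ℕ.^ k))) h)
      ... | inj₁ e = e
      ... | inj₂ e = descend k e

    natF-multiple : ∀ k → natF (k ℕ.* p) ≡ 0ᶠ
    natF-multiple k = ≡.trans (natF-* k p) (≡.trans (≡.cong (natF k *ᶠ_) natF-p) (FP.zeroʳ _))

    coprime⇒natF≢0 : ∀ {n} → Coprime p n → natF n ≢ 0ᶠ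
    coprime⇒natF≢0 {n} c h with coprime-Bézout c
    ... | Bézout.+- x y eq = natF-1≢0 (≡.trans (≡.sym (FP.+-identityʳ _)) (≡.trans (≡.cong (natF 1 +ᶠ_)
            (≡.sym (≡.trans (natF-* y n) (≡.trans (≡.cong (natF y *ᶠ_) h) (FP.zeroʳ _))))) (≡.trans (≡.sym (natF-+ 1 (y ℕ.* n))) (≡.trans (≡.cong natF eq) (natF-multiple x)))))
    ... | Bézout.-+ x y eq = natF-1≢0 (≡.trans (≡.sym (FP.+-identityʳ _)) (≡.trans (≡.cong (natF 1 +ᶠ_) (≡.sym (natF-multiple x)))
            (≡.trans (≡.sym (natF-+ 1 (x ℕ.* p))) (≡.trans (≡.cong natF eq) (≡.trans (natF-* y n) (≡.trans (≡.cong (natF y *ᶠ_) h) (FP.zeroʳ _)))))))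

    natF≡0⇒∣ : ∀ n → natF n ≡ 0ᶠ → p ∣ n
    natF≡0⇒∣ n h with p ∣? n
    ... | yes d = d
    ... | no ¬d = ⊥-elim (coprime⇒natF≢0 (prime-∤⇒coprime p-prime ¬d) h)

    2≢0 : 1ᶠ +ᶠ 1ᶠ ≢ 0ᶠ
    2≢0 h = p≢2 (ℕₚ.≤-antisym (∣⇒≤ (natF≡0⇒∣ 2 (≡.trans (≡.cong (1ᶠ +ᶠ_) (FP.+-identityʳ 1ᶠ)) h))) (ℕ.nonTrivial⇒n>1 p {{prime⇒nonTrivial p-prime}}))

    natF-∸ : ∀ {m n} → m ℕ.≤ n → natF m ≡ natF n → natF (n ℕ.∸ m) ≡ 0ᶠ
    natF-∸ {m} {n} le e = ≡.trans (solveᶠ 2 (λ a b → b :=ᶠ (a :+ᶠ b) :+ᶠ :-ᶠ a) ≡.refl (natF m) _)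
      (≡.trans (≡.cong (_+ᶠ -ᶠ natF m) (≡.trans (≡.sym (natF-+ m (n ℕ.∸ m))) (≡.trans (≡.cong natF (ℕₚ.m+[n∸m]≡n le)) (≡.sym e)))) (FP.-‿inverseʳ _))

    natF-injective-below : ∀ {i j} → i ℕ.< j → j ℕ.< p → natF i ≢ natF j
    natF-injective-below {i} {j} i<j j<p h = ℕₚ.<⇒≱ (ℕₚ.≤-<-trans (ℕₚ.m∸n≤m j i) j<p)
      (∣⇒≤ {{ℕ.>-nonZero (ℕₚ.m<n⇒0<n∸m i<j)}} (natF≡0⇒∣ (j ℕ.∸ i) (natF-∸ (ℕₚ.<⇒≤ i<j) h)))

    ^F≡↑ : ∀ x n → x ^F n ≡ x PR.↑ n
    ^F≡↑ x zero    = ≡.refl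
    ^F≡↑ x (suc n) = ≡.cong (x *ᶠ_) (^F≡↑ x n)

    ^F-+ : ∀ x m n → x ^F (m ℕ.+ n) ≡ x ^F m *ᶠ x ^F n
    ^F-+ x zero    n = ≡.sym (FP.*-identityˡ _)
    ^F-+ x (suc m) n = ≡.trans (≡.cong (x *ᶠ_) (^F-+ x m n)) (≡.sym (FP.*-assoc _ _ _))

    ^F-* : ∀ x m n → x ^F (m ℕ.* n) ≡ (x ^F n) ^F m
    ^F-* x zero    n = ≡.refl
    ^F-* x (suc m) n = ≡.trans (^F-+ x n (m ℕ.* n)) (≡.cong (x ^F n *ᶠ_) (^F-* x m n))

    1^F : ∀ n → 1ᶠ ^F n ≡ 1ᶠ
    1^F zero    = ≡.refl
    1^F (suc n) = ≡.trans (FP.*-identityˡ _) (1^F n)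

    instance
      p≢0 : ℕ.NonZero p
      p≢0 = prime⇒nonZero p-prime

    0^F : ∀ n .{{_ : ℕ.NonZero n}} → 0ᶠ ^F n ≡ 0ᶠ
    0^F (suc n) = FP.zeroˡ _

    frobenius : ∀ x y → (x +ᶠ y) ^F p ≡ x ^F p +ᶠ y ^F p
    frobenius x y = at-p p≡1+pred
      where
      semiringᶠ = CommutativeRing.commutativeSemiring FP.commutativeRing
      open Algebra.Properties.CommutativeSemiring.Binomial semiringᶠ using (theorem; binomialTerm; binomial)
      open Algebra.Properties.Semiring.Exp (CommutativeRing.semiring FP.commutativeRing) using () renaming (_^_ to _^ˢ_)
      open import Algebra.Definitions.RawMonoid (CommutativeRing.+-rawMonoid FP.commutativeRing) using (sum) renaming (_×_ to _⊠_)
      open Algebra.Properties.Monoid.Sum (CommutativeRing.+-monoid FP.commutativeRing) using (sum-init-last; sum-cong-≋; sum-replicate-zero)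
      p≡1+pred : suc (ℕ.pred p) ≡ p
      p≡1+pred = ℕₚ.suc-pred p
      ⊠-natF : ∀ n z → n ⊠ z ≡ natF n *ᶠ z
      ⊠-natF zero    z = ≡.sym (FP.zeroˡ z)
      ⊠-natF (suc n) z = ≡.trans (≡.cong (z +ᶠ_) (⊠-natF n z)) (solveᶠ 2 (λ n z → z :+ᶠ n :*ᶠ z :=ᶠ (:1ᶠ :+ᶠ n) :*ᶠ z) ≡.refl _ z)
      ^ˢ≡^F : ∀ x n → x ^ˢ n ≡ x ^F n
      ^ˢ≡^F x zero    = ≡.refl
      ^ˢ≡^F x (suc n) = ≡.cong (x *ᶠ_) (^ˢ≡^F x n)
      -- The binomial sum is split at both ends, which requires the exponent in the form `suc m`.
      at-p : ∀ {m} → suc m ≡ p → (x +ᶠ y) ^F p ≡ x ^F p +ᶠ y ^F p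
      at-p {m} 1+m≡p = ≡.subst (λ n → (x +ᶠ y) ^F n ≡ x ^F n +ᶠ y ^F n) 1+m≡p (
        ≡.trans (≡.sym (^ˢ≡^F (x +ᶠ y) (suc m))) (≡.trans (theorem (suc m) x y)
        (≡.trans (≡.cong (t Fin.zero +ᶠ_) (sum-init-last (λ i → t (Fin.suc i))))
        (≡.trans (≡.cong₂ _+ᶠ_ first (≡.cong₂ _+ᶠ_ middle-0 last))
          (solveᶠ 2 (λ a b → b :+ᶠ (:0ᶠ :+ᶠ a) :=ᶠ a :+ᶠ b) ≡.refl (x ^F suc m) (y ^F suc m))))))
        where
        t = binomialTerm x y (suc m)
        middle : Fin.Fin m → 𝔽
        middle i = t (Fin.suc (Fin.inject₁ i))
        first : t Fin.zero ≡ y ^F suc m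
        first = ≡.trans (FP.+-identityʳ _) (≡.trans (FP.*-identityˡ _) (^ˢ≡^F y (suc m)))
        last : t (Fin.suc (Fin.fromℕ m)) ≡ x ^F suc m
        last = ≡.trans (≡.cong (λ k → (suc m choose suc k) ⊠ (x ^ˢ suc k *ᶠ y ^ˢ (m ℕ.∸ k))) (Finₚ.toℕ-fromℕ m))
          (≡.trans (≡.cong₂ (λ c d → c ⊠ (x ^ˢ suc m *ᶠ y ^ˢ d)) (nCn≡1 (suc m)) (ℕₚ.n∸n≡0 m))
          (≡.trans (FP.+-identityʳ _) (≡.trans (FP.*-identityʳ _) (^ˢ≡^F x (suc m)))))
        vanish : ∀ i → middle i ≡ 0ᶠ
        vanish i = ≡.trans (⊠-natF (suc m choose suc k) _) (≡.trans (≡.cong (_*ᶠ _) natF-C) (FP.zeroˡ _))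
          where
          k = Fin.toℕ (Fin.inject₁ i)
          p∣C : p ∣ (suc m choose suc k)
          p∣C = ≡.subst (λ n → p ∣ (n choose suc k)) (≡.sym 1+m≡p) (prime-∣-C p-prime k (≡.subst (suc k ℕ.<_) 1+m≡p
            (ℕ.s≤s (≡.subst (ℕ._< m) (≡.sym (Finₚ.toℕ-inject₁ i)) (Finₚ.toℕ<n i)))))
          natF-C : natF (suc m choose suc k) ≡ 0ᶠ
          natF-C with p∣C
          ... | divides c e = ≡.trans (≡.cong natF e) (natF-multiple c)
        middle-0 : sum middle ≡ 0ᶠ
        middle-0 = ≡.trans (sum-cong-≋ vanish) (sum-replicate-zero m)

    frobenius-iterate : ∀ i x y → (x +ᶠ y) ^F (p ℕ.^ i) ≡ x ^F (p ℕ.^ i) +ᶠ y ^F (p ℕ.^ i)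
    frobenius-iterate zero    x y = solveᶠ 2 (λ x y → (x :+ᶠ y) :*ᶠ :1ᶠ :=ᶠ x :*ᶠ :1ᶠ :+ᶠ y :*ᶠ :1ᶠ) ≡.refl x y
    frobenius-iterate (suc i) x y = ≡.trans (^F-* (x +ᶠ y) p (p ℕ.^ i)) (≡.trans (≡.cong (_^F p) (frobenius-iterate i x y))
      (≡.trans (frobenius _ _) (≡.sym (≡.cong₂ _+ᶠ_ (^F-* x p (p ℕ.^ i)) (^F-* y p (p ℕ.^ i))))))

    -- tr α = trace r α by computation.
    trace : ℕ → 𝔽 → 𝔽
    trace k α = traceBelow F K p ζ chars r α k

    trace-+ : ∀ k x y → trace k (x +ᶠ y) ≡ trace k x +ᶠ trace k y
    trace-+ zero    x y = ≡.sym (FP.+-identityˡ 0ᶠ)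
    trace-+ (suc k) x y = ≡.trans (≡.cong₂ _+ᶠ_ (frobenius-iterate k x y) (trace-+ k x y))
      (solveᶠ 4 (λ a b c d → (a :+ᶠ b) :+ᶠ (c :+ᶠ d) :=ᶠ (a :+ᶠ c) :+ᶠ (b :+ᶠ d)) ≡.refl _ _ _ _)

    -- The p-th power shifts the summands α^(p^i) by one place, so all but the two extreme ones
    -- agree. At k = r Fermat's theorem identifies these, and the trace is fixed by Frobenius.
    trace-frobenius : ∀ k α → trace k α ^F p +ᶠ α ≡ trace k α +ᶠ α ^F (p ℕ.^ k)
    trace-frobenius zero    α = ≡.cong₂ _+ᶠ_ (0^F p) (≡.sym (FP.*-identityʳ α))
    trace-frobenius (suc k) α =
      ≡.trans (≡.cong (_+ᶠ α) (frobenius (α ^F (p ℕ.^ k)) (trace k α)))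
        (≡.trans (solveᶠ 3 (λ a t x → (a :+ᶠ t) :+ᶠ x :=ᶠ a :+ᶠ (t :+ᶠ x)) ≡.refl _ _ α)
        (≡.trans (≡.cong₂ _+ᶠ_ (≡.sym (^F-* α p (p ℕ.^ k))) (trace-frobenius k α))
          (solveᶠ 3 (λ b t a → b :+ᶠ (t :+ᶠ a) :=ᶠ (a :+ᶠ t) :+ᶠ b) ≡.refl _ _ _)))

    tr-fixed : ∀ α → tr α ^F p ≡ tr α
    tr-fixed α = ≡.trans (solveᶠ 2 (λ t a → t :=ᶠ (t :+ᶠ a) :+ᶠ :-ᶠ a) ≡.refl _ α)
      (≡.trans (≡.cong (_+ᶠ -ᶠ α) (≡.trans (trace-frobenius r α) (≡.cong (tr α +ᶠ_) fermat)))
        (solveᶠ 2 (λ t a → (t :+ᶠ a) :+ᶠ :-ᶠ a :=ᶠ t) ≡.refl _ α))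
      where
      fermat : α ^F (p ℕ.^ r) ≡ α
      fermat = ≡.trans (≡.cong (α ^F_) (≡.sym q≡p^r)) (≡.trans (^F≡↑ α q) (PR.↑-fermat α))

    natF-fixed : ∀ k → natF k ^F p ≡ natF k
    natF-fixed zero    = 0^F p
    natF-fixed (suc k) = ≡.trans (frobenius 1ᶠ (natF k)) (≡.cong₂ _+ᶠ_ (1^F p) (natF-fixed k))

    p>1 : 1 ℕ.< p
    p>1 = ℕ.nonTrivial⇒n>1 p {{prime⇒nonTrivial p-prime}}

    -- The p elements natF k are roots of X^p − X, so there is no further one.
    fixed⇒natF : ∀ {x} → x ^F p ≡ x → ∃ λ k → k ℕ.< p × natF k ≡ x
    fixed⇒natF {x} fixed with ℕₚ.anyUpTo? (λ k → natF k ≟ᶠ x) p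
    ... | yes w = w
    ... | no ¬w = ⊥-elim (ℕₚ.<⇒≱ (ℕ.s≤s (ℕₚ.≤-reflexive (≡.sym (Listₚ.length-applyUpTo natF p))))
        (PR.monic-root-bound negX {x ∷ applyUpTo natF p}
          (Allₚ.applyUpTo⁺₁ natF p (λ {k} k<p e → ¬w (k , k<p , ≡.sym e)) ∷ AllPairsₚ.applyUpTo⁺₁ natF p natF-injective-below)
          (root fixed ∷ Allₚ.applyUpTo⁺₁ natF p (λ {k} _ → root (natF-fixed k)))))
      where
      negX : PR.PolynomialBelow p (λ y → -ᶠ y)
      negX = PR.below-weaken p>1 (0ᶠ ∷ -1ᶠ ∷ [] , solveᶠ 1 (λ y → :-ᶠ y :=ᶠ :0ᶠ :+ᶠ y :*ᶠ (:-ᶠ :1ᶠ :+ᶠ y :*ᶠ :0ᶠ)) ≡.refl)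
      root : ∀ {y} → y ^F p ≡ y → y PR.↑ p +ᶠ -ᶠ y ≡ 0ᶠ
      root {y} e = ≡.trans (≡.cong (_+ᶠ -ᶠ y) (≡.trans (≡.sym (^F≡↑ y p)) e)) (FP.-‿inverseʳ y)

    -- The search for the index runs downwards from p - 1 with default 0; the witness from
    -- `fixed⇒natF` guarantees that it stops before the default.
    natF-index : ∀ {x} → x ^F p ≡ x → natF (primeFieldIndex x) ≡ x
    natF-index {x} fixed = go p (fixed⇒natF fixed)
      where
      go : ∀ n → (∃ λ k → k ℕ.< n × natF k ≡ x) → natF (indexBelow F K r ζ chars p x n) ≡ x
      go (suc n) (k , k<n , e) with natF n ≟ᶠ x
      ... | yes h = h
      ... | no ne = go n (k , ℕₚ.≤∧≢⇒< (ℕₚ.≤-pred k<n) (λ k≡n → ne (≡.trans (≡.cong natF (≡.sym k≡n)) e)) , e)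

    ^K-+ : ∀ x m n → x ^K (m ℕ.+ n) ≈ x ^K m * x ^K n
    ^K-+ x zero    n = sym (*-identityˡ _)
    ^K-+ x (suc m) n = trans (*-congˡ (^K-+ x m n)) (sym (*-assoc _ _ _))

    ^K-*-1 : ∀ {x} n → x ^K n ≈ 1# → ∀ m → x ^K (m ℕ.* n) ≈ 1#
    ^K-*-1 n h zero    = refl
    ^K-*-1 n h (suc m) = trans (^K-+ _ n (m ℕ.* n)) (trans (*-cong h (^K-*-1 n h m)) (*-identityˡ 1#))

    ζ^-cong-≤ : ∀ {m n} → m ℕ.≤ n → natF m ≡ natF n → ζ ^K m ≈ ζ ^K n
    ζ^-cong-≤ {m} {n} le e with natF≡0⇒∣ (n ℕ.∸ m) (natF-∸ le e)
    ... | divides c d = sym (trans (reflexive (≡.cong (ζ ^K_) (≡.trans (≡.sym (ℕₚ.m+[n∸m]≡n le)) (≡.cong (m ℕ.+_) d))))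
            (trans (^K-+ ζ m (c ℕ.* p)) (trans (*-congˡ (^K-*-1 p ζ^p≈1 c)) (*-identityʳ _))))

    ζ^-cong : ∀ m n → natF m ≡ natF n → ζ ^K m ≈ ζ ^K n
    ζ^-cong m n h with ℕₚ.≤-total m n
    ... | inj₁ le = ζ^-cong-≤ le h
    ... | inj₂ le = sym (ζ^-cong-≤ le (≡.sym h))

    natF-index-tr : ∀ α → natF (primeFieldIndex (tr α)) ≡ tr α
    natF-index-tr α = natF-index (tr-fixed α)

    -- Indices of prime field elements add only modulo p, and ζ^p = 1 absorbs the difference.
    θ-+ : ∀ x y → θ (x +ᶠ y) ≈ θ x * θ y
    θ-+ x y = trans (ζ^-cong (primeFieldIndex (tr (x +ᶠ y))) (i ℕ.+ j)
        (≡.trans (natF-index-tr (x +ᶠ y)) (≡.trans (trace-+ r x y) (≡.sym (≡.trans (natF-+ i j) (≡.cong₂ _+ᶠ_ (natF-index-tr x) (natF-index-tr y)))))))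
      (^K-+ ζ i j)
      where
      i = primeFieldIndex (tr x)
      j = primeFieldIndex (tr y)

    tr-0 : tr 0ᶠ ≡ 0ᶠ
    tr-0 = ≡.trans (solveᶠ 1 (λ t → t :=ᶠ (t :+ᶠ t) :+ᶠ :-ᶠ t) ≡.refl (tr 0ᶠ))
      (≡.trans (≡.cong (_+ᶠ -ᶠ tr 0ᶠ) (≡.trans (≡.sym (trace-+ r 0ᶠ 0ᶠ)) (≡.cong tr (FP.+-identityˡ 0ᶠ)))) (FP.-‿inverseʳ _))

    θ-0 : θ 0ᶠ ≈ 1#
    θ-0 = ζ^-cong (primeFieldIndex (tr 0ᶠ)) 0 (≡.trans (natF-index-tr 0ᶠ) tr-0)

    trace-below : ∀ {n} k → k ℕ.≤ n → PR.PolynomialBelow (p ℕ.^ n) (trace k)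
    trace-below {n} zero    _   = PR.below-0 (p ℕ.^ n)
    trace-below {n} (suc k) k<n = PR.below-+ (power (PR.below-weaken (ℕₚ.^-monoʳ-< p p>1 k<n) (PR.below-↑ (p ℕ.^ k)))) (trace-below k (ℕₚ.<⇒≤ k<n))
      where
      power : PR.PolynomialBelow (p ℕ.^ n) (PR._↑ (p ℕ.^ k)) → PR.PolynomialBelow (p ℕ.^ n) (_^F (p ℕ.^ k))
      power (cs , h) = cs , λ x → ≡.trans (^F≡↑ x (p ℕ.^ k)) (h x)

    -- For r = k + 1 the trace is a monic polynomial of degree p^k, less than q, so it cannot vanish
    -- on the entire field.
    tr-nontrivial : ∃ λ α → tr α ≢ 0ᶠ
    tr-nontrivial with any? (λ α → ¬? (tr α ≟ᶠ 0ᶠ)) F.elements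
    ... | yes w = proj₁ (Any.satisfied w) , proj₂ (Any.satisfied w)
    ... | no ¬w = ⊥-elim (too-many r q≡p^r (λ α → zero-at α))
      where
      zero-at : ∀ α → trace r α ≡ 0ᶠ
      zero-at α with tr α ≟ᶠ 0ᶠ
      ... | yes e = e
      ... | no ne = ⊥-elim (¬w (Any.map (λ { ≡.refl → ne }) (F.complete α)))
      too-many : ∀ k → q ≡ p ℕ.^ k → (∀ α → trace k α ≡ 0ᶠ) → ⊥
      -- Here q = 1, contrary to 0 ≠ 1.
      too-many zero    e h = ℕₚ.<⇒≱ FP.2≤size (ℕₚ.≤-reflexive e)
      too-many (suc k) e h = ℕₚ.<⇒≱ (≡.subst (p ℕ.^ k ℕ.<_) (≡.sym e) (ℕₚ.^-monoʳ-< p p>1 (ℕₚ.n<1+n k)))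
        (PR.monic-root-bound (trace-below k ℕₚ.≤-refl) F.unique (All.tabulate (λ {x} _ →
          ≡.trans (≡.cong (_+ᶠ trace k x) (≡.sym (^F≡↑ x (p ℕ.^ k)))) (h x))))

    -- This is where the primality of p makes ζ primitive: k is prime to p, and Bézout's identity
    -- together with ζ^p = ζ^k = 1 would give ζ = 1.
    ζ^≉1 : ∀ k → natF k ≢ 0ᶠ → ¬ (ζ ^K k ≈ 1#)
    ζ^≉1 k k≢0 h with coprime-Bézout (prime-∤⇒coprime p-prime (λ { (divides c e) → k≢0 (≡.trans (≡.cong natF e) (natF-multiple c)) }))
    ... | Bézout.+- x y eq = ζ≉1 (begin
        ζ  ≈⟨ trans (*-congˡ (^K-*-1 k h y)) (*-identityʳ ζ) ⟨
        ζ * ζ ^K (y ℕ.* k)  ≡⟨ ≡.cong (ζ ^K_) eq ⟩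
        ζ ^K (x ℕ.* p)  ≈⟨ ^K-*-1 p ζ^p≈1 x ⟩
        1#  ∎)
    ... | Bézout.-+ x y eq = ζ≉1 (begin
        ζ  ≈⟨ trans (*-congˡ (^K-*-1 p ζ^p≈1 x)) (*-identityʳ ζ) ⟨
        ζ * ζ ^K (x ℕ.* p)  ≡⟨ ≡.cong (ζ ^K_) eq ⟩
        ζ ^K (y ℕ.* k)  ≈⟨ ^K-*-1 k h y ⟩
        1#  ∎)

    sumF-θ : sumF θ ≈ 0#
    sumF-θ = KP.*-≈0 (λ h → ζ^≉1 (primeFieldIndex (tr α)) (λ e → trα≢0 (≡.trans (≡.sym (natF-index-tr α)) e)) (KP.-‿≈0⇒≈ h)) (begin
        (θ α - 1#) * sumF θ  ≈⟨ solve 2 (λ t s → (t :- :1) :* s := t :* s :- s) refl (θ α) (sumF θ) ⟩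
        θ α * sumF θ - sumF θ  ≈⟨ +-congʳ (sumF-*ˡ (θ α) θ) ⟨
        sumF (λ x → θ α * θ x) - sumF θ  ≈⟨ +-congʳ (sumF-cong (λ x → trans (*-comm _ _) (sym (θ-+ x α)))) ⟩
        sumF (λ x → θ (x +ᶠ α)) - sumF θ  ≈⟨ +-congʳ (sumF-shift α θ) ⟩
        sumF θ - sumF θ  ≈⟨ -‿inverseʳ _ ⟩
        0#  ∎)
      where
      α = proj₁ tr-nontrivial
      trα≢0 = proj₂ tr-nontrivial

-- Euler integrals for Greene's series

module EulerIntegral
  (F : FiniteField) (K : CharZeroField) (p r : ℕ) (ζ : CharZeroField.Carrier K)
  (chars : List (FiniteField.Carrier F → CharZeroField.Carrier K)) where
  open CharacterSums F K p r ζ chars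
  open JacobiSums F K p r ζ chars
  open CharacterDuality F K p r ζ chars

  Q*binom : ∀ A B → Q * binom A B ≈ B -1ᶠ * jacobi A (inv B)
  Q*binom A B = trans (sym (*-assoc _ _ _)) (*-congʳ (trans (*-comm _ _) (KP./-* (B -1ᶠ) Q≉0)))

  N*hyp : ∀ {n} A₀ (As Bs : Vec Char n) x →
          N * hyp A₀ As Bs x ≈ Q * ∑ chars (λ χ → (binom (A₀ · χ) χ * prodBinom As Bs χ) * χ x)
  N*hyp A₀ As Bs x = trans (sym (*-assoc _ _ _)) (*-congʳ (trans (*-comm _ _) (KP./-* Q N≉0)))

  module Enumerated
    (chars-IsChar : All IsChar chars)
    (chars-complete : ∀ χ → IsChar χ → Any (λ ψ → χ ≗ᶜ ψ) chars)
    (chars-distinct : AllPairs (λ χ ψ → ¬ (χ ≗ᶜ ψ)) chars)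
    (chars-length : length chars ≡ q ℕ.∸ 1) where
    open Enumeration chars-IsChar chars-complete chars-distinct chars-length

    module _ {A B C : Char} (a : IsChar A) (b : IsChar B) (c : IsChar C) (A≉ε : ¬ (A ≗ᶜ ε)) {z : 𝔽} (z≢0 : z ≢ 0ᶠ) where

      weight : 𝔽 → 𝔽 → Carrier
      weight x y = A x * (B y * inv C (1ᶠ -ᶠ y))

      weight-0 : ∀ {x y} → x ≡ 0ᶠ ⊎ y ≡ 0ᶠ ⊎ 1ᶠ -ᶠ y ≡ 0ᶠ → weight x y ≈ 0#
      weight-0 (inj₁ ≡.refl)        = 0-*ˡ (at0 a)
      weight-0 (inj₂ (inj₁ ≡.refl)) = 0-*ʳ (0-*ˡ (at0 b))
      weight-0 (inj₂ (inj₂ e))      = 0-*ʳ (0-*ʳ (trans (reflexive (≡.cong (inv C) e)) (inv-0 C)))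

      -- Duality of characters detects x y z = (1 - x)(1 - y), which is linear in x once y is fixed.
      -- The weight vanishes for x = 0, y = 0 and y = 1; at x = 1 the kernel is 0 and the equation
      -- has no solution because y z ≠ 0.
      detect : ∀ x y → weight x y * ∑ chars (λ χ → χ ((x *ᶠ y) *ᶠ z) * inv χ ((1ᶠ -ᶠ x) *ᶠ (1ᶠ -ᶠ y))) ≈
                       weight x y * (N * ι ((x *ᶠ ((y *ᶠ z) +ᶠ (1ᶠ -ᶠ y))) ≟ᶠ (1ᶠ -ᶠ y)))
      detect x y = cases (x ≟ᶠ 0ᶠ) (λ e → vanish (inj₁ e)) (λ x≢0 → cases (y ≟ᶠ 0ᶠ) (λ e → vanish (inj₂ (inj₁ e))) (λ y≢0 →
          cases ((1ᶠ -ᶠ y) ≟ᶠ 0ᶠ) (λ e → vanish (inj₂ (inj₂ e))) (λ 1-y≢0 → *-congˡ (cases ((1ᶠ -ᶠ x) ≟ᶠ 0ᶠ)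
            (λ e → trans (∑-cong chars (λ χ → 0-*ʳ (trans (reflexive (≡.cong (inv χ) (≡.trans (≡.cong (_*ᶠ (1ᶠ -ᶠ y)) e) (FP.zeroˡ _)))) (inv-0 χ))))
              (trans (∑-zero chars) (sym (trans (*-congˡ (ι-no (lin ≟ᶠ (1ᶠ -ᶠ y)) (λ h → FP.*-≢0 (FP.*-≢0 x≢0 y≢0) z≢0
                (≡.trans (to h) (≡.trans (≡.cong (_*ᶠ (1ᶠ -ᶠ y)) e) (FP.zeroˡ _)))))) (zeroʳ N)))))
            (λ 1-x≢0 → trans (dual-orthogonality _ _ (FP.*-≢0 1-x≢0 1-y≢0)) (*-congˡ (ι-cong (((x *ᶠ y) *ᶠ z) ≟ᶠ ((1ᶠ -ᶠ x) *ᶠ (1ᶠ -ᶠ y))) (lin ≟ᶠ (1ᶠ -ᶠ y)) from to)))))))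
        where
        lin = x *ᶠ ((y *ᶠ z) +ᶠ (1ᶠ -ᶠ y))
        vanish : x ≡ 0ᶠ ⊎ y ≡ 0ᶠ ⊎ 1ᶠ -ᶠ y ≡ 0ᶠ → ∀ {u v} → weight x y * u ≈ weight x y * v
        vanish h = trans (*-congʳ (weight-0 h)) (trans (zeroˡ _) (sym (0-*ˡ (weight-0 h))))
        difference : ((x *ᶠ y) *ᶠ z) -ᶠ ((1ᶠ -ᶠ x) *ᶠ (1ᶠ -ᶠ y)) ≡ lin -ᶠ (1ᶠ -ᶠ y)
        difference = solveᶠ 3 (λ x y z → ((x :*ᶠ y) :*ᶠ z) :+ᶠ :-ᶠ ((:1ᶠ :+ᶠ :-ᶠ x) :*ᶠ (:1ᶠ :+ᶠ :-ᶠ y)) :=ᶠ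
          (x :*ᶠ ((y :*ᶠ z) :+ᶠ (:1ᶠ :+ᶠ :-ᶠ y))) :+ᶠ :-ᶠ (:1ᶠ :+ᶠ :-ᶠ y)) ≡.refl x y z
        from : (x *ᶠ y) *ᶠ z ≡ (1ᶠ -ᶠ x) *ᶠ (1ᶠ -ᶠ y) → lin ≡ 1ᶠ -ᶠ y
        from h = FP.-‿≡0⇒≡ (≡.trans (≡.sym difference) (≡.trans (≡.cong (_-ᶠ ((1ᶠ -ᶠ x) *ᶠ (1ᶠ -ᶠ y))) h) (FP.-‿inverseʳ _)))
        to : lin ≡ 1ᶠ -ᶠ y → (x *ᶠ y) *ᶠ z ≡ (1ᶠ -ᶠ x) *ᶠ (1ᶠ -ᶠ y)
        to h = FP.-‿≡0⇒≡ (≡.trans difference (≡.trans (≡.cong (_-ᶠ (1ᶠ -ᶠ y)) h) (FP.-‿inverseʳ _)))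

      summand : ∀ {χ} → IsChar χ → Q * (Q * ((binom (A · χ) χ * (binom (B · χ) (C · χ) * 1#)) * χ z)) ≈
                C -1ᶠ * sumF (λ y → sumF (λ x → weight x y * (χ ((x *ᶠ y) *ᶠ z) * inv χ ((1ᶠ -ᶠ x) *ᶠ (1ᶠ -ᶠ y)))))
      summand {χ} d = begin
        Q * (Q * ((binom (A · χ) χ * (binom (B · χ) (C · χ) * 1#)) * χ z))  ≈⟨ solve 4 (λ q u v w → q :* (q :* ((u :* (v :* :1)) :* w)) := (q :* v) :* (q :* u) :* w) refl Q _ _ (χ z) ⟩
        (Q * binom (B · χ) (C · χ)) * (Q * binom (A · χ) χ) * χ z  ≈⟨ *-congʳ (*-cong (Q*binom (B · χ) (C · χ)) (Q*binom (A · χ) χ)) ⟩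
        ((C -1ᶠ * χ -1ᶠ) * jB) * (χ -1ᶠ * jA) * χ z  ≈⟨ solve 5 (λ c s j k w → ((c :* s) :* j) :* (s :* k) :* w := c :* ((s :* s) :* (w :* (j :* k)))) refl (C -1ᶠ) (χ -1ᶠ) jB jA (χ z) ⟩
        C -1ᶠ * ((χ -1ᶠ * χ -1ᶠ) * (χ z * (jB * jA)))  ≈⟨ *-congˡ (trans (*-congʳ (χ[-1]² d)) (*-identityˡ _)) ⟩
        C -1ᶠ * (χ z * (jB * jA))  ≈⟨ *-congˡ (trans (*-congˡ (sumF-product _ _)) (trans (sym (sumF-*ˡ _ _)) (sumF-cong (λ y → trans (sym (sumF-*ˡ _ _)) (sumF-cong (λ x → inner x y)))))) ⟩
        C -1ᶠ * sumF (λ y → sumF (λ x → weight x y * (χ ((x *ᶠ y) *ᶠ z) * inv χ ((1ᶠ -ᶠ x) *ᶠ (1ᶠ -ᶠ y))))) ∎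
        where
        jA = jacobi (A · χ) (inv χ)
        jB = jacobi (B · χ) (inv (C · χ))
        inner : ∀ x y → χ z * (((B y * χ y) * inv (C · χ) (1ᶠ -ᶠ y)) * ((A x * χ x) * inv χ (1ᶠ -ᶠ x))) ≈
                weight x y * (χ ((x *ᶠ y) *ᶠ z) * inv χ ((1ᶠ -ᶠ x) *ᶠ (1ᶠ -ᶠ y)))
        inner x y = begin
          χ z * (((B y * χ y) * inv (C · χ) (1ᶠ -ᶠ y)) * ((A x * χ x) * inv χ (1ᶠ -ᶠ x)))  ≈⟨ *-congˡ (*-congʳ (*-congˡ (inv-· C χ _))) ⟩
          χ z * (((B y * χ y) * (inv C (1ᶠ -ᶠ y) * inv χ (1ᶠ -ᶠ y))) * ((A x * χ x) * inv χ (1ᶠ -ᶠ x)))  ≈⟨ solve 8 (λ w b u c d a v e → w :* (((b :* u) :* (c :* d)) :* ((a :* v) :* e)) := (a :* (b :* c)) :* (((v :* u) :* w) :* (e :* d))) refl _ _ _ _ _ _ _ _ ⟩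
          weight x y * (((χ x * χ y) * χ z) * (inv χ (1ᶠ -ᶠ x) * inv χ (1ᶠ -ᶠ y)))  ≈⟨ *-congˡ (*-cong (trans (at* d _ _) (*-congʳ (at* d _ _))) (at* (isChar-inv d) _ _)) ⟨
          weight x y * (χ ((x *ᶠ y) *ᶠ z) * inv χ ((1ᶠ -ᶠ x) *ᶠ (1ᶠ -ᶠ y)))  ∎

      complementary-integrand : 𝔽 → Carrier
      complementary-integrand y = (B y * inv C (1ᶠ -ᶠ y)) * (A (1ᶠ -ᶠ y) * inv A ((y *ᶠ z) +ᶠ (1ᶠ -ᶠ y)))

      -- After the sum over χ, x lies on a line and `sumF-ι-ratio` evaluates the sum of A(x). As A
      -- is nontrivial, this includes the y for which the coefficient y z + 1 - y of x vanishes.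
      hyp-complementary-integral : Q * hyp A (B ∷ []) (C ∷ []) z ≈ C -1ᶠ * sumF complementary-integrand
      hyp-complementary-integral = KP.*-cancelˡ N≉0 (begin
        N * (Q * hyp A (B ∷ []) (C ∷ []) z)  ≈⟨ trans (solve 3 (λ n q h → n :* (q :* h) := q :* (n :* h)) refl N Q _) (*-congˡ (N*hyp A (B ∷ []) (C ∷ []) z)) ⟩
        Q * (Q * ∑ chars _)  ≈⟨ trans (*-congˡ (sym (∑-*ˡ chars Q _))) (sym (∑-*ˡ chars Q _)) ⟩
        ∑ chars (λ χ → Q * (Q * ((binom (A · χ) χ * (binom (B · χ) (C · χ) * 1#)) * χ z)))
                                                                       ≈⟨ ∑-cong-All (All.map summand chars-IsChar) ⟩
        ∑ chars (λ χ → C -1ᶠ * sumF (λ y → sumF (λ x → weight x y * kernel χ x y)))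
                                                                       ≈⟨ trans (∑-*ˡ chars _ _) (*-congˡ (∑-swap chars F.elements _)) ⟩
        C -1ᶠ * sumF (λ y → ∑ chars (λ χ → sumF (λ x → weight x y * kernel χ x y)))
                                                                       ≈⟨ *-congˡ (sumF-cong (λ y → trans (∑-swap chars F.elements _) (sumF-cong (λ x → trans (∑-*ˡ chars _ _) (detect x y))))) ⟩
        C -1ᶠ * sumF (λ y → sumF (λ x → weight x y * (N * ι (line x y))))
                                                                       ≈⟨ *-congˡ (sumF-cong (λ y → trans (sumF-cong (λ x → solve 4 (λ a w n i → (a :* w) :* (n :* i) := (n :* w) :* (i :* a)) refl (A x) (B y * inv C (1ᶠ -ᶠ y)) N _))
                                                                            (trans (sumF-*ˡ _ _) (*-congˡ (sumF-ι-ratio a A≉ε _ _))))) ⟩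
        C -1ᶠ * sumF (λ y → (N * (B y * inv C (1ᶠ -ᶠ y))) * (A (1ᶠ -ᶠ y) * inv A ((y *ᶠ z) +ᶠ (1ᶠ -ᶠ y))))
                                                                       ≈⟨ *-congˡ (trans (sumF-cong (λ y → *-assoc _ _ _)) (sumF-*ˡ N _)) ⟩
        C -1ᶠ * (N * sumF complementary-integrand)  ≈⟨ solve 3 (λ c n s → c :* (n :* s) := n :* (c :* s)) refl _ N _ ⟩
        N * (C -1ᶠ * sumF complementary-integrand)  ∎)
        where
        kernel : Char → 𝔽 → 𝔽 → Carrier
        kernel χ x y = χ ((x *ᶠ y) *ᶠ z) * inv χ ((1ᶠ -ᶠ x) *ᶠ (1ᶠ -ᶠ y))
        line : ∀ x y → Dec (x *ᶠ ((y *ᶠ z) +ᶠ (1ᶠ -ᶠ y)) ≡ 1ᶠ -ᶠ y)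
        line x y = (x *ᶠ ((y *ᶠ z) +ᶠ (1ᶠ -ᶠ y))) ≟ᶠ (1ᶠ -ᶠ y)

      integrand : 𝔽 → Carrier
      integrand y = (B y * (inv B · C) (1ᶠ -ᶠ y)) * inv A (1ᶠ -ᶠ (z *ᶠ y))

      -- The substitution y ↦ y / (y − 1), written as u ↦ 1 / u in the variable u = 1 − y.
      sumF-complementary : sumF complementary-integrand ≈ B -1ᶠ * sumF integrand
      sumF-complementary = begin
        sumF complementary-integrand  ≈⟨ sumF-reflect 1ᶠ _ ⟨
        sumF (λ u → complementary-integrand (1ᶠ -ᶠ u))  ≈⟨ sumF-reciprocal FP.1≢0
            (0-*ʳ (0-*ˡ (trans (reflexive (≡.cong A (1-1- 0ᶠ))) (at0 a))))
            (0-*ʳ (0-*ˡ (0-*ʳ (0-*ˡ (trans (reflexive (≡.cong (inv B) (1-1- 0ᶠ))) (inv-0 B))))))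
            (λ u u≢0 → trans (pointwise u≢0) (reflexive (≡.cong (λ v → B -1ᶠ * integrand (1ᶠ -ᶠ v)) (≡.sym (FP.*-identityˡ _))))) ⟩
        sumF (λ v → B -1ᶠ * integrand (1ᶠ -ᶠ v))  ≈⟨ sumF-reflect 1ᶠ (λ y → B -1ᶠ * integrand y) ⟩
        sumF (λ y → B -1ᶠ * integrand y)  ≈⟨ sumF-*ˡ _ _ ⟩
        B -1ᶠ * sumF integrand  ∎
        where
        1-1- : ∀ u → 1ᶠ -ᶠ (1ᶠ -ᶠ u) ≡ u
        1-1- = solveᶠ 1 (λ u → :1ᶠ :+ᶠ :-ᶠ (:1ᶠ :+ᶠ :-ᶠ u) :=ᶠ u) ≡.refl
        pointwise : ∀ {u} → u ≢ 0ᶠ → complementary-integrand (1ᶠ -ᶠ u) ≈ B -1ᶠ * integrand (1ᶠ -ᶠ u ⁻¹ᶠ)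
        pointwise {u} u≢0 = begin
          (B w * inv C (1ᶠ -ᶠ w)) * (A (1ᶠ -ᶠ w) * inv A ((w *ᶠ z) +ᶠ (1ᶠ -ᶠ w)))
            ≡⟨ ≡.cong (λ v → (B w * inv C v) * (A v * inv A ((w *ᶠ z) +ᶠ v))) (1-1- u) ⟩
          (B w * inv C u) * (A u * inv A m)
            ≈⟨ solve 4 (λ b c a i → (b :* c) :* (a :* i) := (:1 :* :1) :* ((b :* c) :* (a :* i))) refl _ _ _ _ ⟩
          (1# * 1#) * ((B w * inv C u) * (A u * inv A m))
            ≈⟨ *-congʳ (*-cong (χ[-1]² b) (trans (*-comm _ _) (χχ⁻¹ b u≢0))) ⟨
          ((B -1ᶠ * B -1ᶠ) * (B v * B u)) * ((B w * inv C u) * (A u * inv A m))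
            ≈⟨ solve 7 (λ s x y b c a i → ((s :* s) :* (x :* y)) :* ((b :* c) :* (a :* i)) := s :* (((s :* (b :* x)) :* (y :* c)) :* (a :* i))) refl (B -1ᶠ) (B v) (B u) (B w) (inv C u) (A u) (inv A m) ⟩
          B -1ᶠ * (((B -1ᶠ * (B w * B v)) * (B u * inv C u)) * (A u * inv A m))
            ≈⟨ *-congˡ (*-cong (*-cong (trans (reflexive (≡.cong B 1-v)) (trans (at-neg b _) (*-congˡ (at* b _ _))))
                 (*-cong (trans (reflexive (≡.cong (inv B) (1-1- v))) (inv-at-⁻¹ B u≢0)) (trans (reflexive (≡.cong C (1-1- v))) (sym (inv-≢0 C u≢0)))))
                 (trans (reflexive (≡.cong (inv A) last)) (trans (at* (isChar-inv a) _ _) (*-congʳ (inv-at-⁻¹ A u≢0))))) ⟨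
          B -1ᶠ * integrand (1ᶠ -ᶠ v) ∎
          where
          v = u ⁻¹ᶠ
          w = 1ᶠ -ᶠ u
          m = (w *ᶠ z) +ᶠ u
          1-v : 1ᶠ -ᶠ v ≡ -ᶠ (w *ᶠ v)
          1-v = ≡.trans (≡.cong (_-ᶠ v) (≡.sym (F.inverseʳ u u≢0))) (solveᶠ 2 (λ u v → u :*ᶠ v :+ᶠ :-ᶠ v :=ᶠ :-ᶠ ((:1ᶠ :+ᶠ :-ᶠ u) :*ᶠ v)) ≡.refl u v)
          last : 1ᶠ -ᶠ (z *ᶠ (1ᶠ -ᶠ v)) ≡ v *ᶠ m
          last = ≡.trans (≡.cong₂ (λ o y → o -ᶠ (z *ᶠ y)) (≡.sym (F.inverseʳ u u≢0)) 1-v)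
            (solveᶠ 3 (λ u v z → u :*ᶠ v :+ᶠ :-ᶠ (z :*ᶠ (:-ᶠ ((:1ᶠ :+ᶠ :-ᶠ u) :*ᶠ v))) :=ᶠ v :*ᶠ (((:1ᶠ :+ᶠ :-ᶠ u) :*ᶠ z) :+ᶠ u)) ≡.refl u v z)

      hyp-integral : Q * hyp A (B ∷ []) (C ∷ []) z ≈ (B -1ᶠ * C -1ᶠ) * sumF integrand
      hyp-integral = trans hyp-complementary-integral (trans (*-congˡ sumF-complementary) (solve 3 (λ c b s → c :* (b :* s) := (b :* c) :* s) refl _ _ _))

-- The product of two Euler integrals as a sum over pairs of lines

module IncidenceSums
  (F : FiniteField) (K : CharZeroField) (p r : ℕ) (ζ : CharZeroField.Carrier K)
  (chars : List (FiniteField.Carrier F → CharZeroField.Carrier K)) where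
  open CharacterSums F K p r ζ chars
  open JacobiSums F K p r ζ chars

  sumF-swap₂₂ : ∀ (f : 𝔽 → 𝔽 → 𝔽 → 𝔽 → Carrier) →
    sumF (λ y → sumF (λ t → sumF (λ α → sumF (λ β → f y t α β)))) ≈
    sumF (λ α → sumF (λ β → sumF (λ y → sumF (λ t → f y t α β))))
  sumF-swap₂₂ f = begin
    sumF (λ y → sumF (λ t → sumF (λ α → sumF (λ β → f y t α β))))  ≈⟨ sumF-cong (λ y → sumF-swap _) ⟩
    sumF (λ y → sumF (λ α → sumF (λ t → sumF (λ β → f y t α β))))  ≈⟨ sumF-swap _ ⟩
    sumF (λ α → sumF (λ y → sumF (λ t → sumF (λ β → f y t α β))))  ≈⟨ sumF-cong (λ α → trans (sumF-cong (λ y → sumF-swap _)) (sumF-swap _)) ⟩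
    sumF (λ α → sumF (λ β → sumF (λ y → sumF (λ t → f y t α β))))  ∎

  module Incidence {a b e : Char} (ca : IsChar a) (cb : IsChar b) (ce : IsChar e)
           (a≉ε : ¬ (a ≗ᶜ ε)) (b≉ε : ¬ (b ≗ᶜ ε)) (e≉ε : ¬ (e ≗ᶜ ε)) (ab̄ē≉ε : ¬ ((a · (inv b · inv e)) ≗ᶜ ε))
           (a[-1] : a -1ᶠ ≈ 1#) (b[-1] : b -1ᶠ ≈ 1#) (e[-1] : e -1ᶠ ≈ 1#)
           {z : 𝔽} (z≢0 : z ≢ 0ᶠ) (z≢1 : z ≢ 1ᶠ) where

    ē = inv e
    cē = isChar-inv ce

    -- Cramer's numerators: where αβ ≠ z², the equations of `line₁` and `line₂` have the solution y
    -- = num / (αβ - z²), t = den / (αβ - z²).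
    num den : 𝔽 → 𝔽 → 𝔽
    num α β = ((α *ᶠ β) -ᶠ α) +ᶠ ((z *ᶠ α) -ᶠ z)
    den α β = ((α *ᶠ β) -ᶠ β) +ᶠ ((z *ᶠ β) -ᶠ z)

    line₁ : ∀ α y t → Dec (α *ᶠ (1ᶠ -ᶠ t) ≡ 1ᶠ -ᶠ (z *ᶠ y))
    line₁ α y t = (α *ᶠ (1ᶠ -ᶠ t)) ≟ᶠ (1ᶠ -ᶠ (z *ᶠ y))

    line₂ : ∀ β y t → Dec (β *ᶠ (1ᶠ -ᶠ y) ≡ 1ᶠ -ᶠ (z *ᶠ t))
    line₂ β y t = (β *ᶠ (1ᶠ -ᶠ y)) ≟ᶠ (1ᶠ -ᶠ (z *ᶠ t))

    incidence : 𝔽 → 𝔽 → Carrier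
    incidence α β = sumF (λ y → sumF (λ t → (ι (line₁ α y t) * ι (line₂ β y t)) * (e y * ē t)))

    product-integral : Carrier
    product-integral = sumF (λ y → sumF (λ t → (e y * ē t) * ((a (1ᶠ -ᶠ t) * inv a (1ᶠ -ᶠ (z *ᶠ y))) * (b (1ᶠ -ᶠ y) * inv b (1ᶠ -ᶠ (z *ᶠ t))))))

    -- The ratios enter through indicators, which also covers zero numerators and denominators:
    -- where both vanish, α or β is unconstrained and the sum of the nontrivial character over it is
    -- 0, just as the original factor.
    product-incidence : product-integral ≈ sumF (λ α → sumF (λ β → (inv a α * inv b β) * incidence α β))
    product-incidence = begin
      product-integral
        ≈⟨ sumF-cong (λ y → sumF-cong (λ t → *-congˡ (trans (*-cong (line-sum ca a≉ε _ _) (line-sum cb b≉ε _ _)) (sumF-product _ _)))) ⟩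
      sumF (λ y → sumF (λ t → (e y * ē t) * sumF (λ α → sumF (λ β → (ι (line₁ α y t) * inv a α) * (ι (line₂ β y t) * inv b β)))))
        ≈⟨ sumF-cong (λ y → sumF-cong (λ t → trans (sym (sumF-*ˡ _ _)) (sumF-cong (λ α → trans (sym (sumF-*ˡ _ _)) (sumF-cong (λ β →
             solve 5 (λ w i a j b → w :* ((i :* a) :* (j :* b)) := (a :* b) :* ((i :* j) :* w)) refl _ _ _ _ _)))))) ⟩
      sumF (λ y → sumF (λ t → sumF (λ α → sumF (λ β → (inv a α * inv b β) * ((ι (line₁ α y t) * ι (line₂ β y t)) * (e y * ē t))))))
        ≈⟨ sumF-swap₂₂ _ ⟩
      sumF (λ α → sumF (λ β → sumF (λ y → sumF (λ t → (inv a α * inv b β) * ((ι (line₁ α y t) * ι (line₂ β y t)) * (e y * ē t))))))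
        ≈⟨ sumF-cong (λ α → sumF-cong (λ β → trans (sumF-cong (λ y → sumF-*ˡ _ _)) (sumF-*ˡ _ _))) ⟩
      sumF (λ α → sumF (λ β → (inv a α * inv b β) * incidence α β)) ∎
      where
      line-sum : ∀ {χ} → IsChar χ → ¬ (χ ≗ᶜ ε) → ∀ m n → χ m * inv χ n ≈ sumF (λ α → ι ((α *ᶠ m) ≟ᶠ n) * inv χ α)
      line-sum {χ} c χ≉ε m n = sym (trans (sumF-ι-ratio (isChar-inv c) (inv-≉ε c χ≉ε) m n) (trans (*-comm _ _) (*-congʳ (inv-inv c m))))

    self-cancel : ∀ {x y : 𝔽} → x ≡ y → x -ᶠ y ≡ 0ᶠ
    self-cancel ≡.refl = FP.-‿inverseʳ _

    module _ {α β : 𝔽} (β≢0 : β ≢ 0ᶠ) where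
      y₀ : 𝔽 → 𝔽
      y₀ t = ((β -ᶠ 1ᶠ) +ᶠ (z *ᶠ t)) *ᶠ β ⁻¹ᶠ

      y₀-β : ∀ t → y₀ t *ᶠ β ≡ (β -ᶠ 1ᶠ) +ᶠ (z *ᶠ t)
      y₀-β t = FP.*⁻¹-solves _ β≢0

      determinant = (α *ᶠ β) -ᶠ (z *ᶠ z)

      incidence-eliminate : incidence α β ≈ sumF (λ t → ι ((t *ᶠ determinant) ≟ᶠ den α β) * (e (y₀ t) * ē t))
      incidence-eliminate = trans (sumF-swap _) (sumF-cong (λ t → begin
        sumF (λ y → (ι (line₁ α y t) * ι (line₂ β y t)) * (e y * ē t))
          ≈⟨ sumF-cong (λ y → trans (*-congʳ (trans (*-comm _ _) (*-congʳ (second y t)))) (*-assoc _ _ _)) ⟩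
        sumF (λ y → ι ((y *ᶠ β) ≟ᶠ ((β -ᶠ 1ᶠ) +ᶠ (z *ᶠ t))) * (ι (line₁ α y t) * (e y * ē t)))
          ≈⟨ sumF-ι-linear _ β≢0 _ ⟩
        ι (line₁ α (y₀ t) t) * (e (y₀ t) * ē t)
          ≈⟨ *-congʳ (first t) ⟩
        ι ((t *ᶠ determinant) ≟ᶠ den α β) * (e (y₀ t) * ē t) ∎))
        where
        second : ∀ y t → ι (line₂ β y t) ≈ ι ((y *ᶠ β) ≟ᶠ ((β -ᶠ 1ᶠ) +ᶠ (z *ᶠ t)))
        second y t = ι-cong (line₂ β y t) ((y *ᶠ β) ≟ᶠ ((β -ᶠ 1ᶠ) +ᶠ (z *ᶠ t)))
          (λ h → FP.-‿≡0⇒≡ (≡.trans (≡.sym difference) (self-cancel (≡.sym h))))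
          (λ h → ≡.sym (FP.-‿≡0⇒≡ (≡.trans difference (self-cancel h))))
          where
          difference : (1ᶠ -ᶠ (z *ᶠ t)) -ᶠ (β *ᶠ (1ᶠ -ᶠ y)) ≡ (y *ᶠ β) -ᶠ ((β -ᶠ 1ᶠ) +ᶠ (z *ᶠ t))
          difference = solveᶠ 4 (λ z t β y → (:1ᶠ :+ᶠ :-ᶠ (z :*ᶠ t)) :+ᶠ :-ᶠ (β :*ᶠ (:1ᶠ :+ᶠ :-ᶠ y)) :=ᶠ
            (y :*ᶠ β) :+ᶠ :-ᶠ ((β :+ᶠ :-ᶠ :1ᶠ) :+ᶠ (z :*ᶠ t))) ≡.refl z t β y
        first : ∀ t → ι (line₁ α (y₀ t) t) ≈ ι ((t *ᶠ determinant) ≟ᶠ den α β)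
        first t = ι-cong (line₁ α (y₀ t) t) ((t *ᶠ determinant) ≟ᶠ den α β)
          (λ h → ≡.sym (FP.-‿≡0⇒≡ (≡.trans (≡.sym difference) (≡.trans (≡.cong (β *ᶠ_) (self-cancel h)) (FP.zeroʳ β)))))
          (λ h → FP.-‿≡0⇒≡ (FP.*-cancelˡ β≢0 (≡.trans difference (≡.trans (self-cancel (≡.sym h)) (≡.sym (FP.zeroʳ β))))))
          where
          difference : β *ᶠ ((α *ᶠ (1ᶠ -ᶠ t)) -ᶠ (1ᶠ -ᶠ (z *ᶠ y₀ t))) ≡ den α β -ᶠ (t *ᶠ determinant)
          difference = ≡.trans (solveᶠ 5 (λ z t α β y → β :*ᶠ ((α :*ᶠ (:1ᶠ :+ᶠ :-ᶠ t)) :+ᶠ :-ᶠ (:1ᶠ :+ᶠ :-ᶠ (z :*ᶠ y))) :=ᶠ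
              (((β :*ᶠ α) :*ᶠ (:1ᶠ :+ᶠ :-ᶠ t)) :+ᶠ :-ᶠ β) :+ᶠ z :*ᶠ (y :*ᶠ β)) ≡.refl z t α β (y₀ t))
            (≡.trans (≡.cong (λ w → ((((β *ᶠ α) *ᶠ (1ᶠ -ᶠ t)) -ᶠ β) +ᶠ (z *ᶠ w))) (y₀-β t))
              (solveᶠ 4 (λ z t α β → (((β :*ᶠ α) :*ᶠ (:1ᶠ :+ᶠ :-ᶠ t)) :+ᶠ :-ᶠ β) :+ᶠ z :*ᶠ ((β :+ᶠ :-ᶠ :1ᶠ) :+ᶠ (z :*ᶠ t)) :=ᶠ
                (((α :*ᶠ β) :+ᶠ :-ᶠ β) :+ᶠ ((z :*ᶠ β) :+ᶠ :-ᶠ z)) :+ᶠ :-ᶠ (t :*ᶠ ((α :*ᶠ β) :+ᶠ :-ᶠ (z :*ᶠ z)))) ≡.refl z t α β))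

      -- The common denominator αβ - z² of y and t cancels between e and ē.
      incidence-regular : determinant ≢ 0ᶠ → incidence α β ≈ e (num α β) * ē (den α β)
      incidence-regular D≢0 = trans incidence-eliminate (trans (sumF-ι-linear _ D≢0 _) (begin
        e (y₀ t₀) * ē t₀  ≈⟨ *-cong (trans (reflexive (≡.cong e y₀-t₀)) (at* ce _ _)) (at* cē _ _) ⟩
        (e n * e D⁻¹) * (ē d * ē D⁻¹)  ≈⟨ solve 4 (λ n i d j → (n :* i) :* (d :* j) := (n :* d) :* (i :* j)) refl _ _ _ _ ⟩
        (e n * ē d) * (e D⁻¹ * ē D⁻¹)  ≈⟨ trans (*-congˡ (χ·inv ce (FP.⁻¹-≢0 D≢0))) (*-identityʳ _) ⟩
        e n * ē d  ∎))
        where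
        n = num α β
        d = den α β
        D⁻¹ = determinant ⁻¹ᶠ
        t₀ = d *ᶠ D⁻¹
        y₀-t₀ : y₀ t₀ ≡ n *ᶠ D⁻¹
        y₀-t₀ = FP.*⁻¹-unique D≢0 (FP.*-cancelˡ β≢0
          (≡.trans (solveᶠ 3 (λ β y D → β :*ᶠ (y :*ᶠ D) :=ᶠ D :*ᶠ (y :*ᶠ β)) ≡.refl β (y₀ t₀) determinant)
          (≡.trans (≡.cong (determinant *ᶠ_) (y₀-β t₀))
          (≡.trans (solveᶠ 4 (λ D β z t → D :*ᶠ ((β :+ᶠ :-ᶠ :1ᶠ) :+ᶠ (z :*ᶠ t)) :=ᶠ D :*ᶠ (β :+ᶠ :-ᶠ :1ᶠ) :+ᶠ z :*ᶠ (t :*ᶠ D)) ≡.refl determinant β z t₀)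
          (≡.trans (≡.cong (λ w → (determinant *ᶠ (β -ᶠ 1ᶠ)) +ᶠ (z *ᶠ w)) (FP.*⁻¹-solves d D≢0))
            (solveᶠ 3 (λ z α β → ((α :*ᶠ β) :+ᶠ :-ᶠ (z :*ᶠ z)) :*ᶠ (β :+ᶠ :-ᶠ :1ᶠ) :+ᶠ z :*ᶠ (((α :*ᶠ β) :+ᶠ :-ᶠ β) :+ᶠ ((z :*ᶠ β) :+ᶠ :-ᶠ z)) :=ᶠ
              β :*ᶠ (((α :*ᶠ β) :+ᶠ :-ᶠ α) :+ᶠ ((z :*ᶠ α) :+ᶠ :-ᶠ z))) ≡.refl z α β))))))

    1-z≢0 : 1ᶠ -ᶠ z ≢ 0ᶠ
    1-z≢0 = FP.≢⇒-‿≢0 (λ h → z≢1 (≡.sym h))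

    z=-1 : Dec (z ≡ -1ᶠ)
    z=-1 = z ≟ᶠ -1ᶠ

    e-neg : ∀ x → e (-ᶠ x) ≈ e x
    e-neg x = trans (at-neg ce x) (trans (*-congʳ e[-1]) (*-identityˡ _))

    ē-neg : ∀ x → ē (-ᶠ x) ≈ ē x
    ē-neg x = trans (at-neg cē x) (trans (*-congʳ (trans (inv[-1] {e}) e[-1])) (*-identityˡ _))

    -- The error of the value e(num) ē(den) on αβ = z². Away from β = -z there is no solution,
    -- whereas that value is e(z) ē(β), which has to be subtracted. At β = -z the value is 0, but
    -- the true sum over the common line is -1, or q - 1 when z = -1.
    excess : 𝔽 → Carrier
    excess β = - (e z * ē β) + ι (β ≟ᶠ (-ᶠ z)) * (Q * ι z=-1)

    -- On the curve α β = z² the two lines are parallel, or equal when α = β = −z.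
    incidence-singular : ∀ {α β} → β ≢ 0ᶠ → α *ᶠ β ≡ z *ᶠ z → incidence α β ≈ e (num α β) * ē (den α β) + excess β
    incidence-singular {α} {β} β≢0 αβ=zz = trans (incidence-eliminate β≢0) (cases (β ≟ᶠ (-ᶠ z)) coincident parallel)
      where
      D≡0 : (α *ᶠ β) -ᶠ (z *ᶠ z) ≡ 0ᶠ
      D≡0 = self-cancel αβ=zz
      den-factored : den α β ≡ -ᶠ ((1ᶠ -ᶠ z) *ᶠ (β +ᶠ z))
      den-factored = ≡.trans (≡.cong (λ w → (w -ᶠ β) +ᶠ ((z *ᶠ β) -ᶠ z)) αβ=zz)
        (solveᶠ 2 (λ z β → ((z :*ᶠ z) :+ᶠ :-ᶠ β) :+ᶠ ((z :*ᶠ β) :+ᶠ :-ᶠ z) :=ᶠ :-ᶠ ((:1ᶠ :+ᶠ :-ᶠ z) :*ᶠ (β :+ᶠ z))) ≡.refl z β)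
      num-factored : β *ᶠ num α β ≡ -ᶠ ((1ᶠ -ᶠ z) *ᶠ (z *ᶠ (β +ᶠ z)))
      num-factored = ≡.trans (solveᶠ 4 (λ z α β w → β :*ᶠ (((α :*ᶠ β) :+ᶠ :-ᶠ α) :+ᶠ ((z :*ᶠ α) :+ᶠ :-ᶠ z)) :=ᶠ
            ((α :*ᶠ β) :*ᶠ ((β :+ᶠ z) :+ᶠ :-ᶠ :1ᶠ)) :+ᶠ :-ᶠ (z :*ᶠ β)) ≡.refl z α β z)
        (≡.trans (≡.cong (λ w → (w *ᶠ ((β +ᶠ z) -ᶠ 1ᶠ)) -ᶠ (z *ᶠ β)) αβ=zz)
          (solveᶠ 2 (λ z β → ((z :*ᶠ z) :*ᶠ ((β :+ᶠ z) :+ᶠ :-ᶠ :1ᶠ)) :+ᶠ :-ᶠ (z :*ᶠ β) :=ᶠ :-ᶠ ((:1ᶠ :+ᶠ :-ᶠ z) :*ᶠ (z :*ᶠ (β :+ᶠ z)))) ≡.refl z β))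

      parallel : β ≢ -ᶠ z → sumF (λ t → ι ((t *ᶠ determinant β≢0) ≟ᶠ den α β) * (e (y₀ {α} β≢0 t) * ē t)) ≈ e (num α β) * ē (den α β) + excess β
      parallel β≢-z = trans (sumF-zero (λ t → ι-no-* ((t *ᶠ determinant β≢0) ≟ᶠ den α β)
            (λ h → den≢0 (≡.trans (≡.sym h) (≡.trans (≡.cong (t *ᶠ_) D≡0) (FP.zeroʳ t))))))
          (sym (trans (+-cong ratio (trans (+-congˡ (ι-no-* (β ≟ᶠ (-ᶠ z)) β≢-z)) (+-identityʳ _))) (-‿inverseʳ _)))
        where
        β+z≢0 : β +ᶠ z ≢ 0ᶠ
        β+z≢0 h = β≢-z (FP.-‿≡0⇒≡ (≡.trans (solveᶠ 2 (λ z β → β :+ᶠ :-ᶠ (:-ᶠ z) :=ᶠ β :+ᶠ z) ≡.refl z β) h))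
        unit : 𝔽
        unit = (1ᶠ -ᶠ z) *ᶠ (β +ᶠ z)
        unit≢0 : unit ≢ 0ᶠ
        unit≢0 = FP.*-≢0 1-z≢0 β+z≢0
        den≢0 : den α β ≢ 0ᶠ
        den≢0 h = FP.-‿≢0 unit≢0 (≡.trans (≡.sym den-factored) h)
        ratio : e (num α β) * ē (den α β) ≈ e z * ē β
        ratio = begin
          e (num α β) * ē (den α β)  ≈⟨ trans (*-congʳ (χ·inv ce β≢0)) (*-identityˡ _) ⟨
          (e β * ē β) * (e (num α β) * ē (den α β))  ≈⟨ solve 4 (λ b c n d → (b :* c) :* (n :* d) := (c :* (b :* n)) :* d) refl _ _ _ _ ⟩
          (ē β * (e β * e (num α β))) * ē (den α β)  ≈⟨ *-cong (*-congˡ (trans (sym (at* ce _ _)) (trans (reflexive (≡.cong e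
                                                                    (≡.trans num-factored (solveᶠ 3 (λ o z s → :-ᶠ (o :*ᶠ (z :*ᶠ s)) :=ᶠ :-ᶠ (z :*ᶠ (o :*ᶠ s))) ≡.refl (1ᶠ -ᶠ z) z (β +ᶠ z)))))
                                                                    (trans (e-neg _) (at* ce z unit))))) (trans (reflexive (≡.cong ē den-factored)) (ē-neg unit)) ⟩
          (ē β * (e z * e unit)) * ē unit  ≈⟨ solve 4 (λ c z u v → (c :* (z :* u)) :* v := (z :* c) :* (u :* v)) refl _ _ _ _ ⟩
          (e z * ē β) * (e unit * ē unit)  ≈⟨ trans (*-congˡ (χ·inv ce unit≢0)) (*-identityʳ _) ⟩
          e z * ē β  ∎

      coincident : β ≡ -ᶠ z → sumF (λ t → ι ((t *ᶠ determinant β≢0) ≟ᶠ den α β) * (e (y₀ {α} β≢0 t) * ē t)) ≈ e (num α β) * ē (den α β) + excess β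
      coincident β≡-z = begin
        sumF (λ t → ι ((t *ᶠ determinant β≢0) ≟ᶠ den α β) * (e (y₀ {α} β≢0 t) * ē t))
          ≈⟨ sumF-cong (λ t → trans (ι-yes-* ((t *ᶠ determinant β≢0) ≟ᶠ den α β) (≡.trans (≡.cong (t *ᶠ_) D≡0) (≡.trans (FP.zeroʳ t) (≡.sym den≡0))))
               (trans (*-comm _ _) (*-congˡ (reflexive (≡.cong e (reflected t)))))) ⟩
        -- For α = β = -z both equations say y + t = σ = (z + 1) / z. This line passes through the
        -- origin exactly when z = -1, and then e(y) ē(t) is constant on it apart from the origin.
        sumF (λ t → ē t * e (σ -ᶠ t))
          ≈⟨ convolution cē ce σ ⟩
        (ē · e) σ * jacobi ē e + ι (σ ≟ᶠ 0ᶠ) * (e -1ᶠ * sumF (ē · e))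
          ≈⟨ +-cong (*-cong (ēe σ) (trans (jacobi-cong {ē} {ē} (λ _ → refl) (λ x → sym (inv-inv ce x)))
               (trans (jacobi-inv cē (inv-≉ε ce e≉ε)) (-‿cong (trans (inv[-1] {e}) e[-1])))))
               (*-cong (ι-cong (σ ≟ᶠ 0ᶠ) z=-1 σ≡0⇒ ⇒σ≡0) (trans (*-cong e[-1] (trans (sumF-cong ēe) sumF-ε)) (*-identityˡ N))) ⟩
        ε σ * - 1# + ι z=-1 * N
          ≈⟨ cases z=-1
               (λ h → trans (+-cong (0-*ˡ (trans (reflexive (≡.cong ε (⇒σ≡0 h))) ε-0)) (ι-yes-* z=-1 h))
                  (sym (trans (+-congˡ (trans (*-congˡ (ι-yes z=-1 h)) (*-identityʳ Q))) (trans (+-congˡ Q≈1+N) (solve 1 (λ n → :- :1 :+ (:1 :+ n) := :0 :+ n) refl N)))))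
               (λ n → trans (+-cong (trans (*-congʳ (ε-≢0 (λ h → n (σ≡0⇒ h)))) (*-identityˡ _)) (ι-no-* z=-1 n))
                  (sym (+-congˡ (trans (*-congˡ (ι-no z=-1 n)) (zeroʳ Q))))) ⟩
        - 1# + Q * ι z=-1
          ≈⟨ +-cong (-‿cong (trans (*-congˡ (trans (reflexive (≡.cong ē β≡-z)) (ē-neg z))) (χ·inv ce z≢0))) (ι-yes-* (β ≟ᶠ (-ᶠ z)) β≡-z) ⟨
        excess β
          ≈⟨ +-identityˡ _ ⟨
        0# + excess β
          ≈⟨ +-congʳ (0-*ʳ (trans (reflexive (≡.cong ē den≡0)) (at0 cē))) ⟨
        e (num α β) * ē (den α β) + excess β ∎
        where
        ēe : ∀ x → ē x * e x ≈ ε x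
        ēe x = trans (*-comm _ _) (χ·inv-ε ce x)
        σ : 𝔽
        σ = (z +ᶠ 1ᶠ) *ᶠ z ⁻¹ᶠ
        den≡0 : den α β ≡ 0ᶠ
        den≡0 = ≡.trans den-factored (≡.trans (≡.cong (λ w → -ᶠ ((1ᶠ -ᶠ z) *ᶠ (w +ᶠ z))) β≡-z)
          (solveᶠ 1 (λ z → :-ᶠ ((:1ᶠ :+ᶠ :-ᶠ z) :*ᶠ (:-ᶠ z :+ᶠ z)) :=ᶠ :0ᶠ) ≡.refl z))
        reflected : ∀ t → y₀ {α} β≢0 t ≡ σ -ᶠ t
        reflected t = ≡.sym (FP.*⁻¹-unique β≢0 (≡.trans (≡.cong ((σ -ᶠ t) *ᶠ_) β≡-z)
          (≡.trans (solveᶠ 3 (λ s t z → (s :+ᶠ :-ᶠ t) :*ᶠ :-ᶠ z :=ᶠ :-ᶠ (s :*ᶠ z) :+ᶠ z :*ᶠ t) ≡.refl σ t z)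
          (≡.trans (≡.cong (λ w → -ᶠ w +ᶠ (z *ᶠ t)) (FP.*⁻¹-solves (z +ᶠ 1ᶠ) z≢0))
          (≡.trans (solveᶠ 2 (λ z t → :-ᶠ (z :+ᶠ :1ᶠ) :+ᶠ z :*ᶠ t :=ᶠ (:-ᶠ z :+ᶠ :-ᶠ :1ᶠ) :+ᶠ z :*ᶠ t) ≡.refl z t)
            (≡.cong (λ w → (w -ᶠ 1ᶠ) +ᶠ (z *ᶠ t)) (≡.sym β≡-z)))))))
        σ≡0⇒ : σ ≡ 0ᶠ → z ≡ -1ᶠ
        σ≡0⇒ h = FP.-‿≡0⇒≡ (≡.trans (solveᶠ 1 (λ z → z :+ᶠ :-ᶠ (:-ᶠ :1ᶠ) :=ᶠ z :+ᶠ :1ᶠ) ≡.refl z)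
          (≡.trans (≡.sym (FP.*⁻¹-solves (z +ᶠ 1ᶠ) z≢0)) (≡.trans (≡.cong (_*ᶠ z) h) (FP.zeroˡ z))))
        ⇒σ≡0 : z ≡ -1ᶠ → σ ≡ 0ᶠ
        ⇒σ≡0 h = ≡.trans (≡.cong (_*ᶠ z ⁻¹ᶠ) (≡.trans (≡.cong (_+ᶠ 1ᶠ) h) (FP.-‿inverseˡ 1ᶠ))) (FP.zeroˡ _)

    incidence-value : ∀ {α β} → β ≢ 0ᶠ → incidence α β ≈ e (num α β) * ē (den α β) + ι (α ≟ᶠ ((z *ᶠ z) *ᶠ β ⁻¹ᶠ)) * excess β
    incidence-value {α} {β} β≢0 = cases (α ≟ᶠ ((z *ᶠ z) *ᶠ β ⁻¹ᶠ))
      (λ h → trans (incidence-singular β≢0 (≡.trans (≡.cong (_*ᶠ β) h) (FP.*⁻¹-solves _ β≢0))) (+-congˡ (sym (ι-yes-* (α ≟ᶠ ((z *ᶠ z) *ᶠ β ⁻¹ᶠ)) h))))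
      (λ n → trans (incidence-regular β≢0 (λ h → n (FP.*⁻¹-unique β≢0 (FP.-‿≡0⇒≡ h))))
        (sym (trans (+-congˡ (ι-no-* (α ≟ᶠ ((z *ᶠ z) *ᶠ β ⁻¹ᶠ)) n)) (+-identityʳ _))))

    collapsed : Carrier
    collapsed = sumF (λ α → sumF (λ β → (inv a α * inv b β) * (e (num α β) * ē (den α β))))

    -- On the curve the part -e(z) ē(β) sums a multiple of a b̄ ē, which is nontrivial. The other
    -- part lives at β = -z, and for z = -1 all its character values are taken at 1.
    excess-total : sumF (λ β → (inv a ((z *ᶠ z) *ᶠ β ⁻¹ᶠ) * inv b β) * excess β) ≈ Q * ι z=-1
    excess-total = begin
      sumF (λ β → (inv a ((z *ᶠ z) *ᶠ β ⁻¹ᶠ) * inv b β) * excess β)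
        ≈⟨ sumF-cong (λ β → cases (β ≟ᶠ 0ᶠ)
             (λ { ≡.refl → trans zero-b (sym (0-*ʳ (0-*ˡ (0-*ˡ (at0 ca))))) })
             (λ β≢0 → trans (*-congʳ (*-congʳ (trans (at* cā _ _) (*-congˡ (inv-at-⁻¹ a β≢0))))) (solve 4 (λ z a b x → ((z :* a) :* b) :* x := z :* ((a :* b) :* x)) refl _ _ _ _))) ⟩
      sumF (λ β → inv a (z *ᶠ z) * ((a β * inv b β) * excess β))
        ≈⟨ trans (sumF-*ˡ _ _) (*-congˡ (sumF-cong (λ β → solve 6 (λ a b e f i q → (a :* b) :* (:- (e :* f) :+ i :* q) := (:- e) :* (a :* (b :* f)) :+ i :* ((a :* b) :* q)) refl _ _ _ _ _ _))) ⟩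
      inv a (z *ᶠ z) * sumF (λ β → (- e z) * (a · (inv b · ē)) β + ι (β ≟ᶠ (-ᶠ z)) * ((a β * inv b β) * (Q * ι z=-1)))
        ≈⟨ *-congˡ (trans (sumF-+ _ _) (+-cong (trans (sumF-*ˡ _ _) (0-*ʳ (sumF-nontrivial (isChar-· ca (isChar-· (isChar-inv cb) cē)) ab̄ē≉ε))) (sumF-ι (-ᶠ z) _))) ⟩
      inv a (z *ᶠ z) * (0# + (a (-ᶠ z) * inv b (-ᶠ z)) * (Q * ι z=-1))
        ≈⟨ solve 4 (λ i w q j → i :* (:0 :+ w :* (q :* j)) := j :* (q :* (i :* w))) refl _ _ Q (ι z=-1) ⟩
      ι z=-1 * (Q * (inv a (z *ᶠ z) * (a (-ᶠ z) * inv b (-ᶠ z))))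
        ≈⟨ ι-* z=-1 (λ h → trans (*-congˡ (trans (*-cong (unit-value cā (≡.trans (≡.cong (λ w → w *ᶠ w) h) -1ᶠ²≡1)) (*-cong (unit-value ca (-z≡1 h)) (unit-value (isChar-inv cb) (-z≡1 h))))
             (trans (*-identityˡ _) (*-identityˡ _)))) (*-identityʳ Q)) ⟩
      ι z=-1 * Q
        ≈⟨ *-comm _ _ ⟩
      Q * ι z=-1 ∎
      where
      cā = isChar-inv ca
      zero-b : ∀ {x y} → (x * inv b 0ᶠ) * y ≈ 0#
      zero-b = 0-*ˡ (0-*ʳ (inv-0 b))
      unit-value : ∀ {χ x} → IsChar χ → x ≡ 1ᶠ → χ x ≈ 1#
      unit-value c ≡.refl = at1 c
      -z≡1 : z ≡ -1ᶠ → -ᶠ z ≡ 1ᶠ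
      -z≡1 h = ≡.trans (≡.cong -ᶠ_ h) (solveᶠ 0 (:-ᶠ (:-ᶠ :1ᶠ) :=ᶠ :1ᶠ) ≡.refl)

    product-collapsed : product-integral ≈ collapsed + Q * ι z=-1
    product-collapsed = begin
      product-integral  ≈⟨ product-incidence ⟩
      sumF (λ α → sumF (λ β → (inv a α * inv b β) * incidence α β))
        ≈⟨ sumF-cong (λ α → trans (sumF-cong (λ β → split α β)) (sumF-+ _ _)) ⟩
      sumF (λ α → sumF (λ β → (inv a α * inv b β) * (e (num α β) * ē (den α β))) + sumF (λ β → singular α β))
        ≈⟨ sumF-+ _ _ ⟩
      collapsed + sumF (λ α → sumF (λ β → singular α β))  ≈⟨ +-congˡ (trans (sumF-swap _) (sumF-cong (λ β → sumF-ι _ (λ α → (inv a α * inv b β) * excess β)))) ⟩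
      collapsed + sumF (λ β → (inv a ((z *ᶠ z) *ᶠ β ⁻¹ᶠ) * inv b β) * excess β)
                                                             ≈⟨ +-congˡ excess-total ⟩
      collapsed + Q * ι z=-1  ∎
      where
      singular : 𝔽 → 𝔽 → Carrier
      singular α β = ι (α ≟ᶠ ((z *ᶠ z) *ᶠ β ⁻¹ᶠ)) * ((inv a α * inv b β) * excess β)
      zero-b : ∀ {x y} → (x * inv b 0ᶠ) * y ≈ 0#
      zero-b = 0-*ˡ (0-*ʳ (inv-0 b))
      split : ∀ α β → (inv a α * inv b β) * incidence α β ≈ (inv a α * inv b β) * (e (num α β) * ē (den α β)) + singular α β
      split α β = cases (β ≟ᶠ 0ᶠ)
        (λ { ≡.refl → trans zero-b (sym (trans (+-cong zero-b (0-*ʳ zero-b)) (+-identityˡ _))) })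
        (λ β≢0 → trans (*-congˡ (incidence-value β≢0)) (solve 4 (λ w x i k → w :* (x :+ i :* k) := w :* x :+ i :* (w :* k)) refl _ _ _ _))

-- Kloosterman form and multiplicative Fourier expansion

module MellinExpansion
  (F : FiniteField) (K : CharZeroField) (p r : ℕ) (ζ : CharZeroField.Carrier K)
  (chars : List (FiniteField.Carrier F → CharZeroField.Carrier K)) where
  open CharacterSums F K p r ζ chars
  open JacobiSums F K p r ζ chars
  open CharacterDuality F K p r ζ chars
  open GaussSums F K p r ζ chars
  open IncidenceSums F K p r ζ chars using (sumF-swap₂₂)

  core : Char → Char → Char → 𝔽 → Carrier
  core a b e κ = sumF (λ α → sumF (λ β → (inv a α * inv b β) *
    (e (((α *ᶠ β) -ᶠ α) +ᶠ κ) * inv e (((α *ᶠ β) -ᶠ β) +ᶠ κ))))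

  module WithAdditiveCharacter
    (θ-+ : ∀ x y → θ (x +ᶠ y) ≈ θ x * θ y)
    (θ-0 : θ 0ᶠ ≈ 1#)
    (sumF-θ : sumF θ ≈ 0#)
    (chars-IsChar : All IsChar chars)
    (chars-complete : ∀ χ → IsChar χ → Any (λ ψ → χ ≗ᶜ ψ) chars)
    (chars-distinct : AllPairs (λ χ ψ → ¬ (χ ≗ᶜ ψ)) chars)
    (chars-length : length chars ≡ q ℕ.∸ 1) where
    open Enumeration chars-IsChar chars-complete chars-distinct chars-length
    open AdditiveCharacter θ-+ θ-0 sumF-θ
    open AdditiveCharacter.Enumerated θ-+ θ-0 sumF-θ chars-IsChar chars-complete chars-distinct chars-length

    module Mellin {a b e : Char} (ca : IsChar a) (cb : IsChar b) (ce : IsChar e)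
             (a≉ε : ¬ (a ≗ᶜ ε)) (e≉ε : ¬ (e ≗ᶜ ε)) (ab≉ε : ¬ ((a · b) ≗ᶜ ε))
             (a[-1] : a -1ᶠ ≈ 1#) (b[-1] : b -1ᶠ ≈ 1#) (e[-1] : e -1ᶠ ≈ 1#)
             {κ : 𝔽} (κ≢0 : κ ≢ 0ᶠ) where

      ē = inv e
      cē = isChar-inv ce
      -- `u` and `v` are the characters of the Gauss variables s and t: next to ē(s) and e(t), the
      -- reciprocal substitution leaves b̄(s) and ā(t).
      u = inv b · ē
      v = inv a · e
      cu = isChar-· (isChar-inv cb) cē
      cv = isChar-· (isChar-inv ca) ce

      M M′ : 𝔽 → 𝔽 → 𝔽
      M  α β = ((α *ᶠ β) -ᶠ α) +ᶠ κ
      M′ α β = ((α *ᶠ β) -ᶠ β) +ᶠ κ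

      -- The nonlinear part κ (s + t) / (αβ) of the exponent, in the variables after the reciprocal
      -- substitution. Being a product, it is separated by multiplicative characters.
      twist : 𝔽 → 𝔽 → 𝔽 → 𝔽 → 𝔽
      twist s t α β = ((κ *ᶠ (s +ᶠ t)) *ᶠ (α *ᶠ β)) *ᶠ (s ⁻¹ᶠ *ᶠ t ⁻¹ᶠ)

      prefactor : 𝔽 → 𝔽 → 𝔽 → 𝔽 → Carrier
      prefactor s t α β = ((u s * v t) * (a α * b β)) * (θ (s +ᶠ t) * (θ α * θ β))

      kloosterman : 𝔽 → 𝔽 → 𝔽 → 𝔽 → Carrier
      kloosterman s t α β = prefactor s t α β * θ (twist s t α β)

      gauss-expand : ∀ α β → Q * (e (M α β) * ē (M′ α β)) ≈ sumF (λ s → sumF (λ t → (ē s * e t) * θ ((s *ᶠ M α β) +ᶠ (t *ᶠ M′ α β))))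
      gauss-expand α β = begin
        Q * (e (M α β) * ē (M′ α β))  ≈⟨ *-congʳ (trans (gauss-inv ce e≉ε) (trans (*-congʳ e[-1]) (*-identityˡ Q))) ⟨
        (gauss e * gauss ē) * (e (M α β) * ē (M′ α β))  ≈⟨ solve 4 (λ g h x y → (g :* h) :* (x :* y) := (h :* x) :* (g :* y)) refl _ _ _ _ ⟩
        (gauss ē * e (M α β)) * (gauss e * ē (M′ α β))  ≈⟨ *-cong (trans (gauss-scale cē (inv-≉ε ce e≉ε) _) (*-congˡ (inv-inv ce _))) (gauss-scale ce e≉ε _) ⟨
        sumF (λ s → ē s * θ (s *ᶠ M α β)) * sumF (λ t → e t * θ (t *ᶠ M′ α β)) ≈⟨ sumF-product _ _ ⟩
        sumF (λ s → sumF (λ t → (ē s * θ (s *ᶠ M α β)) * (e t * θ (t *ᶠ M′ α β))))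
          ≈⟨ sumF-cong (λ s → sumF-cong (λ t → trans (solve 4 (λ x y z w → (x :* y) :* (z :* w) := (x :* z) :* (y :* w)) refl _ _ _ _) (*-congˡ (sym (θ-+ _ _))))) ⟩
        sumF (λ s → sumF (λ t → (ē s * e t) * θ ((s *ᶠ M α β) +ᶠ (t *ᶠ M′ α β)))) ∎

      rescaled : 𝔽 → 𝔽 → 𝔽 → 𝔽 → Carrier
      rescaled s t α β = (inv a α * inv b β) * ((ē s * e t) * θ ((α *ᶠ β) ⁻¹ᶠ *ᶠ ((s *ᶠ M α β) +ᶠ (t *ᶠ M′ α β))))

      -- Scaling s and t by one common factor leaves ē(s) e(t) unchanged, so the exponent can be
      -- divided by αβ at no cost.
      rescale : ∀ {α β} → α ≢ 0ᶠ → β ≢ 0ᶠ → sumF (λ s → sumF (λ t → (ē s * e t) * θ ((s *ᶠ M α β) +ᶠ (t *ᶠ M′ α β)))) ≈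
        sumF (λ s → sumF (λ t → (ē s * e t) * θ ((α *ᶠ β) ⁻¹ᶠ *ᶠ ((s *ᶠ M α β) +ᶠ (t *ᶠ M′ α β)))))
      rescale {α} {β} α≢0 β≢0 = begin
        sumF (λ s → sumF (λ t → f s t))  ≈⟨ sumF-scale c≢0 _ ⟨
        sumF (λ s → sumF (λ t → f (c *ᶠ s) t))  ≈⟨ sumF-cong (λ s → sym (sumF-scale c≢0 _)) ⟩
        sumF (λ s → sumF (λ t → f (c *ᶠ s) (c *ᶠ t)))  ≈⟨ sumF-cong (λ s → sumF-cong (λ t → *-cong (begin
            ē (c *ᶠ s) * e (c *ᶠ t)  ≈⟨ *-cong (at* cē c s) (at* ce c t) ⟩
            (ē c * ē s) * (e c * e t)  ≈⟨ solve 4 (λ x y z w → (x :* y) :* (z :* w) := (z :* x) :* (y :* w)) refl _ _ _ _ ⟩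
            (e c * ē c) * (ē s * e t)  ≈⟨ trans (*-congʳ (χ·inv ce c≢0)) (*-identityˡ _) ⟩
            ē s * e t  ∎)
            (reflexive (≡.cong θ (solveᶠ 5 (λ c s t m n → ((c :*ᶠ s) :*ᶠ m) :+ᶠ ((c :*ᶠ t) :*ᶠ n) :=ᶠ c :*ᶠ ((s :*ᶠ m) :+ᶠ (t :*ᶠ n))) ≡.refl c s t _ _))))) ⟩
        sumF (λ s → sumF (λ t → (ē s * e t) * θ (c *ᶠ ((s *ᶠ M α β) +ᶠ (t *ᶠ M′ α β))))) ∎
        where
        c = (α *ᶠ β) ⁻¹ᶠ
        c≢0 = FP.⁻¹-≢0 (FP.*-≢0 α≢0 β≢0)
        f : 𝔽 → 𝔽 → Carrier
        f s t = (ē s * e t) * θ ((s *ᶠ M α β) +ᶠ (t *ᶠ M′ α β))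

      vanish-* : ∀ {x y w} → x ≈ 0# → (x * y) * w ≈ 0#
      vanish-* h = 0-*ˡ (0-*ˡ h)

      vanish-*ʳ : ∀ {x y w} → y ≈ 0# → (x * y) * w ≈ 0#
      vanish-*ʳ h = 0-*ˡ (0-*ʳ h)

      both-0 : ∀ {x y} → x ≈ 0# → y ≈ 0# → x ≈ y
      both-0 h k = trans h (sym k)

      Q*core : Q * core a b e κ ≈ sumF (λ s → sumF (λ t → sumF (λ α → sumF (λ β → rescaled s t α β))))
      Q*core = begin
        Q * core a b e κ
          ≈⟨ trans (sym (sumF-*ˡ _ _)) (sumF-cong (λ α → trans (sym (sumF-*ˡ _ _)) (sumF-cong (λ β →
               solve 3 (λ q w x → q :* (w :* x) := w :* (q :* x)) refl Q _ _)))) ⟩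
        sumF (λ α → sumF (λ β → (inv a α * inv b β) * (Q * (e (M α β) * ē (M′ α β)))))
          ≈⟨ sumF-cong (λ α → sumF-cong (λ β → trans (*-congˡ (gauss-expand α β)) (cases (α ≟ᶠ 0ᶠ)
               (λ { ≡.refl → both-0 (vanish-* (inv-0 a)) (vanish-* (inv-0 a)) })
               (λ α≢0 → cases (β ≟ᶠ 0ᶠ) (λ { ≡.refl → both-0 (vanish-*ʳ (inv-0 b)) (vanish-*ʳ (inv-0 b)) }) (λ β≢0 → *-congˡ (rescale α≢0 β≢0)))))) ⟩
        sumF (λ α → sumF (λ β → (inv a α * inv b β) * sumF (λ s → sumF (λ t → (ē s * e t) * θ ((α *ᶠ β) ⁻¹ᶠ *ᶠ ((s *ᶠ M α β) +ᶠ (t *ᶠ M′ α β)))))))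
          ≈⟨ sumF-cong (λ α → sumF-cong (λ β → trans (sym (sumF-*ˡ _ _)) (sumF-cong (λ s → sym (sumF-*ˡ _ _))))) ⟩
        sumF (λ α → sumF (λ β → sumF (λ s → sumF (λ t → rescaled s t α β))))
          ≈⟨ sumF-swap₂₂ _ ⟩
        sumF (λ s → sumF (λ t → sumF (λ α → sumF (λ β → rescaled s t α β)))) ∎

      -- The divided exponent is (s + t) - t / α - s / β + κ (s + t) / (αβ); its two middle terms
      -- are taken as the new variables. The signs are harmless because a(-1) = b(-1) = 1.
      reciprocal-pointwise : ∀ {s t α β} → s ≢ 0ᶠ → t ≢ 0ᶠ → α ≢ 0ᶠ → β ≢ 0ᶠ →
                             rescaled s t α β ≈ kloosterman s t ((-ᶠ t) *ᶠ α ⁻¹ᶠ) ((-ᶠ s) *ᶠ β ⁻¹ᶠ)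
      reciprocal-pointwise {s} {t} {α} {β} s≢0 t≢0 α≢0 β≢0 = trans (sym (*-assoc _ _ _)) (trans (*-cong characters exponent) (sym (*-assoc _ _ _)))
        where
        α′ = (-ᶠ t) *ᶠ α ⁻¹ᶠ
        β′ = (-ᶠ s) *ᶠ β ⁻¹ᶠ
        at-reciprocal : ∀ {χ} → IsChar χ → χ -1ᶠ ≈ 1# → ∀ {x y} → y ≢ 0ᶠ → χ ((-ᶠ x) *ᶠ y ⁻¹ᶠ) ≈ χ x * inv χ y
        at-reciprocal {χ} c h y≢0 = trans (at* c _ _) (*-cong (trans (at-neg c _) (trans (*-congʳ h) (*-identityˡ _))) (sym (inv-≢0 χ y≢0)))
        characters : (inv a α * inv b β) * (ē s * e t) ≈ (u s * v t) * (a α′ * b β′)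
        characters = sym (begin
          ((inv b s * ē s) * (inv a t * e t)) * (a α′ * b β′)  ≈⟨ *-congˡ (*-cong (at-reciprocal ca a[-1] α≢0) (at-reciprocal cb b[-1] β≢0)) ⟩
          ((inv b s * ē s) * (inv a t * e t)) * ((a t * inv a α) * (b s * inv b β))  ≈⟨ solve 8 (λ b' e' a' f a x b y → ((b' :* e') :* (a' :* f)) :* ((a :* x) :* (b :* y)) := ((a :* a') :* (b :* b')) :* ((x :* y) :* (e' :* f))) refl _ _ _ _ _ _ _ _ ⟩
          ((a t * inv a t) * (b s * inv b s)) * ((inv a α * inv b β) * (ē s * e t))  ≈⟨ trans (*-congʳ (trans (*-cong (χ·inv ca t≢0) (χ·inv cb s≢0)) (*-identityˡ 1#))) (*-identityˡ _) ⟩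
          (inv a α * inv b β) * (ē s * e t)  ∎)
        exponent-≡ : (α *ᶠ β) ⁻¹ᶠ *ᶠ ((s *ᶠ M α β) +ᶠ (t *ᶠ M′ α β)) ≡ ((s +ᶠ t) +ᶠ (α′ +ᶠ β′)) +ᶠ twist s t α′ β′
        exponent-≡ = ≡.trans (≡.cong (_*ᶠ ((s *ᶠ M α β) +ᶠ (t *ᶠ M′ α β))) (FP.⁻¹-distrib-* α≢0 β≢0))
          (≡.trans (solveᶠ 7 (λ s t α β i j κ → (i :*ᶠ j) :*ᶠ ((s :*ᶠ (((α :*ᶠ β) :+ᶠ :-ᶠ α) :+ᶠ κ)) :+ᶠ (t :*ᶠ (((α :*ᶠ β) :+ᶠ :-ᶠ β) :+ᶠ κ))) :=ᶠ
              ((s :+ᶠ t) :*ᶠ ((α :*ᶠ i) :*ᶠ (β :*ᶠ j)) :+ᶠ ((:-ᶠ t :*ᶠ i) :*ᶠ (β :*ᶠ j) :+ᶠ (:-ᶠ s :*ᶠ j) :*ᶠ (α :*ᶠ i))) :+ᶠ (κ :*ᶠ (s :+ᶠ t)) :*ᶠ (i :*ᶠ j))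
              ≡.refl s t α β (α ⁻¹ᶠ) (β ⁻¹ᶠ) κ)
          (≡.trans (≡.cong₂ (λ x y → ((((s +ᶠ t) *ᶠ (x *ᶠ y)) +ᶠ ((α′ *ᶠ y) +ᶠ (β′ *ᶠ x))) +ᶠ ((κ *ᶠ (s +ᶠ t)) *ᶠ (α ⁻¹ᶠ *ᶠ β ⁻¹ᶠ)))) (F.inverseʳ α α≢0) (F.inverseʳ β β≢0))
          (≡.trans (solveᶠ 7 (λ s t α′ β′ κ i j → (((s :+ᶠ t) :*ᶠ (:1ᶠ :*ᶠ :1ᶠ)) :+ᶠ ((α′ :*ᶠ :1ᶠ) :+ᶠ (β′ :*ᶠ :1ᶠ))) :+ᶠ ((κ :*ᶠ (s :+ᶠ t)) :*ᶠ (i :*ᶠ j)) :=ᶠ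
              ((s :+ᶠ t) :+ᶠ (α′ :+ᶠ β′)) :+ᶠ ((κ :*ᶠ (s :+ᶠ t)) :*ᶠ (i :*ᶠ j)) :*ᶠ (:1ᶠ :*ᶠ :1ᶠ)) ≡.refl s t α′ β′ κ (α ⁻¹ᶠ) (β ⁻¹ᶠ))
          (≡.trans (≡.cong₂ (λ x y → ((s +ᶠ t) +ᶠ (α′ +ᶠ β′)) +ᶠ (((κ *ᶠ (s +ᶠ t)) *ᶠ (α ⁻¹ᶠ *ᶠ β ⁻¹ᶠ)) *ᶠ (x *ᶠ y))) (≡.sym (F.inverseʳ s s≢0)) (≡.sym (F.inverseʳ t t≢0)))
            (≡.cong (((s +ᶠ t) +ᶠ (α′ +ᶠ β′)) +ᶠ_) (solveᶠ 7 (λ s t i j k l κ → ((κ :*ᶠ (s :+ᶠ t)) :*ᶠ (i :*ᶠ j)) :*ᶠ ((s :*ᶠ k) :*ᶠ (t :*ᶠ l)) :=ᶠ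
              ((κ :*ᶠ (s :+ᶠ t)) :*ᶠ ((:-ᶠ t :*ᶠ i) :*ᶠ (:-ᶠ s :*ᶠ j))) :*ᶠ (k :*ᶠ l)) ≡.refl s t (α ⁻¹ᶠ) (β ⁻¹ᶠ) (s ⁻¹ᶠ) (t ⁻¹ᶠ) κ))))))
        exponent : θ ((α *ᶠ β) ⁻¹ᶠ *ᶠ ((s *ᶠ M α β) +ᶠ (t *ᶠ M′ α β))) ≈ (θ (s +ᶠ t) * (θ α′ * θ β′)) * θ (twist s t α′ β′)
        exponent = trans (reflexive (≡.cong θ exponent-≡)) (trans (θ-+ _ _) (*-congʳ (trans (θ-+ _ _) (*-congˡ (θ-+ _ _)))))

      core-kloosterman : Q * core a b e κ ≈ sumF (λ s → sumF (λ t → sumF (λ α → sumF (λ β → kloosterman s t α β))))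
      core-kloosterman = trans Q*core (sumF-cong (λ s → sumF-cong (λ t → cases (s ≟ᶠ 0ᶠ)
        (λ { ≡.refl → sumF-cong (λ α → sumF-cong (λ β → both-0 (0-*ʳ (vanish-* (inv-0 e)))
               (vanish-* (vanish-* (at0 cu))))) })
        (λ s≢0 → cases (t ≟ᶠ 0ᶠ)
          (λ { ≡.refl → sumF-cong (λ α → sumF-cong (λ β → both-0 (0-*ʳ (vanish-*ʳ (at0 ce)))
                 (vanish-* (vanish-*ʳ (at0 cv))))) })
          (λ t≢0 → sumF-reciprocal (FP.-‿≢0 t≢0)
            (sumF-zero (λ β → vanish-* (inv-0 a)))
            (sumF-zero (λ β → vanish-* (0-*ʳ (0-*ˡ (at0 ca)))))
            (λ α α≢0 → sumF-reciprocal (FP.-‿≢0 s≢0)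
              (vanish-*ʳ (inv-0 b))
              (vanish-* (0-*ʳ (0-*ʳ (at0 cb))))
              (λ β β≢0 → reciprocal-pointwise s≢0 t≢0 α≢0 β≢0)))))))

      mellin-coefficient : Char → Carrier
      mellin-coefficient χ = (gauss (inv χ) * χ κ) * ((gauss (a · χ) * gauss (b · χ)) *
        (jacobi (u · inv χ) (v · inv χ) * gauss ((u · inv χ) · (v · inv χ) · χ)))

      expanded : 𝔽 → 𝔽 → 𝔽 → 𝔽 → Char → Carrier
      expanded s t α β χ = (gauss (inv χ) * χ κ) * ((((a · χ) α * θ α) * ((b · χ) β * θ β)) *
        (((u · inv χ) s * (v · inv χ) t) * (χ (s +ᶠ t) * θ (s +ᶠ t))))

      prefactor-0 : ∀ {s t α β} → s ≡ 0ᶠ ⊎ t ≡ 0ᶠ → prefactor s t α β ≈ 0#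
      prefactor-0 (inj₁ ≡.refl) = vanish-* (0-*ˡ (at0 cu))
      prefactor-0 (inj₂ ≡.refl) = vanish-* (0-*ʳ (at0 cv))

      expand-χ : ∀ s t α β {χ} → IsChar χ → prefactor s t α β * (gauss (inv χ) * χ (twist s t α β)) ≈ expanded s t α β χ
      expand-χ s t α β {χ} c = cases (s ≟ᶠ 0ᶠ)
        (λ e → both-0 (0-*ˡ (prefactor-0 (inj₁ e))) (0-*ʳ (0-*ʳ (vanish-* (trans (reflexive (≡.cong (u · inv χ) e)) (at0 (isChar-· cu (isChar-inv c))))))))
        (λ s≢0 → cases (t ≟ᶠ 0ᶠ)
          (λ e → both-0 (0-*ˡ (prefactor-0 {s} (inj₂ e))) (0-*ʳ (0-*ʳ (vanish-*ʳ (trans (reflexive (≡.cong (v · inv χ) e)) (at0 (isChar-· cv (isChar-inv c))))))))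
          (λ t≢0 → begin
            prefactor s t α β * (gauss (inv χ) * χ (twist s t α β))
              ≈⟨ *-congˡ (*-congˡ (trans (at* c _ _) (*-cong (trans (at* c _ _) (*-cong (at* c _ _) (at* c _ _))) (trans (at* c _ _) (sym (*-cong (inv-≢0 χ s≢0) (inv-≢0 χ t≢0))))))) ⟩
            (((u s * v t) * (a α * b β)) * (θ (s +ᶠ t) * (θ α * θ β))) * (gauss (inv χ) * (((χ κ * χ (s +ᶠ t)) * (χ α * χ β)) * (inv χ s * inv χ t)))
              ≈⟨ rearrange _ _ _ _ _ _ _ _ _ _ _ _ _ _ ⟩
            expanded s t α β χ ∎))
        where
        rearrange : ∀ us vt aα bβ θst θα θβ g χκ χst χα χβ χs χt →
          (((us * vt) * (aα * bβ)) * (θst * (θα * θβ))) * (g * (((χκ * χst) * (χα * χβ)) * (χs * χt))) ≈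
          (g * χκ) * ((((aα * χα) * θα) * ((bβ * χβ) * θβ)) * (((us * χs) * (vt * χt)) * (χst * θst)))
        rearrange = solve 14 (λ us vt aα bβ θst θα θβ g χκ χst χα χβ χs χt →
          (((us :* vt) :* (aα :* bβ)) :* (θst :* (θα :* θβ))) :* (g :* (((χκ :* χst) :* (χα :* χβ)) :* (χs :* χt))) :=
          (g :* χκ) :* ((((aα :* χα) :* θα) :* ((bβ :* χβ) :* θβ)) :* (((us :* χs) :* (vt :* χt)) :* (χst :* θst)))) refl

      -- The correction of `θ-expansion` at argument 0: where the prefactor is nonzero so are s, t,
      -- α and β, and `twist` vanishes only through its factor s + t.
      expand-0 : ∀ s t α β → prefactor s t α β * (N * ι (twist s t α β ≟ᶠ 0ᶠ)) ≈ (N * ((a α * θ α) * (b β * θ β))) * (ι (t ≟ᶠ (-ᶠ s)) * ((u s * v t) * θ (s +ᶠ t)))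
      expand-0 s t α β = trans (cases (s ≟ᶠ 0ᶠ) (λ e → both-0 (0-*ˡ (prefactor-0 (inj₁ e))) (0-*ˡ (prefactor-0 (inj₁ e)))) (λ s≢0 →
          cases (t ≟ᶠ 0ᶠ) (λ e → both-0 (0-*ˡ (prefactor-0 {s} (inj₂ e))) (0-*ˡ (prefactor-0 {s} (inj₂ e)))) (λ t≢0 →
          cases (α ≟ᶠ 0ᶠ) (λ { ≡.refl → both-0 (0-*ˡ (zero-α s t β)) (0-*ˡ (zero-α s t β)) }) (λ α≢0 →
          cases (β ≟ᶠ 0ᶠ) (λ { ≡.refl → both-0 (0-*ˡ (zero-β s t α)) (0-*ˡ (zero-β s t α)) }) (λ β≢0 →
            *-congˡ (*-congˡ (ι-cong (twist s t α β ≟ᶠ 0ᶠ) (t ≟ᶠ (-ᶠ s)) (to s≢0 t≢0 α≢0 β≢0) from)))))))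
          (solve 9 (λ us vt aα bβ θst θα θβ n i → (((us :* vt) :* (aα :* bβ)) :* (θst :* (θα :* θβ))) :* (n :* i) :=
            (n :* ((aα :* θα) :* (bβ :* θβ))) :* (i :* ((us :* vt) :* θst))) refl _ _ _ _ _ _ _ N _)
        where
        zero-α : ∀ s t β → prefactor s t 0ᶠ β ≈ 0#
        zero-α s t β = vanish-*ʳ (0-*ˡ (at0 ca))
        zero-β : ∀ s t α → prefactor s t α 0ᶠ ≈ 0#
        zero-β s t α = vanish-*ʳ (0-*ʳ (at0 cb))
        to : s ≢ 0ᶠ → t ≢ 0ᶠ → α ≢ 0ᶠ → β ≢ 0ᶠ → twist s t α β ≡ 0ᶠ → t ≡ -ᶠ s
        to s≢0 t≢0 α≢0 β≢0 h with (s +ᶠ t) ≟ᶠ 0ᶠ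
        ... | yes k = FP.-‿≡0⇒≡ (≡.trans (solveᶠ 2 (λ s t → t :+ᶠ :-ᶠ (:-ᶠ s) :=ᶠ s :+ᶠ t) ≡.refl s t) k)
        ... | no n  = ⊥-elim (FP.*-≢0 (FP.*-≢0 (FP.*-≢0 κ≢0 n) (FP.*-≢0 α≢0 β≢0)) (FP.*-≢0 (FP.⁻¹-≢0 s≢0) (FP.⁻¹-≢0 t≢0)) h)
        from : t ≡ -ᶠ s → twist s t α β ≡ 0ᶠ
        from h = ≡.trans (≡.cong (λ w → ((κ *ᶠ w) *ᶠ (α *ᶠ β)) *ᶠ (s ⁻¹ᶠ *ᶠ t ⁻¹ᶠ)) (≡.trans (≡.cong (s +ᶠ_) h) (FP.-‿inverseʳ s)))
          (solveᶠ 3 (λ k m n → ((k :*ᶠ :0ᶠ) :*ᶠ m) :*ᶠ n :=ᶠ :0ᶠ) ≡.refl κ _ _)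

      uv≉ε : ¬ ((u · v) ≗ᶜ ε)
      uv≉ε h = ab≉ε (by-units (at0 (isChar-· ca cb)) ε-0 (λ x x≢0 → begin
        a x * b x  ≈⟨ trans (*-congˡ (trans (h x) (ε-≢0 x≢0))) (*-identityʳ _) ⟨
        (a x * b x) * ((inv b x * ē x) * (inv a x * e x))  ≈⟨ solve 6 (λ a b b' e' a' e → (a :* b) :* ((b' :* e') :* (a' :* e)) := (a :* a') :* ((b :* b') :* (e :* e'))) refl _ _ _ _ _ _ ⟩
        (a x * inv a x) * ((b x * inv b x) * (e x * ē x))  ≈⟨ *-cong (χ·inv ca x≢0) (*-cong (χ·inv cb x≢0) (χ·inv ce x≢0)) ⟩
        1# * (1# * 1#)  ≈⟨ solve 0 (:1 :* (:1 :* :1) := :1) refl ⟩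
        1#  ≈⟨ ε-≢0 x≢0 ⟨
        ε x  ∎))

      -- Along t = -s the additive character is 1 and the sum over s is a multiple of Σ u v, with u
      -- v = ā b̄ nontrivial.
      remainder-0 : sumF (λ s → sumF (λ t → sumF (λ α → sumF (λ β → (N * ((a α * θ α) * (b β * θ β))) * (ι (t ≟ᶠ (-ᶠ s)) * ((u s * v t) * θ (s +ᶠ t))))))) ≈ 0#
      remainder-0 = begin
        sumF (λ s → sumF (λ t → sumF (λ α → sumF (λ β → (N * ((a α * θ α) * (b β * θ β))) * (ι (t ≟ᶠ (-ᶠ s)) * ((u s * v t) * θ (s +ᶠ t)))))))
          ≈⟨ sumF-cong (λ s → sumF-cong (λ t → trans (sumF-cong (λ α → sumF-*ʳ _ _)) (sumF-*ʳ _ _))) ⟩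
        sumF (λ s → sumF (λ t → G * (ι (t ≟ᶠ (-ᶠ s)) * ((u s * v t) * θ (s +ᶠ t)))))
          ≈⟨ sumF-cong (λ s → trans (sumF-*ˡ _ _) (*-congˡ (sumF-ι (-ᶠ s) _))) ⟩
        sumF (λ s → G * ((u s * v (-ᶠ s)) * θ (s +ᶠ -ᶠ s)))
          ≈⟨ sumF-cong (λ s → trans (*-congˡ (trans (*-cong (*-congˡ (at-neg cv s)) (trans (reflexive (≡.cong θ (FP.-‿inverseʳ s))) θ-0)) (*-identityʳ _)))
               (solve 4 (λ g u m v → g :* (u :* (m :* v)) := (g :* m) :* (u :* v)) refl G _ _ _)) ⟩
        sumF (λ s → (G * v -1ᶠ) * (u · v) s)
          ≈⟨ trans (sumF-*ˡ _ _) (0-*ʳ (sumF-nontrivial (isChar-· cu cv) uv≉ε)) ⟩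
        0# ∎
        where G = sumF (λ α → sumF (λ β → N * ((a α * θ α) * (b β * θ β))))

      -- α and β separate into Gauss sums. Collecting s and t by σ = s + t gives a convolution,
      -- whose correction at σ = 0 is killed by the factor χ(σ).
      expanded-sum : ∀ {χ} → IsChar χ → sumF (λ s → sumF (λ t → sumF (λ α → sumF (λ β → expanded s t α β χ)))) ≈ mellin-coefficient χ
      expanded-sum {χ} c = begin
        sumF (λ s → sumF (λ t → sumF (λ α → sumF (λ β → expanded s t α β χ))))
          ≈⟨ sumF-cong (λ s → sumF-cong (λ t → trans (sumF-cong (λ α → trans (sumF-*ˡ _ _) (*-congˡ (sumF-*ʳ _ _)))) (trans (sumF-*ˡ _ _) (*-congˡ (trans (sumF-*ʳ _ _) (*-congʳ (sym (sumF-product _ _)))))))) ⟩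
        sumF (λ s → sumF (λ t → (gauss (inv χ) * χ κ) * ((gauss (a · χ) * gauss (b · χ)) * ((X s * Y t) * (χ (s +ᶠ t) * θ (s +ᶠ t))))))
          ≈⟨ trans (sumF-cong (λ s → trans (sumF-*ˡ _ _) (*-congˡ (sumF-*ˡ _ _)))) (trans (sumF-*ˡ _ _) (*-congˡ (sumF-*ˡ _ _))) ⟩
        (gauss (inv χ) * χ κ) * ((gauss (a · χ) * gauss (b · χ)) * sumF (λ s → sumF (λ t → (X s * Y t) * (χ (s +ᶠ t) * θ (s +ᶠ t)))))
          ≈⟨ *-congˡ (*-congˡ (trans (sumF-cong (λ s → trans (sym (sumF-shift (-ᶠ s) _)) (sumF-cong (λ σ → trans (*-congˡ (reflexive (≡.cong (λ w → χ w * θ w)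
               (solveᶠ 2 (λ s σ → s :+ᶠ (σ :+ᶠ :-ᶠ s) :=ᶠ σ) ≡.refl s σ)))) (*-comm _ _))))) (sumF-swap _))) ⟩
        (gauss (inv χ) * χ κ) * ((gauss (a · χ) * gauss (b · χ)) * sumF (λ σ → sumF (λ s → (χ σ * θ σ) * (X s * Y (σ -ᶠ s)))))
          ≈⟨ *-congˡ (*-congˡ (sumF-cong (λ σ → trans (sumF-*ˡ _ _) (trans (*-congˡ (convolution cX cY σ)) (σ-term σ))))) ⟩
        (gauss (inv χ) * χ κ) * ((gauss (a · χ) * gauss (b · χ)) * sumF (λ σ → jacobi X Y * (((X · Y) · χ) σ * θ σ)))
          ≈⟨ *-congˡ (*-congˡ (sumF-*ˡ _ _)) ⟩
        mellin-coefficient χ ∎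
        where
        X = u · inv χ
        Y = v · inv χ
        cX = isChar-· cu (isChar-inv c)
        cY = isChar-· cv (isChar-inv c)
        σ-term : ∀ σ → (χ σ * θ σ) * ((X · Y) σ * jacobi X Y + ι (σ ≟ᶠ 0ᶠ) * (Y -1ᶠ * sumF (X · Y))) ≈ jacobi X Y * (((X · Y) · χ) σ * θ σ)
        σ-term σ = cases (σ ≟ᶠ 0ᶠ)
          (λ { ≡.refl → both-0 (vanish-* (at0 c)) (0-*ʳ (0-*ˡ (0-*ʳ (at0 c)))) })
          (λ n → trans (*-congˡ (trans (+-congˡ (ι-no-* (σ ≟ᶠ 0ᶠ) n)) (+-identityʳ _))) (solve 4 (λ c t w j → (c :* t) :* (w :* j) := j :* ((w :* c) :* t)) refl (χ σ) (θ σ) ((X · Y) σ) (jacobi X Y)))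

      core-mellin : N * (Q * core a b e κ) ≈ ∑ chars mellin-coefficient
      core-mellin = begin
        N * (Q * core a b e κ)
          ≈⟨ *-congˡ core-kloosterman ⟩
        N * sumF (λ s → sumF (λ t → sumF (λ α → sumF (λ β → kloosterman s t α β))))
          ≈⟨ trans (sym (sumF-*ˡ _ _)) (sumF-cong (λ s → trans (sym (sumF-*ˡ _ _)) (sumF-cong (λ t → trans (sym (sumF-*ˡ _ _)) (sumF-cong (λ α → trans (sym (sumF-*ˡ _ _)) (sumF-cong (λ β → expand s t α β)))))))) ⟩
        sumF (λ s → sumF (λ t → sumF (λ α → sumF (λ β → ∑ chars (expanded s t α β) + remainder s t α β))))
          ≈⟨ trans (sumF-cong (λ s → trans (sumF-cong (λ t → trans (sumF-cong (λ α → sumF-+ _ _)) (sumF-+ _ _))) (sumF-+ _ _))) (sumF-+ _ _) ⟩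
        sumF (λ s → sumF (λ t → sumF (λ α → sumF (λ β → ∑ chars (expanded s t α β))))) + sumF (λ s → sumF (λ t → sumF (λ α → sumF (λ β → remainder s t α β))))
          ≈⟨ trans (+-congˡ remainder-0) (+-identityʳ _) ⟩
        sumF (λ s → sumF (λ t → sumF (λ α → sumF (λ β → ∑ chars (expanded s t α β)))))
          ≈⟨ trans (sumF-cong (λ s → trans (sumF-cong (λ t → trans (sumF-cong (λ α → ∑-swap F.elements chars _)) (∑-swap F.elements chars _))) (∑-swap F.elements chars _))) (∑-swap F.elements chars _) ⟩
        ∑ chars (λ χ → sumF (λ s → sumF (λ t → sumF (λ α → sumF (λ β → expanded s t α β χ)))))
          ≈⟨ ∑-cong-All (All.map expanded-sum chars-IsChar) ⟩
        ∑ chars mellin-coefficient ∎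
        where
        remainder : 𝔽 → 𝔽 → 𝔽 → 𝔽 → Carrier
        remainder s t α β = (N * ((a α * θ α) * (b β * θ β))) * (ι (t ≟ᶠ (-ᶠ s)) * ((u s * v t) * θ (s +ᶠ t)))
        expand : ∀ s t α β → N * kloosterman s t α β ≈ ∑ chars (expanded s t α β) + remainder s t α β
        expand s t α β = begin
          N * (prefactor s t α β * θ y)  ≈⟨ solve 3 (λ n w t → n :* (w :* t) := w :* (n :* t)) refl N _ _ ⟩
          prefactor s t α β * (N * θ y)  ≈⟨ *-congˡ (θ-expansion y) ⟩
          prefactor s t α β * (∑ chars (λ χ → gauss (inv χ) * χ y) + N * ι (y ≟ᶠ 0ᶠ))  ≈⟨ distribˡ _ _ _ ⟩
          prefactor s t α β * ∑ chars (λ χ → gauss (inv χ) * χ y) + prefactor s t α β * (N * ι (y ≟ᶠ 0ᶠ))  ≈⟨ +-cong (trans (sym (∑-*ˡ chars _ _)) (∑-cong-All (All.map (expand-χ s t α β) chars-IsChar))) (expand-0 s t α β) ⟩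
          ∑ chars (expanded s t α β) + remainder s t α β  ∎
          where y = twist s t α β

      jacobi-product : Char → Carrier
      jacobi-product χ = χ κ * ((jacobi (a · χ) (inv χ) * jacobi (b · χ) ((inv a · inv b) · inv χ)) * jacobi (u · inv χ) (v · inv χ))

      -- The Gauss sums are paired so that the products of characters are (aχ) χ̄ = a and (bχ)(ā b̄
      -- χ̄) = ā. Neither depends on χ, so a ≠ ε makes the product formula valid for every χ at
      -- once, and g(a) g(ā) = q.
      mellin-jacobi : ∀ {χ} → IsChar χ → mellin-coefficient χ ≈ Q * jacobi-product χ
      mellin-jacobi {χ} c = begin
        (gauss χ̄ * χ κ) * ((gauss (a · χ) * gauss (b · χ)) * (J * gauss (((u · χ̄) · (v · χ̄)) · χ)))
          ≈⟨ *-congˡ (*-congˡ (*-congˡ (gauss-cong third))) ⟩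
        (gauss χ̄ * χ κ) * ((gauss (a · χ) * gauss (b · χ)) * (J * gauss (w · χ̄)))
          ≈⟨ solve 6 (λ g k x y j h → (g :* k) :* ((x :* y) :* (j :* h)) := k :* (((x :* g) :* (y :* h)) :* j)) refl _ _ _ _ _ _ ⟩
        χ κ * (((gauss (a · χ) * gauss χ̄) * (gauss (b · χ) * gauss (w · χ̄))) * J)
          ≈⟨ *-congˡ (*-congʳ (*-cong
               (trans (gauss-*-nontrivial (isChar-· ca c) cχ̄ (λ h → a≉ε (λ x → trans (sym (first x)) (h x)))) (*-congˡ (gauss-cong first)))
               (trans (gauss-*-nontrivial (isChar-· cb c) (isChar-· cw cχ̄) (λ h → inv-≉ε ca a≉ε (λ x → trans (sym (second x)) (h x)))) (*-congˡ (gauss-cong second))))) ⟩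
        χ κ * (((J₁ * gauss a) * (J₂ * gauss (inv a))) * J)
          ≈⟨ solve 6 (λ k x g y h j → k :* (((x :* g) :* (y :* h)) :* j) := (g :* h) :* (k :* ((x :* y) :* j))) refl _ _ _ _ _ _ ⟩
        (gauss a * gauss (inv a)) * jacobi-product χ
          ≈⟨ *-congʳ (trans (gauss-inv ca a≉ε) (trans (*-congʳ a[-1]) (*-identityˡ Q))) ⟩
        Q * jacobi-product χ ∎
        where
        χ̄ = inv χ
        cχ̄ = isChar-inv c
        w = inv a · inv b
        cw = isChar-· (isChar-inv ca) (isChar-inv cb)
        J = jacobi (u · χ̄) (v · χ̄)
        J₁ = jacobi (a · χ) χ̄
        J₂ = jacobi (b · χ) (w · χ̄)
        third : (((u · χ̄) · (v · χ̄)) · χ) ≗ᶜ (w · χ̄)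
        third = by-units (at0 (isChar-· (isChar-· (isChar-· cu cχ̄) (isChar-· cv cχ̄)) c)) (at0 (isChar-· cw cχ̄)) (λ x x≢0 → begin
          (((inv b x * ē x) * χ̄ x) * ((inv a x * e x) * χ̄ x)) * χ x  ≈⟨ solve 6 (λ b e' k a e c → (((b :* e') :* k) :* ((a :* e) :* k)) :* c := ((a :* b) :* k) :* ((c :* k) :* (e :* e'))) refl _ _ _ _ _ _ ⟩
          ((inv a x * inv b x) * χ̄ x) * ((χ x * χ̄ x) * (e x * ē x))  ≈⟨ trans (*-congˡ (trans (*-cong (χ·inv c x≢0) (χ·inv ce x≢0)) (*-identityˡ 1#))) (*-identityʳ _) ⟩
          (inv a x * inv b x) * χ̄ x  ∎)
        first : ((a · χ) · χ̄) ≗ᶜ a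
        first = by-units (at0 (isChar-· (isChar-· ca c) cχ̄)) (at0 ca) (λ x x≢0 →
          trans (*-assoc _ _ _) (trans (*-congˡ (χ·inv c x≢0)) (*-identityʳ _)))
        second : ((b · χ) · (w · χ̄)) ≗ᶜ inv a
        second = by-units (at0 (isChar-· (isChar-· cb c) (isChar-· cw cχ̄))) (inv-0 a) (λ x x≢0 → begin
          (b x * χ x) * ((inv a x * inv b x) * χ̄ x)  ≈⟨ solve 5 (λ b c a b' c' → (b :* c) :* ((a :* b') :* c') := a :* ((b :* b') :* (c :* c'))) refl _ _ _ _ _ ⟩
          inv a x * ((b x * inv b x) * (χ x * χ̄ x))  ≈⟨ trans (*-congˡ (trans (*-cong (χ·inv cb x≢0) (χ·inv c x≢0)) (*-identityˡ 1#))) (*-identityʳ _) ⟩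
          inv a x  ∎)

      N*core : N * core a b e κ ≈ ∑ chars jacobi-product
      N*core = KP.*-cancelˡ Q≉0 (begin
        Q * (N * core a b e κ)  ≈⟨ solve 3 (λ q n x → q :* (n :* x) := n :* (q :* x)) refl Q N _ ⟩
        N * (Q * core a b e κ)  ≈⟨ core-mellin ⟩
        ∑ chars mellin-coefficient  ≈⟨ ∑-cong-All (All.map mellin-jacobi chars-IsChar) ⟩
        ∑ chars (λ χ → Q * jacobi-product χ)  ≈⟨ ∑-*ˡ chars Q _ ⟩
        Q * ∑ chars jacobi-product  ∎)

    module _ (2≢0 : 1ᶠ +ᶠ 1ᶠ ≢ 0ᶠ) where
      open QuadraticCharacter 2≢0
      open HasseDavenport 2≢0

      -- Hasse–Davenport for the two binomials of the ₄F₃ whose upper parameters differ by φ.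
      jacobi-pair : ∀ {T X Y} → IsChar T → IsChar X → IsChar Y → (X · Y) ≗ᶜ inv (sq T) → ¬ (sq (T · X) ≗ᶜ ε) →
        ((jacobi T X * jacobi (T · φ) Y) * (gauss (T · X) * gauss ((T · φ) · Y))) * T 4ᶠ ≈ Q * (jacobi X Y * gauss φ)
      jacobi-pair {T} {X} {Y} cT cX cY XY≗ [TX]²≉ε = begin
        ((jacobi T X * jacobi (T · φ) Y) * (gauss (T · X) * gauss ((T · φ) · Y))) * T 4ᶠ
          ≈⟨ *-congʳ (solve 4 (λ a b c d → (a :* b) :* (c :* d) := (a :* c) :* (b :* d)) refl _ _ _ _) ⟩
        ((jacobi T X * gauss (T · X)) * (jacobi (T · φ) Y * gauss ((T · φ) · Y))) * T 4ᶠ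
          ≈⟨ *-congʳ (*-cong (gauss-*-nontrivial cT cX (λ h → [TX]²≉ε (sq-ε h))) (gauss-*-nontrivial (isChar-· cT isChar-φ) cY TφY≉ε)) ⟨
        ((gauss T * gauss X) * (gauss (T · φ) * gauss Y)) * T 4ᶠ
          ≈⟨ solve 5 (λ t x p y f → ((t :* x) :* (p :* y)) :* f := (f :* (t :* p)) :* (x :* y)) refl _ _ _ _ _ ⟩
        (T 4ᶠ * (gauss T * gauss (T · φ))) * (gauss X * gauss Y)
          ≈⟨ *-congʳ (gauss-duplication cT) ⟩
        (gauss (sq T) * gauss φ) * (gauss X * gauss Y)
          ≈⟨ solve 4 (λ s f x y → (s :* f) :* (x :* y) := (s :* (x :* y)) :* f) refl _ _ _ _ ⟩
        (gauss (sq T) * (gauss X * gauss Y)) * gauss φ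
          -- For some T the character X Y = T̄² is trivial. Then g(T²) = -1, and this sign is
          -- matched by J(X, X̄) = -X(-1) against g(X) g(X̄) = X(-1) q, so the result is the generic
          -- one.
          ≈⟨ *-congʳ (cases (isChar-· cX cY ≗? isChar-ε) degenerate generic) ⟩
        (Q * jacobi X Y) * gauss φ
          ≈⟨ *-assoc _ _ _ ⟩
        Q * (jacobi X Y * gauss φ) ∎
        where
        csqT = isChar-· cT cT
        sq-ε : ∀ {χ} → χ ≗ᶜ ε → sq χ ≗ᶜ ε
        sq-ε h x = trans (*-cong (h x) (h x)) (·ε isChar-ε x)
        sqT·XY : ∀ {x} → x ≢ 0ᶠ → (T x * T x) * (X x * Y x) ≈ 1#
        sqT·XY x≢0 = trans (*-congˡ (XY≗ _)) (χ·inv csqT x≢0)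
        -- (T X)² (T φ Y)² = (T² X Y)² φ² is trivial, so the one assumption on (T X)² serves both
        -- products.
        TφY≉ε : ¬ (((T · φ) · Y) ≗ᶜ ε)
        TφY≉ε h = [TX]²≉ε (by-units (at0 (isChar-· (isChar-· cT cX) (isChar-· cT cX))) ε-0 (λ x x≢0 → begin
          (T x * X x) * (T x * X x)
            ≈⟨ trans (*-congˡ (trans (sq-ε h x) (ε-≢0 x≢0))) (*-identityʳ _) ⟨
          ((T x * X x) * (T x * X x)) * (((T x * φ x) * Y x) * ((T x * φ x) * Y x))
            ≈⟨ solve 4 (λ t x f y → ((t :* x) :* (t :* x)) :* (((t :* f) :* y) :* ((t :* f) :* y)) := (((t :* t) :* (x :* y)) :* ((t :* t) :* (x :* y))) :* (f :* f)) refl _ _ _ _ ⟩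
          (((T x * T x) * (X x * Y x)) * ((T x * T x) * (X x * Y x))) * (φ x * φ x)
            ≈⟨ *-cong (trans (*-cong (sqT·XY x≢0) (sqT·XY x≢0)) (*-identityˡ 1#)) (φ·φ x) ⟩
          1# * ε x
            ≈⟨ *-identityˡ _ ⟩
          ε x ∎))
        sqT[-1] : sq T -1ᶠ ≈ 1#
        sqT[-1] = χ[-1]² cT
        generic : ¬ ((X · Y) ≗ᶜ ε) → gauss (sq T) * (gauss X * gauss Y) ≈ Q * jacobi X Y
        generic n = begin
          gauss (sq T) * (gauss X * gauss Y)  ≈⟨ *-congˡ (trans (gauss-*-nontrivial cX cY n) (*-congˡ (gauss-cong XY≗))) ⟩
          gauss (sq T) * (jacobi X Y * gauss (inv (sq T)))  ≈⟨ solve 3 (λ g j h → g :* (j :* h) := (g :* h) :* j) refl _ _ _ ⟩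
          (gauss (sq T) * gauss (inv (sq T))) * jacobi X Y  ≈⟨ *-congʳ (trans (gauss-inv csqT (λ h → n (λ x → trans (XY≗ x) (trans (inv-cong h x) (inv-ε x)))))
                                                                          (trans (*-congʳ sqT[-1]) (*-identityˡ Q))) ⟩
          Q * jacobi X Y  ∎
        degenerate : (X · Y) ≗ᶜ ε → gauss (sq T) * (gauss X * gauss Y) ≈ Q * jacobi X Y
        degenerate h = begin
          gauss (sq T) * (gauss X * gauss Y)  ≈⟨ *-cong (trans (gauss-cong sqT≗ε) gauss-ε) (trans (*-congˡ (gauss-cong Y≗)) (gauss-inv cX X≉ε)) ⟩
          - 1# * (X -1ᶠ * Q)  ≈⟨ solve 2 (λ x q → :- :1 :* (x :* q) := q :* :- x) refl _ Q ⟩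
          Q * - X -1ᶠ  ≈⟨ *-congˡ (trans (jacobi-cong {X} {X} (λ _ → refl) Y≗) (jacobi-inv cX X≉ε)) ⟨
          Q * jacobi X Y  ∎
          where
          sqT≗ε : sq T ≗ᶜ ε
          sqT≗ε = by-units (at0 csqT) ε-0 (λ x x≢0 → trans (sym (trans (*-congˡ (trans (h x) (ε-≢0 x≢0))) (*-identityʳ _))) (trans (sqT·XY x≢0) (sym (ε-≢0 x≢0))))
          X≉ε : ¬ (X ≗ᶜ ε)
          X≉ε k = [TX]²≉ε (λ x → trans (solve 2 (λ t x → (t :* x) :* (t :* x) := (t :* t) :* (x :* x)) refl _ _) (trans (*-cong (sqT≗ε x) (sq-ε k x)) (·ε isChar-ε x)))
          Y≗ : Y ≗ᶜ inv X
          Y≗ = ≗-from-ratio cY (isChar-inv cX) ratio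
            where
            ratio : (inv X · inv Y) ≗ᶜ ε
            ratio x = trans (sym (inv-· X Y x)) (trans (inv-cong h x) (inv-ε x))

-- Assembly of the product formula

module ProductFormula
  (F : FiniteField) (K : CharZeroField) (p r : ℕ) (ζ : CharZeroField.Carrier K)
  (chars : List (FiniteField.Carrier F → CharZeroField.Carrier K)) where
  open CharacterSums F K p r ζ chars
  open JacobiSums F K p r ζ chars
  open CharacterDuality F K p r ζ chars
  open GaussSums F K p r ζ chars
  open EulerIntegral F K p r ζ chars
  open IncidenceSums F K p r ζ chars
  open MellinExpansion F K p r ζ chars

  *-≈1 : ∀ {x y} → x ≈ 1# → y ≈ 1# → x * y ≈ 1#
  *-≈1 h k = trans (*-cong h k) (*-identityˡ 1#)

  drop-1 : ∀ {x y} → y ≈ 1# → x * y ≈ x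
  drop-1 h = trans (*-congˡ h) (*-identityʳ _)

  inv-unique : ∀ {χ} → IsChar χ → ∀ {x y} → x ≢ 0ᶠ → χ x * y ≈ 1# → y ≈ inv χ x
  inv-unique {χ} c {x} {y} x≢0 h = begin
    y  ≈⟨ drop-1 (χ·inv c x≢0) ⟨
    y * (χ x * inv χ x)  ≈⟨ solve 3 (λ y a b → y :* (a :* b) := (a :* y) :* b) refl y _ _ ⟩
    (χ x * y) * inv χ x  ≈⟨ trans (*-congʳ h) (*-identityˡ _) ⟩
    inv χ x  ∎

  module _
    (θ-+ : ∀ x y → θ (x +ᶠ y) ≈ θ x * θ y)
    (θ-0 : θ 0ᶠ ≈ 1#)
    (sumF-θ : sumF θ ≈ 0#)
    (2≢0 : 1ᶠ +ᶠ 1ᶠ ≢ 0ᶠ)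
    (chars-IsChar : All IsChar chars)
    (chars-complete : ∀ χ → IsChar χ → Any (λ ψ → χ ≗ᶜ ψ) chars)
    (chars-distinct : AllPairs (λ χ ψ → ¬ (χ ≗ᶜ ψ)) chars)
    (chars-length : length chars ≡ q ℕ.∸ 1)
    {A D E : Char} (cA : IsChar A) (cD : IsChar D) (cE : IsChar E)
    (A²≉ε : ¬ (sq A ≗ᶜ ε)) (E²≉ε : ¬ (sq E ≗ᶜ ε))
    (A²D̄²Ē²≉ε : ¬ ((sq A · inv (sq D) · inv (sq E)) ≗ᶜ ε))
    (A²D²Ē²≉ε : ¬ ((sq A · sq D · inv (sq E)) ≗ᶜ ε))
    (A²≉D² : ¬ (sq A ≗ᶜ sq D)) (D²≉E² : ¬ (sq D ≗ᶜ sq E)) where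
    open Enumeration chars-IsChar chars-complete chars-distinct chars-length
    open EulerIntegral.Enumerated F K p r ζ chars chars-IsChar chars-complete chars-distinct chars-length
    open AdditiveCharacter θ-+ θ-0 sumF-θ
    open QuadraticCharacter 2≢0
    open WithAdditiveCharacter θ-+ θ-0 sumF-θ chars-IsChar chars-complete chars-distinct chars-length

    -- `ab` has the literal bracketing of the series parameter and agrees with `a · b` only up to
    -- associativity.
    a b c e ē ab s : Char
    a  = sq A
    c  = sq D
    e  = sq E
    ē  = inv e
    b  = c · ē
    ab = a · c · ē
    s  = A · D · inv E

    ca : IsChar a
    ca = isChar-· cA cA
    cc : IsChar c
    cc = isChar-· cD cD
    ce : IsChar e
    ce = isChar-· cE cE
    cē : IsChar ē
    cē = isChar-inv ce
    cb : IsChar b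
    cb = isChar-· cc cē
    caē : IsChar (a · ē)
    caē = isChar-· ca cē
    cs : IsChar s
    cs = isChar-· (isChar-· cA cD) (isChar-inv cE)

    a[-1] : a -1ᶠ ≈ 1#
    a[-1] = χ[-1]² cA
    c[-1] : c -1ᶠ ≈ 1#
    c[-1] = χ[-1]² cD
    e[-1] : e -1ᶠ ≈ 1#
    e[-1] = χ[-1]² cE
    ē[-1] : ē -1ᶠ ≈ 1#
    ē[-1] = trans (inv[-1] {e}) e[-1]
    b[-1] : b -1ᶠ ≈ 1#
    b[-1] = *-≈1 c[-1] ē[-1]

    inv-ē : ∀ x → inv ē x ≈ e x
    inv-ē = inv-inv ce

    inv-b : ∀ x → inv b x ≈ inv c x * e x
    inv-b x = trans (inv-· c ē x) (*-congˡ (inv-ē x))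

    b≉ε : ¬ (b ≗ᶜ ε)
    b≉ε h = D²≉E² (λ x → sym (≗-from-ratio ce cc h x))

    ab̄ē≉ε : ¬ ((a · (inv b · ē)) ≗ᶜ ε)
    ab̄ē≉ε h = A²≉D² (λ x → sym (≗-from-ratio cc ca (by-units (0-*ˡ (at0 ca)) ε-0 (λ x x≢0 → begin
      a x * inv c x  ≈⟨ drop-1 (χ·inv ce x≢0) ⟨
      (a x * inv c x) * (e x * ē x)  ≈⟨ solve 4 (λ a c e f → (a :* c) :* (e :* f) := a :* ((c :* e) :* f)) refl _ _ _ _ ⟩
      a x * ((inv c x * e x) * ē x)  ≈⟨ *-congˡ (*-congʳ (inv-b x)) ⟨
      a x * (inv b x * ē x)  ≈⟨ h x ⟩
      ε x  ∎)) x))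

    a·b≉ε : ¬ ((a · b) ≗ᶜ ε)
    a·b≉ε h = A²D²Ē²≉ε (λ x → trans (*-assoc _ _ _) (h x))

    H₁ H₂ : 𝔽 → Carrier
    H₁ = hyp a (e ∷ []) (c ∷ [])
    H₂ = hyp b (ē ∷ []) (a · ē ∷ [])

    H₃ : 𝔽 → Carrier
    H₃ = hyp a (b ∷ s ∷ s · φ ∷ []) (ab ∷ c ∷ a · ē ∷ [])

    g₁ g₂ : Carrier
    g₁ = gauss (A · inv E · inv D)
    g₂ = gauss (inv A · E · D · φ)

    module _ {z : 𝔽} (z≢0 : z ≢ 0ᶠ) (z≢1 : z ≢ 1ᶠ) where
      open Incidence ca cb ce A²≉ε b≉ε E²≉ε ab̄ē≉ε a[-1] b[-1] e[-1] z≢0 z≢1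
        using (product-integral; collapsed; product-collapsed; z=-1; num; den; 1-z≢0)

      w κ : 𝔽
      w = 1ᶠ -ᶠ z
      κ = (-ᶠ z) *ᶠ (w *ᶠ w) ⁻¹ᶠ

      w²≢0 : w *ᶠ w ≢ 0ᶠ
      w²≢0 = FP.*-≢0 1-z≢0 1-z≢0

      κ≢0 : κ ≢ 0ᶠ
      κ≢0 = FP.*-≢0 (FP.-‿≢0 z≢0) (FP.⁻¹-≢0 w²≢0)

      κw² : κ *ᶠ (w *ᶠ w) ≡ -ᶠ z
      κw² = FP.*⁻¹-solves (-ᶠ z) w²≢0

      open Mellin ca cb ce A²≉ε E²≉ε a·b≉ε a[-1] b[-1] e[-1] κ≢0 using (N*core; jacobi-product; u; v)

      R : Carrier
      R = core a b e κ

      H-product : (Q * H₁ z) * (Q * H₂ z) ≈ product-integral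
      H-product = begin
        (Q * H₁ z) * (Q * H₂ z)
          ≈⟨ *-cong (trans (hyp-integral ca ce cc A²≉ε z≢0) (trans (*-congʳ (*-≈1 e[-1] c[-1])) (*-identityˡ _)))
                    (trans (hyp-integral cb cē caē b≉ε z≢0) (trans (*-congʳ (*-≈1 ē[-1] (*-≈1 a[-1] ē[-1]))) (*-identityˡ _))) ⟩
        sumF (λ y → (e y * (ē (1ᶠ -ᶠ y) * c (1ᶠ -ᶠ y))) * inv a (1ᶠ -ᶠ (z *ᶠ y))) *
        sumF (λ t → (ē t * (inv ē (1ᶠ -ᶠ t) * (a (1ᶠ -ᶠ t) * ē (1ᶠ -ᶠ t)))) * inv b (1ᶠ -ᶠ (z *ᶠ t)))
          ≈⟨ trans (*-congˡ (sumF-cong (λ t → *-congʳ (*-congˡ (cancel-ē (1ᶠ -ᶠ t)))))) (sumF-product _ _) ⟩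
        sumF (λ y → sumF (λ t → ((e y * (ē (1ᶠ -ᶠ y) * c (1ᶠ -ᶠ y))) * inv a (1ᶠ -ᶠ (z *ᶠ y))) * ((ē t * a (1ᶠ -ᶠ t)) * inv b (1ᶠ -ᶠ (z *ᶠ t)))))
          ≈⟨ sumF-cong (λ y → sumF-cong (λ t → solve 7 (λ e f c x g y' z → ((e :* (f :* c)) :* x) :* ((g :* y') :* z) :=
               (e :* g) :* ((y' :* x) :* ((c :* f) :* z))) refl _ _ _ _ _ _ _)) ⟩
        product-integral ∎
        where
        cancel-ē : ∀ x → inv ē x * (a x * ē x) ≈ a x
        cancel-ē = by-units (0-*ˡ (inv-0 ē)) (at0 ca) (λ x x≢0 →
          trans (solve 3 (λ i a f → i :* (a :* f) := a :* (f :* i)) refl _ _ _) (drop-1 (χ·inv cē x≢0)))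

      -- The origin of κ: since z α - α = -w α with w = 1 - z, scaling α and β by w makes every term
      -- of `num` and `den` divisible by w² except -z, which becomes w² κ. The factor w² then
      -- cancels between e and ē.
      collapsed-core : collapsed ≈ (inv a w * inv b w) * R
      collapsed-core = begin
        collapsed
          ≈⟨ sumF-scale 1-z≢0 _ ⟨
        sumF (λ α → sumF (λ β → f (w *ᶠ α) β))
          ≈⟨ sumF-cong (λ α → sumF-scale 1-z≢0 _) ⟨
        sumF (λ α → sumF (λ β → f (w *ᶠ α) (w *ᶠ β)))
          ≈⟨ sumF-cong (λ α → sumF-cong (λ β → begin
               f (w *ᶠ α) (w *ᶠ β)
                 ≈⟨ *-cong (*-cong (at* (isChar-inv ca) w α) (at* (isChar-inv cb) w β))
                      (*-cong (trans (reflexive (≡.cong e (num-scaled α β))) (at* ce _ _)) (trans (reflexive (≡.cong ē (den-scaled α β))) (at* cē _ _))) ⟩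
               ((inv a w * inv a α) * (inv b w * inv b β)) * ((e (w *ᶠ w) * e (((α *ᶠ β) -ᶠ α) +ᶠ κ)) * (ē (w *ᶠ w) * ē (((α *ᶠ β) -ᶠ β) +ᶠ κ)))
                 ≈⟨ solve 8 (λ x a y b e m f n → ((x :* a) :* (y :* b)) :* ((e :* m) :* (f :* n)) := ((x :* y) :* ((a :* b) :* (m :* n))) :* (e :* f)) refl _ _ _ _ _ _ _ _ ⟩
               ((inv a w * inv b w) * ((inv a α * inv b β) * (e (((α *ᶠ β) -ᶠ α) +ᶠ κ) * ē (((α *ᶠ β) -ᶠ β) +ᶠ κ)))) * (e (w *ᶠ w) * ē (w *ᶠ w))
                 ≈⟨ drop-1 (χ·inv ce w²≢0) ⟩
               (inv a w * inv b w) * ((inv a α * inv b β) * (e (((α *ᶠ β) -ᶠ α) +ᶠ κ) * ē (((α *ᶠ β) -ᶠ β) +ᶠ κ))) ∎)) ⟩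
        sumF (λ α → sumF (λ β → (inv a w * inv b w) * ((inv a α * inv b β) * (e (((α *ᶠ β) -ᶠ α) +ᶠ κ) * ē (((α *ᶠ β) -ᶠ β) +ᶠ κ)))))
          ≈⟨ trans (sumF-cong (λ α → sumF-*ˡ _ _)) (sumF-*ˡ _ _) ⟩
        (inv a w * inv b w) * R ∎
        where
        f : 𝔽 → 𝔽 → Carrier
        f α β = (inv a α * inv b β) * (e (num α β) * ē (den α β))
        num-scaled : ∀ α β → num (w *ᶠ α) (w *ᶠ β) ≡ (w *ᶠ w) *ᶠ (((α *ᶠ β) -ᶠ α) +ᶠ κ)
        num-scaled α β = ≡.trans (solveᶠ 3 (λ z α β → (((:1ᶠ :+ᶠ :-ᶠ z) :*ᶠ α) :*ᶠ ((:1ᶠ :+ᶠ :-ᶠ z) :*ᶠ β) :+ᶠ :-ᶠ ((:1ᶠ :+ᶠ :-ᶠ z) :*ᶠ α)) :+ᶠ ((z :*ᶠ ((:1ᶠ :+ᶠ :-ᶠ z) :*ᶠ α)) :+ᶠ :-ᶠ z) :=ᶠ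
            (((:1ᶠ :+ᶠ :-ᶠ z) :*ᶠ (:1ᶠ :+ᶠ :-ᶠ z)) :*ᶠ ((α :*ᶠ β) :+ᶠ :-ᶠ α)) :+ᶠ :-ᶠ z) ≡.refl z α β)
          (≡.trans (≡.cong (((w *ᶠ w) *ᶠ ((α *ᶠ β) -ᶠ α)) +ᶠ_) (≡.sym κw²)) (solveᶠ 3 (λ w m k → (w :*ᶠ m) :+ᶠ k :*ᶠ w :=ᶠ w :*ᶠ (m :+ᶠ k)) ≡.refl (w *ᶠ w) _ κ))
        den-scaled : ∀ α β → den (w *ᶠ α) (w *ᶠ β) ≡ (w *ᶠ w) *ᶠ (((α *ᶠ β) -ᶠ β) +ᶠ κ)
        den-scaled α β = ≡.trans (solveᶠ 3 (λ z α β → (((:1ᶠ :+ᶠ :-ᶠ z) :*ᶠ α) :*ᶠ ((:1ᶠ :+ᶠ :-ᶠ z) :*ᶠ β) :+ᶠ :-ᶠ ((:1ᶠ :+ᶠ :-ᶠ z) :*ᶠ β)) :+ᶠ ((z :*ᶠ ((:1ᶠ :+ᶠ :-ᶠ z) :*ᶠ β)) :+ᶠ :-ᶠ z) :=ᶠ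
            (((:1ᶠ :+ᶠ :-ᶠ z) :*ᶠ (:1ᶠ :+ᶠ :-ᶠ z)) :*ᶠ ((α :*ᶠ β) :+ᶠ :-ᶠ β)) :+ᶠ :-ᶠ z) ≡.refl z α β)
          (≡.trans (≡.cong (((w *ᶠ w) *ᶠ ((α *ᶠ β) -ᶠ β)) +ᶠ_) (≡.sym κw²)) (solveᶠ 3 (λ w m k → (w :*ᶠ m) :+ᶠ k :*ᶠ w :=ᶠ w :*ᶠ (m :+ᶠ k)) ≡.refl (w *ᶠ w) _ κ))

      module _ {χ : Char} (cχ : IsChar χ) where
        -- Up to q and signs, the binomials with upper parameters s and s φ are J(T, X) and J(T φ,
        -- Y). The choice is tied to X Y = T̄², the relation under which `jacobi-pair` merges them.
        χ̄ X Y T : Char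
        χ̄ = inv χ
        X = inv (c · χ)
        Y = inv ((a · ē) · χ)
        T = s · χ

        cχ̄ : IsChar χ̄
        cχ̄ = isChar-inv cχ
        cX : IsChar X
        cX = isChar-inv (isChar-· cc cχ)
        cY : IsChar Y
        cY = isChar-inv (isChar-· caē cχ)
        cT : IsChar T
        cT = isChar-· cs cχ

        X-value : ∀ x → X x ≈ inv c x * χ̄ x
        X-value = inv-· c χ

        Y-value : ∀ x → Y x ≈ (inv a x * e x) * χ̄ x
        Y-value x = trans (inv-· (a · ē) χ x) (*-congʳ (trans (inv-· a ē x) (*-congˡ (inv-ē x))))

        inv-c : ∀ x → inv c x ≈ inv D x * inv D x
        inv-c = inv-· D D

        inv-a : ∀ x → inv a x ≈ inv A x * inv A x
        inv-a = inv-· A A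

        u·χ̄ : (u · χ̄) ≗ᶜ X
        u·χ̄ = by-units (at0 (isChar-· (isChar-· (isChar-inv cb) cē) cχ̄)) (at0 cX) (λ x x≢0 → begin
          (inv b x * ē x) * χ̄ x  ≈⟨ *-congʳ (*-congʳ (inv-b x)) ⟩
          ((inv c x * e x) * ē x) * χ̄ x  ≈⟨ *-congʳ (trans (*-assoc _ _ _) (drop-1 (χ·inv ce x≢0))) ⟩
          inv c x * χ̄ x  ≈⟨ X-value x ⟨
          X x  ∎)

        v·χ̄ : (v · χ̄) ≗ᶜ Y
        v·χ̄ x = sym (Y-value x)

        ab-χ : ((inv a · inv b) · χ̄) ≗ᶜ inv (ab · χ)
        ab-χ x = sym (trans (inv-· ab χ x) (*-congʳ (trans (inv-· (a · c) ē x) (trans (*-cong (inv-· a c x) (inv-ē x))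
          (trans (*-assoc _ _ _) (*-congˡ (sym (inv-b x))))))))

        XY≗ : (X · Y) ≗ᶜ inv (sq T)
        XY≗ = by-units (at0 (isChar-· cX cY)) (inv-0 (sq T)) (λ x x≢0 → inv-unique (isChar-· cT cT) x≢0 (begin
          (T x * T x) * (X x * Y x)
            ≈⟨ *-congˡ (*-cong (trans (X-value x) (*-congʳ (inv-c x))) (trans (Y-value x) (*-congʳ (*-congʳ (inv-a x))))) ⟩
          ((((A x * D x) * inv E x) * χ x) * (((A x * D x) * inv E x) * χ x)) * (((inv D x * inv D x) * χ̄ x) * (((inv A x * inv A x) * (E x * E x)) * χ̄ x))
            ≈⟨ solve 8 (λ A D E χ A' D' E' χ' → ((((A :* D) :* E') :* χ) :* (((A :* D) :* E') :* χ)) :* (((D' :* D') :* χ') :* (((A' :* A') :* (E :* E)) :* χ')) :=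
                 (((A :* A') :* (D :* D')) :* ((E :* E') :* (χ :* χ'))) :* (((A :* A') :* (D :* D')) :* ((E :* E') :* (χ :* χ')))) refl _ _ _ _ _ _ _ _ ⟩
          pairs x * pairs x
            ≈⟨ *-≈1 (pairs-1 x≢0) (pairs-1 x≢0) ⟩
          1# ∎))
          where
          pairs : 𝔽 → Carrier
          pairs x = ((A x * inv A x) * (D x * inv D x)) * ((E x * inv E x) * (χ x * χ̄ x))
          pairs-1 : ∀ {x} → x ≢ 0ᶠ → pairs x ≈ 1#
          pairs-1 x≢0 = *-≈1 (*-≈1 (χ·inv cA x≢0) (χ·inv cD x≢0)) (*-≈1 (χ·inv cE x≢0) (χ·inv cχ x≢0))

        -- χ cancels here and in `TφY≗`; this is why the Gauss sums `g₁` and `g₂` are constants that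
        -- come out of the sum over χ.
        TX≗ : (T · X) ≗ᶜ (A · inv E · inv D)
        TX≗ = by-units (at0 (isChar-· cT cX)) (at0 (isChar-· (isChar-· cA (isChar-inv cE)) (isChar-inv cD))) (λ x x≢0 → begin
          T x * X x
            ≈⟨ *-congˡ (trans (X-value x) (*-congʳ (inv-c x))) ⟩
          (((A x * D x) * inv E x) * χ x) * ((inv D x * inv D x) * χ̄ x)
            ≈⟨ solve 6 (λ A D E' χ D' χ' → (((A :* D) :* E') :* χ) :* ((D' :* D') :* χ') := ((A :* E') :* D') :* ((D :* D') :* (χ :* χ'))) refl _ _ _ _ _ _ ⟩
          ((A x * inv E x) * inv D x) * ((D x * inv D x) * (χ x * χ̄ x))
            ≈⟨ drop-1 (*-≈1 (χ·inv cD x≢0) (χ·inv cχ x≢0)) ⟩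
          (A x * inv E x) * inv D x ∎)

        TφY≗ : ((T · φ) · Y) ≗ᶜ (inv A · E · D · φ)
        TφY≗ = by-units (at0 (isChar-· (isChar-· cT isChar-φ) cY)) (0-*ʳ φ-0) (λ x x≢0 → begin
          (T x * φ x) * Y x
            ≈⟨ *-congˡ (trans (Y-value x) (*-congʳ (*-congʳ (inv-a x)))) ⟩
          ((((A x * D x) * inv E x) * χ x) * φ x) * (((inv A x * inv A x) * (E x * E x)) * χ̄ x)
            ≈⟨ solve 8 (λ A D E' χ f A' E χ' → ((((A :* D) :* E') :* χ) :* f) :* (((A' :* A') :* (E :* E)) :* χ') :=
                 (((A' :* E) :* D) :* f) :* (((A :* A') :* (E :* E')) :* (χ :* χ'))) refl _ _ _ _ _ _ _ _ ⟩
          (((inv A x * E x) * D x) * φ x) * (((A x * inv A x) * (E x * inv E x)) * (χ x * χ̄ x))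
            ≈⟨ drop-1 (*-≈1 (*-≈1 (χ·inv cA x≢0) (χ·inv cE x≢0)) (χ·inv cχ x≢0)) ⟩
          ((inv A x * E x) * D x) * φ x ∎)

        [TX]²≉ε : ¬ (sq (T · X) ≗ᶜ ε)
        [TX]²≉ε h = A²D̄²Ē²≉ε (λ x → begin
          ((A x * A x) * inv c x) * inv e x
            ≈⟨ *-cong (*-congˡ (inv-c x)) (inv-· E E x) ⟩
          ((A x * A x) * (inv D x * inv D x)) * (inv E x * inv E x)
            ≈⟨ solve 3 (λ A D' E' → ((A :* A) :* (D' :* D')) :* (E' :* E') := ((A :* E') :* D') :* ((A :* E') :* D')) refl _ _ _ ⟩
          ((A x * inv E x) * inv D x) * ((A x * inv E x) * inv D x)
            ≈⟨ *-cong (TX≗ x) (TX≗ x) ⟨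
          sq (T · X) x
            ≈⟨ h x ⟩
          ε x ∎)

        Sφχ : ((s · φ) · χ) ≗ᶜ (T · φ)
        Sφχ x = solve 3 (λ s f c → (s :* f) :* c := (s :* c) :* f) refl _ _ _

        pair : ((jacobi T X * jacobi ((s · φ) · χ) Y) * (g₁ * g₂)) * T 4ᶠ ≈ Q * (jacobi (u · χ̄) (v · χ̄) * gauss φ)
        pair = begin
          ((jacobi T X * jacobi ((s · φ) · χ) Y) * (g₁ * g₂)) * T 4ᶠ
            ≈⟨ *-congʳ (*-cong (*-congˡ (jacobi-cong {B = Y} Sφχ (λ _ → refl))) (sym (*-cong (gauss-cong TX≗) (gauss-cong TφY≗)))) ⟩
          ((jacobi T X * jacobi (T · φ) Y) * (gauss (T · X) * gauss ((T · φ) · Y))) * T 4ᶠ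
            ≈⟨ jacobi-pair 2≢0 cT cX cY XY≗ [TX]²≉ε ⟩
          Q * (jacobi X Y * gauss φ)
            ≈⟨ *-congˡ (*-congʳ (jacobi-cong u·χ̄ v·χ̄)) ⟨
          Q * (jacobi (u · χ̄) (v · χ̄) * gauss φ) ∎

        Q*binom-· : ∀ (B C : Char) → C -1ᶠ ≈ 1# → Q * binom B (C · χ) ≈ χ -1ᶠ * jacobi B (inv (C · χ))
        Q*binom-· B C h = trans (Q*binom B (C · χ)) (*-congʳ (trans (*-congʳ h) (*-identityˡ _)))

        term : Carrier
        term = (binom (a · χ) χ * prodBinom (b ∷ s ∷ s · φ ∷ []) (ab ∷ c ∷ a · ē ∷ []) χ) * χ (4ᶠ *ᶠ κ)

        -- Four binomials take q⁴ and leave χ(-1)⁴ = 1. The factor T(4) of `jacobi-pair` splits into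
        -- s(4), the constant in the theorem, and χ(4), which turns χ(κ) into χ(4κ).
        term-value : (((Q * Q) * (Q * Q)) * term) * (s 4ᶠ * (g₁ * g₂)) ≈ (Q * gauss φ) * jacobi-product χ
        term-value = begin
          (((Q * Q) * (Q * Q)) * ((binom (a · χ) χ * (β₂ * (β₃ * (β₄ * 1#)))) * χ (4ᶠ *ᶠ κ))) * (s 4ᶠ * (g₁ * g₂))
            ≈⟨ *-congʳ (*-congˡ (*-congˡ (at* cχ 4ᶠ κ))) ⟩
          (((Q * Q) * (Q * Q)) * ((binom (a · χ) χ * (β₂ * (β₃ * (β₄ * 1#)))) * (χ 4ᶠ * χ κ))) * (s 4ᶠ * (g₁ * g₂))
            ≈⟨ solve 9 (λ q b₁ b₂ b₃ b₄ f k S g → (((q :* q) :* (q :* q)) :* ((b₁ :* (b₂ :* (b₃ :* (b₄ :* :1)))) :* (f :* k))) :* (S :* g) :=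
                 (((q :* b₁) :* (q :* b₂)) :* ((q :* b₃) :* (q :* b₄))) :* ((S :* f) :* (g :* k))) refl Q (binom (a · χ) χ) β₂ β₃ β₄ (χ 4ᶠ) (χ κ) (s 4ᶠ) (g₁ * g₂) ⟩
          (((Q * binom (a · χ) χ) * (Q * β₂)) * ((Q * β₃) * (Q * β₄))) * (T 4ᶠ * ((g₁ * g₂) * χ κ))
            ≈⟨ *-congʳ (*-cong (*-cong (Q*binom (a · χ) χ) (Q*binom-· (b · χ) ab (*-≈1 (*-≈1 a[-1] c[-1]) ē[-1])))
                               (*-cong (Q*binom-· T c c[-1]) (Q*binom-· ((s · φ) · χ) (a · ē) (*-≈1 a[-1] ē[-1])))) ⟩
          (((σ * J₁) * (σ * J₂)) * ((σ * J₃) * (σ * J₄))) * (T 4ᶠ * ((g₁ * g₂) * χ κ))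
            ≈⟨ solve 8 (λ s j₁ j₂ j₃ j₄ t g k → (((s :* j₁) :* (s :* j₂)) :* ((s :* j₃) :* (s :* j₄))) :* (t :* (g :* k)) :=
                 ((s :* s) :* (s :* s)) :* ((k :* (j₁ :* j₂)) :* (((j₃ :* j₄) :* g) :* t))) refl σ J₁ J₂ J₃ J₄ (T 4ᶠ) (g₁ * g₂) (χ κ) ⟩
          ((σ * σ) * (σ * σ)) * ((χ κ * (J₁ * J₂)) * (((J₃ * J₄) * (g₁ * g₂)) * T 4ᶠ))
            ≈⟨ trans (*-congʳ (*-≈1 (χ[-1]² cχ) (χ[-1]² cχ))) (*-identityˡ _) ⟩
          (χ κ * (J₁ * J₂)) * (((J₃ * J₄) * (g₁ * g₂)) * T 4ᶠ)
            ≈⟨ *-cong (*-congˡ (*-congˡ (jacobi-cong {b · χ} {b · χ} (λ _ → refl) (λ x → sym (ab-χ x))))) pair ⟩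
          (χ κ * (J₁ * jacobi (b · χ) ((inv a · inv b) · χ̄))) * (Q * (jacobi (u · χ̄) (v · χ̄) * gauss φ))
            ≈⟨ solve 6 (λ k i j q h g → (k :* (i :* j)) :* (q :* (h :* g)) := (q :* g) :* (k :* ((i :* j) :* h))) refl _ _ _ Q _ (gauss φ) ⟩
          (Q * gauss φ) * jacobi-product χ ∎
          where
          σ  = χ -1ᶠ
          β₂ = binom (b · χ) (ab · χ)
          β₃ = binom T (c · χ)
          β₄ = binom ((s · φ) · χ) ((a · ē) · χ)
          J₁ = jacobi (a · χ) χ̄
          J₂ = jacobi (b · χ) (inv (ab · χ))
          J₃ = jacobi T X
          J₄ = jacobi ((s · φ) · χ) Y

      -- Of the q⁴ for the four binomials, one q comes from the normalisation of the series and one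
      -- is returned by `jacobi-pair`, so q² remains.
      H₃-core : ((Q * Q) * (s 4ᶠ * (g₁ * g₂))) * H₃ (4ᶠ *ᶠ κ) ≈ gauss φ * R
      H₃-core = KP.*-cancelˡ (KP.*-≉0 Q≉0 N≉0) (begin
        (Q * N) * (((Q * Q) * G) * H₃ (4ᶠ *ᶠ κ))
          ≈⟨ solve 4 (λ q n g h → (q :* n) :* (((q :* q) :* g) :* h) := (g :* (q :* (q :* q))) :* (n :* h)) refl Q N G _ ⟩
        (G * (Q * (Q * Q))) * (N * H₃ (4ᶠ *ᶠ κ))
          ≈⟨ *-congˡ (N*hyp a (b ∷ s ∷ s · φ ∷ []) (ab ∷ c ∷ a · ē ∷ []) (4ᶠ *ᶠ κ)) ⟩
        (G * (Q * (Q * Q))) * (Q * ∑ chars t)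
          ≈⟨ solve 3 (λ q g x → (g :* (q :* (q :* q))) :* (q :* x) := (((q :* q) :* (q :* q)) :* x) :* g) refl Q G _ ⟩
        (((Q * Q) * (Q * Q)) * ∑ chars t) * G
          ≈⟨ trans (∑-*ʳ chars G _) (*-congʳ (∑-*ˡ chars _ t)) ⟨
        ∑ chars (λ χ → (((Q * Q) * (Q * Q)) * t χ) * G)
          ≈⟨ ∑-cong-All (All.map term-value chars-IsChar) ⟩
        ∑ chars (λ χ → (Q * gauss φ) * jacobi-product χ)
          ≈⟨ ∑-*ˡ chars _ _ ⟩
        (Q * gauss φ) * ∑ chars jacobi-product
          ≈⟨ *-congˡ N*core ⟨
        (Q * gauss φ) * (N * R)
          ≈⟨ solve 4 (λ q g n r → (q :* g) :* (n :* r) := (q :* n) :* (g :* r)) refl Q _ N _ ⟩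
        (Q * N) * (gauss φ * R) ∎)
        where
        G = s 4ᶠ * (g₁ * g₂)
        t : Char → Carrier
        t χ = (binom (a · χ) χ * prodBinom (b ∷ s ∷ s · φ ∷ []) (ab ∷ c ∷ a · ē ∷ []) χ) * χ (4ᶠ *ᶠ κ)

      -- As z ≠ 1, the only zero of 1 - z² is z = -1, and there e(z) = 1.
      boundary : Q * (e z * δ (1ᶠ -ᶠ (z *ᶠ z))) ≈ Q * ι z=-1
      boundary = *-congˡ (cases z=-1
        (λ h → trans (*-≈1 (trans (reflexive (≡.cong e h)) e[-1]) (trans (reflexive (≡.cong δ (1-z² h))) (reflexive isZero-0))) (sym (ι-yes z=-1 h)))
        (λ n → trans (*-congˡ (reflexive (isZero-≢0 (nonzero n)))) (trans (zeroʳ _) (sym (ι-no z=-1 n)))))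
        where
        1-z² : z ≡ -1ᶠ → 1ᶠ -ᶠ (z *ᶠ z) ≡ 0ᶠ
        1-z² h = ≡.trans (≡.cong (λ y → 1ᶠ -ᶠ (y *ᶠ y)) h) (solveᶠ 0 (:1ᶠ :+ᶠ :-ᶠ (:-ᶠ :1ᶠ :*ᶠ :-ᶠ :1ᶠ) :=ᶠ :0ᶠ) ≡.refl)
        nonzero : z ≢ -1ᶠ → 1ᶠ -ᶠ (z *ᶠ z) ≢ 0ᶠ
        nonzero n h = FP.*-≢0 1-z≢0 (FP.≢⇒-‿≢0 n) (≡.trans (solveᶠ 1 (λ z → (:1ᶠ :+ᶠ :-ᶠ z) :*ᶠ (z :+ᶠ :-ᶠ (:-ᶠ :1ᶠ)) :=ᶠ :1ᶠ :+ᶠ :-ᶠ (z :*ᶠ z)) ≡.refl z) h)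

      prefactor-w : (inv a · inv c · e) w ≈ inv a w * inv b w
      prefactor-w = trans (*-assoc _ _ _) (*-congˡ (sym (inv-b w)))

      argument : (-ᶠ (4ᶠ *ᶠ z)) *ᶠ (w *ᶠ w) ⁻¹ᶠ ≡ 4ᶠ *ᶠ κ
      argument = solveᶠ 3 (λ f z i → (:-ᶠ (f :*ᶠ z)) :*ᶠ i :=ᶠ f :*ᶠ (:-ᶠ z :*ᶠ i)) ≡.refl 4ᶠ z _

      formula-≢0 : H₁ z * H₂ z ≈ ((e z / Q) * δ (1ᶠ -ᶠ (z *ᶠ z))) +
        ((((s 4ᶠ * (inv a · inv c · e) w) * g₁) * g₂) / gauss φ) * H₃ ((-ᶠ (4ᶠ *ᶠ z)) *ᶠ (w *ᶠ w) ⁻¹ᶠ)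
      formula-≢0 = KP.*-cancelˡ (KP.*-≉0 Q≉0 Q≉0) (begin
        (Q * Q) * (H₁ z * H₂ z)
          ≈⟨ solve 3 (λ q x y → (q :* q) :* (x :* y) := (q :* x) :* (q :* y)) refl Q _ _ ⟩
        (Q * H₁ z) * (Q * H₂ z)
          ≈⟨ trans H-product product-collapsed ⟩
        collapsed + Q * ι z=-1
          ≈⟨ +-comm _ _ ⟩
        Q * ι z=-1 + collapsed
          ≈⟨ +-cong (sym first) (sym second) ⟩
        (Q * Q) * ((e z / Q) * δz) + (Q * Q) * ((M / gauss φ) * H₃ arg)
          ≈⟨ distribˡ _ _ _ ⟨
        (Q * Q) * ((e z / Q) * δz + (M / gauss φ) * H₃ arg) ∎)
        where
        δz = δ (1ᶠ -ᶠ (z *ᶠ z))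
        arg = (-ᶠ (4ᶠ *ᶠ z)) *ᶠ (w *ᶠ w) ⁻¹ᶠ
        M = ((s 4ᶠ * (inv a · inv c · e) w) * g₁) * g₂
        gφ≉0 : ¬ (gauss φ ≈ 0#)
        gφ≉0 = gauss≉0 isChar-φ φ≉ε
        first : (Q * Q) * ((e z / Q) * δz) ≈ Q * ι z=-1
        first = begin
          (Q * Q) * ((e z / Q) * δz)  ≈⟨ solve 3 (λ q x d → (q :* q) :* (x :* d) := q :* ((x :* q) :* d)) refl Q _ _ ⟩
          Q * (((e z / Q) * Q) * δz)  ≈⟨ *-congˡ (*-congʳ (KP./-* (e z) Q≉0)) ⟩
          Q * (e z * δz)  ≈⟨ boundary ⟩
          Q * ι z=-1  ∎
        second : (Q * Q) * ((M / gauss φ) * H₃ arg) ≈ collapsed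
        second = KP.*-cancelˡ gφ≉0 (begin
          gauss φ * ((Q * Q) * ((M / gauss φ) * H₃ arg))
            ≈⟨ solve 4 (λ g q m h → g :* ((q :* q) :* (m :* h)) := (q :* q) :* ((m :* g) :* h)) refl _ Q _ _ ⟩
          (Q * Q) * (((M / gauss φ) * gauss φ) * H₃ arg)
            ≈⟨ *-congˡ (*-cong (trans (KP./-* M gφ≉0) (*-congʳ (*-congʳ (*-congˡ prefactor-w)))) (reflexive (≡.cong H₃ argument))) ⟩
          (Q * Q) * ((((s 4ᶠ * (inv a w * inv b w)) * g₁) * g₂) * H₃ (4ᶠ *ᶠ κ))
            ≈⟨ solve 6 (λ q s x g h t → (q :* q) :* ((((s :* x) :* g) :* h) :* t) := x :* (((q :* q) :* (s :* (g :* h))) :* t)) refl Q _ _ _ _ _ ⟩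
          (inv a w * inv b w) * (((Q * Q) * (s 4ᶠ * (g₁ * g₂))) * H₃ (4ᶠ *ᶠ κ))
            ≈⟨ *-congˡ H₃-core ⟩
          (inv a w * inv b w) * (gauss φ * R)
            ≈⟨ solve 3 (λ x g r → x :* (g :* r) := g :* (x :* r)) refl _ _ _ ⟩
          gauss φ * ((inv a w * inv b w) * R)
            ≈⟨ *-congˡ collapsed-core ⟨
          gauss φ * collapsed ∎)

    hyp-0 : ∀ {n} A₀ (As Bs : Vec Char n) → hyp A₀ As Bs 0ᶠ ≈ 0#
    hyp-0 A₀ As Bs = 0-*ʳ (trans (∑-cong-All (All.map (λ cχ → 0-*ʳ (at0 cχ)) chars-IsChar)) (∑-zero chars))

    formula : ∀ z → z ≢ 1ᶠ → H₁ z * H₂ z ≈ ((e z / Q) * δ (1ᶠ -ᶠ (z *ᶠ z))) +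
      ((((s 4ᶠ * (inv a · inv c · e) (1ᶠ -ᶠ z)) * g₁) * g₂) / gauss φ) * H₃ ((-ᶠ (4ᶠ *ᶠ z)) *ᶠ ((1ᶠ -ᶠ z) *ᶠ (1ᶠ -ᶠ z)) ⁻¹ᶠ)
    formula z z≢1 = cases (z ≟ᶠ 0ᶠ)
      -- At z = 0 all the series vanish, because even ε is 0 at 0, and δ(1) = 0.
      (λ { ≡.refl → trans (0-*ˡ (hyp-0 a (e ∷ []) (c ∷ []))) (sym (trans (+-cong
            (0-*ʳ (reflexive (isZero-≢0 (λ h → FP.1≢0 (≡.trans (solveᶠ 0 (:1ᶠ :=ᶠ :1ᶠ :+ᶠ :-ᶠ (:0ᶠ :*ᶠ :0ᶠ)) ≡.refl) h)))))
            (0-*ʳ (trans (reflexive (≡.cong H₃ (solveᶠ 2 (λ f i → (:-ᶠ (f :*ᶠ :0ᶠ)) :*ᶠ i :=ᶠ :0ᶠ) ≡.refl 4ᶠ _)))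
              (hyp-0 a (b ∷ s ∷ s · φ ∷ []) (ab ∷ c ∷ a · ē ∷ []))))) (+-identityʳ 0#))) })
      (λ z≢0 → formula-≢0 z≢0 z≢1)

theorem1p4 : (F : FiniteField) (K : CharZeroField) (p r : ℕ)
  (ζ : CharZeroField.Carrier K)
  (chars : List (FiniteField.Carrier F → CharZeroField.Carrier K)) →
  let open Setup F K p r ζ chars in
  Prime p → p ≢ 2 → q ≡ p ^ r →
  -- ζ is a primitive p-th root of unity
  (ζ ^K p) K.≈ K.1# → ¬ (ζ K.≈ K.1#) →
  -- chars enumerates all multiplicative characters, without repetition
  All IsChar chars →
  (∀ χ → IsChar χ → Any (λ ψ → χ ≗ᶜ ψ) chars) →
  AllPairs (λ χ ψ → ¬ (χ ≗ᶜ ψ)) chars →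
  length chars ≡ q ∸ 1 →
  (A D E : Char) → IsChar A → IsChar D → IsChar E →
  ¬ (sq A ≗ᶜ ε) → ¬ (sq E ≗ᶜ ε) →
  ¬ ((sq A · inv (sq D) · inv (sq E)) ≗ᶜ ε) →
  ¬ ((sq A · sq D · inv (sq E)) ≗ᶜ ε) →
  ¬ (sq A ≗ᶜ sq D) → ¬ (sq D ≗ᶜ sq E) →
  (z : FiniteField.Carrier F) → z ≢ F.1# →
  let one-z = F.1# F.+ (F.- z)
      four  = F.1# F.+ (F.1# F.+ (F.1# F.+ F.1#))
      arg   = (F.- (four F.* z)) F.* ((one-z F.* one-z) F.⁻¹)
  in
  (hyp (sq A) (sq E ∷ []) (sq D ∷ []) z
     K.* hyp (sq D · inv (sq E)) (inv (sq E) ∷ []) (sq A · inv (sq E) ∷ []) z)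
  K.≈
  (((sq E z K./ K.fromℕ q) K.* δ (F.1# F.+ (F.- (z F.* z))))
   K.+ (((((A · D · inv E) four K.* (inv (sq A) · inv (sq D) · sq E) one-z)
            K.* gauss (A · inv E · inv D))
            K.* gauss (inv A · E · D · φ))
          K./ gauss φ)
       K.* hyp (sq A)
               (sq D · inv (sq E) ∷ A · D · inv E ∷ A · D · inv E · φ ∷ [])
               (sq A · sq D · inv (sq E) ∷ sq D ∷ sq A · inv (sq E) ∷ [])
               arg)
theorem1p4 F K p r ζ chars p-prime p≢2 q≡p^r ζ^p≈1 ζ≉1 isChar complete distinct length≡ A D E cA cD cE =
  ProductFormula.formula F K p r ζ chars θ-+ θ-0 sumF-θ 2≢0 isChar complete distinct length≡ cA cD cE
  where open TraceCharacter.PrimePower F K p r ζ chars p-prime p≢2 q≡p^r ζ^p≈1 ζ≉1
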